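{- (Abstraction Theorem) Let $\Delta \mid \Gamma \vdash \varphi : \mathsf{Specs}$ be a well-typed specification. If $\Delta \mid \Gamma \vdash \varphi$ is provable in the logic, then for all $(\rho,\eta_0,\eta_1,r) \in [\![\Delta]\!] \times [\![\Gamma]\!]^2 \times \mathcal{R}$ we have $(\rho,\eta_0,\eta_1,r) \models \varphi$.
   Context: **FM domain theory.** $\mathit{Loc}$ is a countably infinite set (locations). A permutation is a bijection $\pi$ of $\mathit{Loc}$ with $\pi(l)\neq l$ for only finitely many $l$; $\mathsf{perm}$ is the set of these. An FM-set is a set $A$ with an action $\cdot:\mathsf{perm}\times A\to A$ such that $\mathrm{id}\cdot a=a$, $\pi\cdot(\pi'\cdot a)=(\pi\circ\pi')\cdot a$, and every $a\in A$ is supported by some finite $L\subseteq\mathit{Loc}$, i.e. ($\forall l\in L.\ \pi(l)=l$) implies $\pi\cdot a=a$. The smallest supporting set is $\mathsf{supp}(a)$. An FM-poset is an FM-set with a partial order preserved by the action. A chain is finitely supported if one finite $L\subseteq\mathit{Loc}$ supports all its elements. An FM-cpo is an FM-poset in which every finitely supported $\omega$-chain has a least upper bound; morphisms are functions commuting with the action and preserving lubs of finitely supported chains. Products $A\times B$ are cartesian; the exponential $A\to B$ consists of the finitely supported (for $(\pi\cdot f)(a)=\pi\cdot f(\pi^{ -1}\cdot a)$) monotone functions preserving lubs of finitely supported chains, ordered pointwise. $A\rightharpoonup_{fin}B$ is the set of finite partial functions, with $f\sqsubseteq g$ iff $\mathrm{dom}(f)=\mathrm{dom}(g)$ and $f(a)\sqsubseteq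 g(a)$ for all $a\in \mathrm{dom}(f)$, and $(\pi\cdot f)(a)=\pi\cdot f(\pi^{ -1}\cdot a)$ if $a\in\pi(\mathrm{dom} f)$, undefined otherwise. **Semantic domains.** $\mathit{Val}=\mathit{Loc}+\mathit{Int}+\{\mathit{default}\}$ (discrete; $\pi$ acts on locations only); $\mathit{O}=\{\mathit{normal},\mathit{err}\}_\bot$ (flat, trivial action); $\mathit{G}=\{\mathit{normal},\bot\}\subseteq \mathit O$; $\mathit{Heap}=\mathit{Loc}\rightharpoonup_{fin}\mathit{Val}\times\mathit{Val}$; $\mathit{Cont}=(\mathit{Heap}\to\mathit{O})$. For heaps, $h\#h'$ means disjoint domains, and $h\bullet h'$ is the union of disjoint heaps (undefined otherwise); $[]$ is the empty heap. **Language.** Types $\tau::=\mathsf{com}\mid\mathsf{val}\to\tau\mid\tau\to\tau$. Expressions $E::=i\mid 0\mid 1\mid -1\mid E+E\mid E-E$, with stack variables $i,j,\dots$. Terms $M::=x\mid\lambda i.M\mid M\,E\mid\lambda x{:}\tau.M\mid M\,M\mid\mathsf{fix}\,M\mid\mathsf{if}\,(E{=}E)\,\mathsf{then}\,M\,\mathsf{else}\,M\mid M;M\mid\mathsf{let}\ i{=}\mathsf{new}\ \mathsf{in}\ M\mid\mathsf{free}(E)\mid\mathsf{let}\ i{=}E.f\ \mathsf{in}\ M\mid E.f:=E$ with $f\in\{0,1\}$ and identifiers $x,y,\dots$. $\Delta$ is a finite set of stack variables and $\Gamma$ a finite type environment for identifiers. $\Delta\vdash E$ means all variables of $E$ are in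 $\Delta$. $\Delta\mid\Gamma\vdash M:\tau$ is simple typing: identifiers have their type in $\Gamma$; $\lambda i.M:\mathsf{val}\to\tau$ if $\Delta,i\mid\Gamma\vdash M:\tau$; $M\,E:\tau$ if $M:\mathsf{val}\to\tau$; $\lambda x{:}\tau.M:\tau\to\tau'$ if $\Delta\mid\Gamma,x{:}\tau\vdash M:\tau'$; $M\,N:\tau$ if $M:\tau'\to\tau$, $N:\tau'$; $\mathsf{fix}\,M:\tau$ if $M:\tau\to\tau$; the remaining constructs have type $\mathsf{com}$, with subterms of type $\mathsf{com}$ (and $\Delta$ extended by $i$ for the bodies of the two let forms). **Semantics of the language.** $[\![\mathsf{com}]\!]=(\mathit{Heap}\times\mathit{Cont}\to\mathit{O})$, $[\![\mathsf{val}\to\tau]\!]=\mathit{Val}\to[\![\tau]\!]$, $[\![\tau\to\tau']\!]=[\![\tau]\!]\to[\![\tau']\!]$, $[\![\Delta]\!]=\prod_{i\in\Delta}\mathit{Val}$, $[\![\Gamma]\!]=\prod_{x:\tau\in\Gamma}[\![\tau]\!]$. For $\rho\in[\![\Delta]\!]$: $[\![i]\!]_\rho=\rho(i)$, constants denote integers, $[\![E_1\pm E_2]\!]_\rho$ is the integer sum/difference if both values are integers and $\mathit{default}$ otherwise. For terms, $[\![M]\!]_{\rho,\eta}\in[\![\tau]\!]$: identifiers, abstractions, applications are interpreted in the standard way, $\mathsf{fix}$ is least fixed point, the conditional chooses a branch according to whether $[\![E]\!]_\rho=[\![F]\!]_\rho$, and - $[\![M;N]\!]_{\rho,\eta}(h,k)=[\![M]\!]_{\rho,\eta}(h,\lambda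 h'.[\![N]\!]_{\rho,\eta}(h',k))$; - $[\![\mathsf{let}\ i{=}\mathsf{new}\ \mathsf{in}\ M]\!]_{\rho,\eta}(h,k)=[\![M]\!]_{\rho[i\to l],\eta}(h\bullet[l\to 0,0],k)$ for any $l\in\mathit{Loc}\setminus\mathsf{supp}(h,\rho,\eta,k)$ (the result is independent of $l$); - $[\![\mathsf{free}(E)]\!]_{\rho,\eta}(h,k)=\mathit{err}$ if $[\![E]\!]_\rho\notin\mathrm{dom}(h)$, else $k(h')$ where $h'$ is $h$ with cell $[\![E]\!]_\rho$ removed; - $[\![\mathsf{let}\ i{=}E.f\ \mathsf{in}\ M]\!]_{\rho,\eta}(h,k)=\mathit{err}$ if $[\![E]\!]_\rho\notin\mathrm{dom}(h)$, else $[\![M]\!]_{\rho[i\to v],\eta}(h,k)$ with $v$ the $f$-th component of $h([\![E]\!]_\rho)$; - $[\![E.f:=F]\!]_{\rho,\eta}(h,k)=\mathit{err}$ if $[\![E]\!]_\rho\notin\mathrm{dom}(h)$, else $k(h')$ where $h'$ is $h$ with the $f$-th component of cell $[\![E]\!]_\rho$ replaced by $[\![F]\!]_\rho$. **Assertions.** $P::=E=E\mid E\le E\mid E\mapsto E,E\mid\mathsf{emp}\mid P*P\mid P\wedge P\mid\neg P\mid\exists i.P$ (other classical connectives are defined), depending only on stack variables, with the standard semantics $[\![P]\!]_\rho\subseteq\mathit{Heap}$: $E\mapsto E_0,E_1$ holds of the heap consisting of the single cell at location $[\![E]\!]_\rho$ with contents $([\![E_0]\!]_\rho,[\![E_1]\!]_\rho)$;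 $\mathsf{emp}$ holds only of $[]$; $P*Q$ holds of $h$ iff $h=h_1\bullet h_2$ with $h_1\in[\![P]\!]_\rho$, $h_2\in[\![Q]\!]_\rho$; $E\le F$ compares integer values; the rest is classical, with $\exists i$ ranging over $\mathit{Val}$. Abbreviations: $E\mapsto -$ is $\exists i,j.E\mapsto i,j$; $E\mapsto -,E_1$ is $\exists i.E\mapsto i,E_1$; $E\mapsto E_0,-$ is $\exists i.E\mapsto E_0,i$ (bound variables fresh). **Specifications.** $\varphi::=\{P\}M\{Q\}\mid\varphi\otimes P\mid E=E\mid M=M\mid\varphi\wedge\varphi\mid\varphi\vee\varphi\mid\varphi\Rightarrow\varphi\mid\forall x{:}\tau.\varphi\mid\exists x{:}\tau.\varphi\mid\forall i.\varphi\mid\exists i.\varphi$, typed by $\Delta\mid\Gamma\vdash\varphi:\mathsf{Specs}$ in the evident way ($M:\mathsf{com}$ in triples; both sides of $M=N$ of the same type). **Relations and quadruples.** $\mathcal R$ is the set of binary relations $r$ on $\mathit{Heap}$ that are finitely supported (there is a finite $L\subseteq\mathit{Loc}$ such that whenever $\pi$ fixes $L$ pointwise, $h_0[r]h_1\iff(\pi\cdot h_0)[r](\pi\cdot h_1)$). $h_0[r*s]h_1$ iff there are splittings $h_0=n_0\bullet m_0$, $h_1=n_1\bullet m_1$ with $n_0[r]n_1$ and $m_0[s]m_1$. For a subset $D_0$ of an FM-cpo, $\mathsf{eq}(D_0)=\{(d,d)\mid d\in D_0\}$. $k_0[r\to\mathsf{eq}(\mathit{G})]k_1$ means $k_0(h_0)[\mathsf{eq}(\mathit{G})]k_1(h_1)$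 whenever $h_0[r]h_1$. For $c_0,c_1\in[\![\mathsf{com}]\!]$ and $r,s\in\mathcal R$, the semantic quadruple $[r](c_0,c_1)[s]$ holds iff for all $r'\in\mathcal R$, $h_0,h_1\in\mathit{Heap}$, $k_0,k_1\in\mathit{Cont}$: $h_0[r*r']h_1$ and $k_0[s*r'\to\mathsf{eq}(\mathit{G})]k_1$ imply $c_0(h_0,k_0)[\mathsf{eq}(\mathit{G})]c_1(h_1,k_1)$. **Satisfaction.** For $\rho\in[\![\Delta]\!]$, $\eta_0,\eta_1\in[\![\Gamma]\!]$, $r\in\mathcal R$: - $(\rho,\eta_0,\eta_1,r)\models\{P\}M\{Q\}$ iff $[\mathsf{eq}([\![P]\!]_\rho)*r]([\![M]\!]_{\rho,\eta_0},[\![M]\!]_{\rho,\eta_1})[\mathsf{eq}([\![Q]\!]_\rho)*r]$; - $(\rho,\eta_0,\eta_1,r)\models\varphi\otimes P$ iff $(\rho,\eta_0,\eta_1,r*\mathsf{eq}([\![P]\!]_\rho))\models\varphi$; - $\models E=F$ iff $[\![E]\!]_\rho=[\![F]\!]_\rho$; $\models M=N$ iff $[\![M]\!]_{\rho,\eta_j}=[\![N]\!]_{\rho,\eta_j}$ for $j=0,1$; - $(\rho,\eta_0,\eta_1,r)\models\varphi\Rightarrow\psi$ iff for all $s\in\mathcal R$, $(\rho,\eta_0,\eta_1,r*s)\models\varphi$ implies $(\rho,\eta_0,\eta_1,r*s)\models\psi$; - $\forall i$ / $\exists i$: for all / some $v\in\mathit{Val}$, $(\rho[i\to v],\eta_0,\eta_1,r)\models\varphi$;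 - $\forall x{:}\tau$ / $\exists x{:}\tau$: for all / some $m,n\in[\![\tau]\!]$, $(\rho,\eta_0[x\to m],\eta_1[x\to n],r)\models\varphi$; - $\wedge,\vee$ are interpreted pointwise as "and", "or". **The logic.** Its rules are all usual rules of first-order intuitionistic logic with equality (for formulas in contexts $\Delta\mid\Gamma$), together with the following (all well-typed instances; $\mathsf{fv}$ = free variables). Triples: 1. $(\forall i.\{P\}M\{Q\})\Rightarrow\{\exists i.P\}M\{\exists i.Q\}$, $i\notin\mathsf{fv}(M)$. 2. $(\{P\}M\{Q\}\wedge\{P'\}M\{Q'\})\Rightarrow\{P\vee P'\}M\{Q\vee Q'\}$. 3. $\{P\wedge E{=}F\}M\{Q\}\wedge\{P\wedge E{\neq}F\}N\{Q\}\Rightarrow\{P\}\mathsf{if}\,(E{=}F)\,\mathsf{then}\,M\,\mathsf{else}\,N\{Q\}$. 4. $\{P\}M\{P_0\}\wedge\{P_0\}N\{Q\}\Rightarrow\{P\}M;N\{Q\}$. 5. $(\forall i.\{P*i\mapsto 0,0\}M\{Q\})\Rightarrow\{P\}\mathsf{let}\ i{=}\mathsf{new}\ \mathsf{in}\ M\{Q\}$, $i\notin\mathsf{fv}(P,Q)$. 6. $(\forall i.\{P*E\mapsto i,E_1\}M\{Q\})\Rightarrow\{\exists i.P*E\mapsto i,E_1\}\mathsf{let}\ i{=}E.0\ \mathsf{in}\ M\{Q\}$, $i\notin\mathsf{fv}(E,Q)$. 7. $\{E\mapsto -\}\mathsf{free}(E)\{\mathsf{emp}\}$. 8. $\{E\mapsto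 -,E_1\}E.0:=F\{E\mapsto F,E_1\}$. 9. (Consequence) If $[\![P]\!]_\rho\subseteq[\![P']\!]_\rho$ and $[\![Q']\!]_\rho\subseteq[\![Q]\!]_\rho$ for all $\rho\in[\![\Delta]\!]$, infer $\Delta\mid\Gamma\vdash\{P'\}M\{Q'\}\Rightarrow\{P\}M\{Q\}$. Invariant extension: 10. $\varphi\Rightarrow\varphi\otimes P$; $\{P\}M\{P'\}\otimes Q\Leftrightarrow\{P*Q\}M\{P'*Q\}$; $(E=F)\otimes Q\Leftrightarrow E=F$; $(M=N)\otimes Q\Leftrightarrow M=N$; $(\varphi\otimes P)\otimes Q\Leftrightarrow\varphi\otimes(P*Q)$; $(\varphi\oplus\psi)\otimes P\Leftrightarrow(\varphi\otimes P)\oplus(\psi\otimes P)$ for $\oplus\in\{\Rightarrow,\wedge,\vee\}$; $(\kappa x{:}\tau.\varphi)\otimes P\Leftrightarrow\kappa x{:}\tau.\,\varphi\otimes P$ for $\kappa\in\{\forall,\exists\}$; $(\kappa i.\varphi)\otimes P\Leftrightarrow\kappa i.\,\varphi\otimes P$ for $\kappa\in\{\forall,\exists\}$, $i\notin\mathsf{fv}(P)$. Fixed-point induction: let $C::=[\,]\mid\lambda i.C\mid C\,E\mid\lambda x{:}\tau.C\mid C\,M\mid\mathsf{fix}\,C\mid C;M$ and $\gamma::=\{P\}C\{Q\}\mid\gamma\wedge\gamma\mid\forall x{:}\tau.\gamma\mid\forall i.\gamma$, with $\gamma(N)$ the capture-avoiding insertion of $N$ into the hole(s). 11. $(\forall x.\,\gamma(x)\Rightarrow\gamma(M\,x))\Rightarrow\gamma(\mathsf{fix}\,M)$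 ($x$ fresh). -}

module Defs where

open import Axiom.ExcludedMiddle using (ExcludedMiddle)
open import Data.Bool using (Bool; true; false; if_then_else_)
open import Data.Empty using (⊥-elim)
open import Data.Fin using (Fin; zero; suc)
open import Data.Fin.Patterns using (0F; 1F)
open import Data.Integer as ℤ using (ℤ; 0ℤ; 1ℤ; -1ℤ)
open import Data.List using (List; []; _∷_; _++_; map; concatMap)
open import Data.List.Membership.Propositional using (_∈_; _∉_)
open import Data.List.Membership.Propositional.Properties
  using (∈-++⁺ˡ; ∈-++⁺ʳ; ∈-map⁺; ∈-map⁻; ∈-concatMap⁺)
open import Data.List.Membership.DecPropositional using (_∈?_)
open import Data.List.Relation.Unary.Any as Any using (here; there)
open import Data.Maybe as Maybe using (Maybe; just; nothing; maybe′)
open import Data.Nat.ListAction using (sum)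
open import Data.Nat using (ℕ; zero; suc; _≤_)
import Data.Nat as ℕ
open import Data.Nat.Properties as ℕₚ using (_≟_)
open import Data.Product using (∃; _×_; _,_; proj₁; proj₂; ∃-syntax)
open import Data.Product.Relation.Binary.Pointwise.NonDependent
  using (×-setoid; ×-isPartialOrder)
open import Data.Sum using (_⊎_; inj₁; inj₂)
open import Data.Unit using (⊤)
open import Data.Vec as Vec using (Vec; []; _∷_; lookup)
open import Data.Vec.Properties as Vecₚ using ()
open import Function using (_∘_; _↔_; Inverse; _⇔_; mk⇔; Equivalence)
open import Function.Construct.Composition using (_↔-∘_)
open import Function.Construct.Identity using (↔-id)
open import Function.Construct.Symmetry using (↔-sym)
open import Level using (0ℓ; Lift)
open import Relation.Binary using (Setoid; IsPartialOrder)
open import Relation.Binary.PropositionalEquality as ≡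
  using (_≡_; _≢_; refl; sym; trans; cong; cong₂; subst)
open import Relation.Nullary using (¬_; Dec; yes; no; does)
open import Relation.Nullary.Decidable as Dec using ()

Loc : Set
Loc = ℕ

record Perm : Set where
  field
    bij   : Loc ↔ Loc
    moved : ∃ λ (L : List Loc) → ∀ {l} → l ∉ L → Inverse.to bij l ≡ l

  open Inverse bij public using (to; from; strictlyInverseˡ; strictlyInverseʳ)

open Perm public using (to; from)

to-from : ∀ π l → to π (from π l) ≡ l
to-from = Perm.strictlyInverseˡ

from-to : ∀ π l → from π (to π l) ≡ l
from-to = Perm.strictlyInverseʳ

to-injective : ∀ π {l l′} → to π l ≡ to π l′ → l ≡ l′
to-injective π {l} {l′} eq =
  trans (sym (from-to π l)) (trans (cong (from π) eq) (from-to π l′))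

Fixes : Perm → List Loc → Set
Fixes π L = ∀ {l} → l ∈ L → to π l ≡ l

idₚ : Perm
idₚ = record { bij = ↔-id Loc ; moved = [] , λ _ → refl }

infixr 9 _∘ₚ_

_∘ₚ_ : Perm → Perm → Perm
π ∘ₚ π′ = record
  { bij   = Perm.bij π ↔-∘ Perm.bij π′
  ; moved = proj₁ (Perm.moved π) ++ proj₁ (Perm.moved π′) , λ l∉ →
      trans (cong (to π) (proj₂ (Perm.moved π′) (l∉ ∘ ∈-++⁺ʳ _)))
            (proj₂ (Perm.moved π) (l∉ ∘ ∈-++⁺ˡ))
  }

infix 10 _⁻¹

_⁻¹ : Perm → Perm
π ⁻¹ = record
  { bij   = ↔-sym (Perm.bij π)
  ; moved = proj₁ (Perm.moved π) , λ {l} l∉ →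
      trans (cong (from π) (sym (proj₂ (Perm.moved π) l∉))) (from-to π l)
  }

fixes-⁻¹ : ∀ π {L} → Fixes π L → Fixes (π ⁻¹) L
fixes-⁻¹ π fix {l} l∈ = trans (cong (from π) (sym (fix l∈))) (from-to π l)

conjugate : Perm → Perm → Perm
conjugate π σ = π ⁻¹ ∘ₚ σ ∘ₚ π

conjugate-fixes : ∀ π σ {L} → Fixes σ (map (to π) L) → Fixes (conjugate π σ) L
conjugate-fixes π σ fix l∈ = trans (cong (from π) (fix (∈-map⁺ (to π) l∈))) (from-to π _)

swapLoc : Loc → Loc → Loc → Loc
swapLoc a b l with l ≟ a | l ≟ b
... | yes _ | _     = b
... | no  _ | yes _ = a
... | no  _ | no  _ = l

swapLoc-left : ∀ a b → swapLoc a b a ≡ b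
swapLoc-left a b with a ≟ a | a ≟ b
... | yes _   | _ = refl
... | no  a≢a | _ = ⊥-elim (a≢a refl)

swapLoc-right : ∀ a b → swapLoc a b b ≡ a
swapLoc-right a b with b ≟ a | b ≟ b
... | yes b≡a | _       = b≡a
... | no  _   | yes _   = refl
... | no  _   | no  b≢b = ⊥-elim (b≢b refl)

swapLoc-other : ∀ a b {l} → l ≢ a → l ≢ b → swapLoc a b l ≡ l
swapLoc-other a b {l} l≢a l≢b with l ≟ a | l ≟ b
... | yes l≡a | _       = ⊥-elim (l≢a l≡a)
... | no  _   | yes l≡b = ⊥-elim (l≢b l≡b)
... | no  _   | no  _   = refl

swapLoc-involutive : ∀ a b l → swapLoc a b (swapLoc a b l) ≡ l
swapLoc-involutive a b l = go (l ≟ a) (l ≟ b)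
  where
  go : Dec (l ≡ a) → Dec (l ≡ b) → swapLoc a b (swapLoc a b l) ≡ l
  go (yes refl) _          = trans (cong (swapLoc a b) (swapLoc-left a b)) (swapLoc-right a b)
  go (no _)     (yes refl) = trans (cong (swapLoc a b) (swapLoc-right a b)) (swapLoc-left a b)
  go (no l≢a)   (no l≢b)   =
    trans (cong (swapLoc a b) (swapLoc-other a b l≢a l≢b)) (swapLoc-other a b l≢a l≢b)

swap : Loc → Loc → Perm
swap a b = record
  { bij   = Function.mk↔ₛ′ (swapLoc a b) (swapLoc a b)
              (swapLoc-involutive a b) (swapLoc-involutive a b)
  ; moved = a ∷ b ∷ [] , λ l∉ →
      swapLoc-other a b (λ { refl → l∉ (here refl) }) (λ { refl → l∉ (there (here refl)) })
  }

swap-fixes : ∀ {a b L} → a ∉ L → b ∉ L → Fixes (swap a b) L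
swap-fixes a∉ b∉ l∈ =
  swapLoc-other _ _ (λ { refl → a∉ l∈ }) (λ { refl → b∉ l∈ })

fresh : List Loc → Loc
fresh L = suc (sum L)

fresh-∉ : ∀ L → fresh L ∉ L
fresh-∉ L l∈ = ℕₚ.<-irrefl refl (bound L l∈)
  where
  bound : ∀ L {l} → l ∈ L → l ≤ sum L
  bound (x ∷ L) (here refl) = ℕₚ.m≤m+n x (sum L)
  bound (x ∷ L) (there l∈)  = ℕₚ.≤-trans (bound L l∈) (ℕₚ.m≤n+m (sum L) x)

-- Equality on an FM-set is the setoid equality; finite sets of locations
-- are lists.

record FMSet : Set₁ where
  infixr 8 _∙_
  field
    setoid : Setoid 0ℓ 0ℓ

  open Setoid setoid public
    using (Carrier; _≈_)
    renaming (refl to ≈-refl; sym to ≈-sym; trans to ≈-trans; reflexive to ≈-reflexive)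

  field
    _∙_    : Perm → Carrier → Carrier
    ∙-cong : ∀ π {x y} → x ≈ y → π ∙ x ≈ π ∙ y
    ∙-id   : ∀ x → idₚ ∙ x ≈ x
    ∙-∘    : ∀ π π′ x → π ∙ (π′ ∙ x) ≈ (π ∘ₚ π′) ∙ x

  Supports : List Loc → Carrier → Set
  Supports L x = ∀ π → Fixes π L → π ∙ x ≈ x

  field
    finSupp : ∀ x → ∃ λ L → Supports L x

  supp : Carrier → List Loc
  supp x = proj₁ (finSupp x)

  supp-supports : ∀ x → Supports (supp x) x
  supp-supports x = proj₂ (finSupp x)

  ∙-trivial : ∀ π x → (∀ l → to π l ≡ l) → π ∙ x ≈ x
  ∙-trivial π x fix = supp-supports x π (λ {l} _ → fix l)

  ∙-ext : ∀ {π π′ x} → (∀ l → to π l ≡ to π′ l) → π ∙ x ≈ π′ ∙ x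
  ∙-ext {π} {π′} {x} eq =
    ≈-trans (≈-sym (∙-trivial (π′ ∘ₚ π′ ⁻¹) _ (to-from π′)))
      (≈-trans (≈-sym (∙-∘ π′ (π′ ⁻¹) _)) (∙-cong π′
        (≈-trans (∙-∘ (π′ ⁻¹) π x) (∙-trivial _ x λ l →
          trans (cong (from π′) (eq l)) (from-to π′ l)))))

  ∙-inverseˡ : ∀ π x → π ⁻¹ ∙ π ∙ x ≈ x
  ∙-inverseˡ π x = ≈-trans (∙-∘ _ _ x) (∙-trivial _ x (from-to π))

  ∙-inverseʳ : ∀ π x → π ∙ π ⁻¹ ∙ x ≈ x
  ∙-inverseʳ π x = ≈-trans (∙-∘ _ _ x) (∙-trivial _ x (to-from π))

  supports-resp : ∀ {L x y} → x ≈ y → Supports L x → Supports L y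
  supports-resp x≈y s π fix = ≈-trans (∙-cong π (≈-sym x≈y)) (≈-trans (s π fix) x≈y)

  ∙-conjugate : ∀ π σ x → conjugate π σ ∙ x ≈ π ⁻¹ ∙ σ ∙ π ∙ x
  ∙-conjugate π σ x =
    ≈-sym (≈-trans (∙-cong (π ⁻¹) (∙-∘ σ π x)) (∙-∘ (π ⁻¹) (σ ∘ₚ π) x))

  supports-∙ : ∀ π {L x} → Supports L x → Supports (map (to π) L) (π ∙ x)
  supports-∙ π {L} {x} s σ fix =
    ≈-trans (≈-sym (∙-inverseʳ π (σ ∙ π ∙ x))) (∙-cong π
      (≈-trans (≈-sym (∙-conjugate π σ x)) (s (conjugate π σ) (conjugate-fixes π σ fix))))

record FMPoset : Set₁ where
  infix 4 _⊑_
  field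
    fmset : FMSet

  open FMSet fmset public

  field
    _⊑_            : Carrier → Carrier → Set
    isPartialOrder : IsPartialOrder _≈_ _⊑_
    ∙-mono         : ∀ π {x y} → x ⊑ y → π ∙ x ⊑ π ∙ y

  open IsPartialOrder isPartialOrder public
    using ()
    renaming (refl to ⊑-refl; trans to ⊑-trans; antisym to ⊑-antisym; reflexive to ⊑-reflexive)

  IsLub : (ℕ → Carrier) → Carrier → Set
  IsLub c x = (∀ n → c n ⊑ x) × (∀ z → (∀ n → c n ⊑ z) → x ⊑ z)

  isLub-unique : ∀ {c d x y} → (∀ n → c n ≈ d n) → IsLub c x → IsLub d y → x ≈ y
  isLub-unique eq (ub , least) (ub′ , least′) = ⊑-antisym
    (least _ λ n → ⊑-trans (⊑-reflexive (eq n)) (ub′ n))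
    (least′ _ λ n → ⊑-trans (⊑-reflexive (≈-sym (eq n))) (ub n))

  isLub-∙ : ∀ π {c x} → IsLub c x → IsLub (λ n → π ∙ c n) (π ∙ x)
  isLub-∙ π {c} {x} (ub , least) = (λ n → ∙-mono π (ub n)) , λ z z-ub →
    ⊑-trans (∙-mono π (least (π ⁻¹ ∙ z) λ n →
               ⊑-trans (⊑-reflexive (≈-sym (∙-inverseˡ π (c n)))) (∙-mono (π ⁻¹) (z-ub n))))
            (⊑-reflexive (∙-inverseʳ π z))

record Chain (A : FMPoset) : Set where
  open FMPoset A
  field
    at        : ℕ → Carrier
    asc       : ∀ n → at n ⊑ at (suc n)
    supported : ∃ λ L → ∀ n → Supports L (at n)

open Chain public

chain-mono : ∀ (A : FMPoset) (c : Chain A) {m n} → m ≤ n → FMPoset._⊑_ A (at c m) (at c n)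
chain-mono A c m≤n = go (ℕₚ.≤⇒≤′ m≤n)
  where
  open FMPoset A
  go : ∀ {m n} → m ℕ.≤′ n → at c m ⊑ at c n
  go (ℕ.≤′-reflexive refl) = ⊑-refl
  go (ℕ.≤′-step m≤n)       = ⊑-trans (go m≤n) (asc c _)

record FMCpo : Set₁ where
  no-eta-equality
  field
    fmposet : FMPoset

  open FMPoset fmposet public

  field
    ⨆     : Chain fmposet → Carrier
    ⨆-lub : ∀ c → IsLub (at c) (⨆ c)

∣_∣ : FMCpo → Set
∣ A ∣ = FMCpo.Carrier A

private variable
  A B C X : FMCpo

module _ (A B : FMCpo) where
  private
    module A = FMCpo A
    module B = FMCpo B

  Monotone : (A.Carrier → B.Carrier) → Set
  Monotone f = ∀ {x y} → x A.⊑ y → f x B.⊑ f y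

  Continuous : (A.Carrier → B.Carrier) → Set
  Continuous f = ∀ (c : Chain A.fmposet) {x} → A.IsLub (at c) x → B.IsLub (f ∘ at c) (f x)

  SubContinuous : (A.Carrier → B.Carrier) → Set
  SubContinuous f = ∀ (c : Chain A.fmposet) {x} → A.IsLub (at c) x →
    ∀ z → (∀ n → f (at c n) B.⊑ z) → f x B.⊑ z

  continuous : ∀ f → Monotone f → SubContinuous f → Continuous f
  continuous f mono sub c l = (λ n → mono (proj₁ l n)) , sub c l

record Hom (A B : FMCpo) : Set where
  private
    module A = FMCpo A
    module B = FMCpo B
  field
    app   : A.Carrier → B.Carrier
    equiv : ∀ π x → π B.∙ app x B.≈ app (π A.∙ x)
    mono  : Monotone A B app
    cont  : Continuous A B app

  cong-app : ∀ {x y} → x A.≈ y → app x B.≈ app y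
  cong-app eq = B.⊑-antisym (mono (A.⊑-reflexive eq)) (mono (A.⊑-reflexive (A.≈-sym eq)))

  mapChain : Chain A.fmposet → Chain B.fmposet
  mapChain c .at n = app (at c n)
  mapChain c .asc n = mono (asc c n)
  mapChain c .supported = proj₁ (supported c) , λ n π fix →
    B.≈-trans (equiv π _) (cong-app (proj₂ (supported c) n π fix))

open Hom public using (app)

idᴴ : Hom A A
idᴴ {A} = record
  { app = λ x → x ; equiv = λ _ _ → FMCpo.≈-refl A ; mono = λ p → p ; cont = λ _ l → l }

infixr 9 _∘ᴴ_

_∘ᴴ_ : Hom B C → Hom A B → Hom A C
_∘ᴴ_ {B} {C} {A} g f = record
  { app   = λ x → app g (app f x)
  ; equiv = λ π x → FMCpo.≈-trans C (Hom.equiv g π _) (Hom.cong-app g (Hom.equiv f π x))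
  ; mono  = λ p → Hom.mono g (Hom.mono f p)
  ; cont  = λ c l → Hom.cont g (Hom.mapChain f c) (Hom.cont f c l)
  }

module _ (S : FMSet) where
  open FMSet S

  discretePoset : FMPoset
  discretePoset = record
    { fmset          = S
    ; _⊑_            = _≈_
    ; isPartialOrder = record
        { isPreorder = record
            { isEquivalence = Setoid.isEquivalence setoid
            ; reflexive     = λ p → p
            ; trans         = ≈-trans
            }
        ; antisym = λ p _ → p
        }
    ; ∙-mono         = ∙-cong
    }

  chain-constant : ∀ (c : Chain discretePoset) n → at c 0 ≈ at c n
  chain-constant c zero    = ≈-refl
  chain-constant c (suc n) = ≈-trans (chain-constant c n) (asc c n)

  discrete : FMCpo
  discrete .FMCpo.fmposet = discretePoset
  discrete .FMCpo.⨆ c     = at c 0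
  discrete .FMCpo.⨆-lub c = (λ n → ≈-sym (chain-constant c n)) , λ z ub → ub 0

IsDiscrete : FMCpo → Set
IsDiscrete A = ∀ {x y} → x ⊑ y → x ≈ y
  where open FMCpo A

liftᴴ : IsDiscrete A → (f : ∣ A ∣ → ∣ B ∣) →
        (∀ {x y} → FMCpo._≈_ A x y → FMCpo._≈_ B (f x) (f y)) →
        (∀ π x → FMCpo._≈_ B (FMCpo._∙_ B π (f x)) (f (FMCpo._∙_ A π x))) →
        Hom A B
liftᴴ {A} {B} disc f f-cong f-equiv = record
  { app   = f
  ; equiv = f-equiv
  ; mono  = f-mono
  ; cont  = continuous A B f f-mono λ c l z ub →
      B.⊑-trans (B.⊑-reflexive (B.≈-sym (f-cong (disc (proj₁ l 0))))) (ub 0)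
  }
  where
  module B = FMCpo B
  f-mono : Monotone A B f
  f-mono p = B.⊑-reflexive (f-cong (disc p))

module Product (A B : FMCpo) where
  private
    module A = FMCpo A
    module B = FMCpo B

  ×-poset : FMPoset
  ×-poset = record
    { fmset = record
        { setoid  = ×-setoid A.setoid B.setoid
        ; _∙_     = λ π (x , y) → π A.∙ x , π B.∙ y
        ; ∙-cong  = λ π (p , q) → A.∙-cong π p , B.∙-cong π q
        ; ∙-id    = λ (x , y) → A.∙-id x , B.∙-id y
        ; ∙-∘     = λ π π′ (x , y) → A.∙-∘ π π′ x , B.∙-∘ π π′ y
        ; finSupp = λ (x , y) → A.supp x ++ B.supp y , λ π fix →
            A.supp-supports x π (λ l∈ → fix (∈-++⁺ˡ l∈)) ,
            B.supp-supports y π (λ l∈ → fix (∈-++⁺ʳ (A.supp x) l∈))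
        }
    ; _⊑_            = λ (x , y) (x′ , y′) → x A.⊑ x′ × y B.⊑ y′
    ; isPartialOrder = ×-isPartialOrder A.isPartialOrder B.isPartialOrder
    ; ∙-mono         = λ π (p , q) → A.∙-mono π p , B.∙-mono π q
    }

  fstChain : Chain ×-poset → Chain A.fmposet
  fstChain c .at n = proj₁ (at c n)
  fstChain c .asc n = proj₁ (asc c n)
  fstChain c .supported = proj₁ (supported c) , λ n π fix → proj₁ (proj₂ (supported c) n π fix)

  sndChain : Chain ×-poset → Chain B.fmposet
  sndChain c .at n = proj₂ (at c n)
  sndChain c .asc n = proj₂ (asc c n)
  sndChain c .supported = proj₁ (supported c) , λ n π fix → proj₂ (proj₂ (supported c) n π fix)

infixr 3 _×ᴰ_

_×ᴰ_ : FMCpo → FMCpo → FMCpo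
(A ×ᴰ B) .FMCpo.fmposet = Product.×-poset A B
(A ×ᴰ B) .FMCpo.⨆ c =
  FMCpo.⨆ A (Product.fstChain A B c) , FMCpo.⨆ B (Product.sndChain A B c)
(A ×ᴰ B) .FMCpo.⨆-lub c =
  (λ n → proj₁ l n , proj₁ r n) ,
  λ z ub → proj₂ l _ (λ n → proj₁ (ub n)) , proj₂ r _ (λ n → proj₂ (ub n))
  where
  l = FMCpo.⨆-lub A (Product.fstChain A B c)
  r = FMCpo.⨆-lub B (Product.sndChain A B c)

π₁ : Hom (A ×ᴰ B) A
π₁ {A} {B} = record
  { app   = proj₁
  ; equiv = λ _ _ → FMCpo.≈-refl A
  ; mono  = proj₁
  ; cont  = continuous (A ×ᴰ B) A proj₁ proj₁ λ c {(x , y)} l z ub →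
      proj₁ (proj₂ l (z , y) λ n → ub n , proj₂ (proj₁ l n))
  }

π₂ : Hom (A ×ᴰ B) B
π₂ {A} {B} = record
  { app   = proj₂
  ; equiv = λ _ _ → FMCpo.≈-refl B
  ; mono  = proj₂
  ; cont  = continuous (A ×ᴰ B) B proj₂ proj₂ λ c {(x , y)} l z ub →
      proj₂ (proj₂ l (x , z) λ n → proj₁ (proj₁ l n) , ub n)
  }

⟨_,_⟩ : Hom X A → Hom X B → Hom X (A ×ᴰ B)
⟨_,_⟩ {X} {A} {B} f g = record
  { app   = λ x → app f x , app g x
  ; equiv = λ π x → Hom.equiv f π x , Hom.equiv g π x
  ; mono  = fg-mono
  ; cont  = continuous X (A ×ᴰ B) _ (λ {x} {y} → fg-mono {x} {y}) λ c l z ub →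
      proj₂ (Hom.cont f c l) _ (λ n → proj₁ (ub n)) ,
      proj₂ (Hom.cont g c l) _ (λ n → proj₂ (ub n))
  }
  where
  fg-mono : Monotone X (A ×ᴰ B) (λ x → app f x , app g x)
  fg-mono p = Hom.mono f p , Hom.mono g p

record Fun (A B : FMCpo) : Set where
  private
    module A = FMCpo A
    module B = FMCpo B
  field
    fun   : A.Carrier → B.Carrier
    mono  : Monotone A B fun
    cont  : Continuous A B fun
    fsupp : ∃ λ L → ∀ π → Fixes π L → ∀ a → π B.∙ fun (π ⁻¹ A.∙ a) B.≈ fun a

  cong-fun : ∀ {x y} → x A.≈ y → fun x B.≈ fun y
  cong-fun eq = B.⊑-antisym (mono (A.⊑-reflexive eq)) (mono (A.⊑-reflexive (A.≈-sym eq)))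

  fun-equiv : ∀ π → Fixes π (proj₁ fsupp) → ∀ a → π B.∙ fun a B.≈ fun (π A.∙ a)
  fun-equiv π fix a =
    B.≈-trans (B.∙-cong π (cong-fun (A.≈-sym (A.∙-inverseˡ π a)))) (proj₂ fsupp π fix (π A.∙ a))

  mapChain : Chain A.fmposet → Chain B.fmposet
  mapChain c .at n = fun (at c n)
  mapChain c .asc n = mono (asc c n)
  mapChain c .supported = proj₁ fsupp ++ proj₁ (supported c) , λ n π fix →
    B.≈-trans (fun-equiv π (λ l∈ → fix (∈-++⁺ˡ l∈)) _)
              (cong-fun (proj₂ (supported c) n π (λ l∈ → fix (∈-++⁺ʳ (proj₁ fsupp) l∈))))

open Fun public using (fun)

mkSupport : ∀ (A B : FMCpo) {f : ∣ A ∣ → ∣ B ∣} {L} →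
  let module A = FMCpo A
      module B = FMCpo B
  in Monotone A B f →
     (∀ π → Fixes π L → ∀ a → π B.∙ f a B.≈ f (π A.∙ a)) →
     ∀ π → Fixes π L → ∀ a → π B.∙ f (π ⁻¹ A.∙ a) B.≈ f a
mkSupport A B f-mono h π fix a = B.≈-trans (h π fix (π ⁻¹ A.∙ a))
  (B.⊑-antisym (f-mono (A.⊑-reflexive (A.∙-inverseʳ π a)))
               (f-mono (A.⊑-reflexive (A.≈-sym (A.∙-inverseʳ π a)))))
  where
  module A = FMCpo A
  module B = FMCpo B

module Exponential (A B : FMCpo) where
  private
    module A = FMCpo A
    module B = FMCpo B

  _≈ᶠ_ _⊑ᶠ_ : Fun A B → Fun A B → Set
  f ≈ᶠ g = ∀ a → fun f a B.≈ fun g a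
  f ⊑ᶠ g = ∀ a → fun f a B.⊑ fun g a

  act : Perm → Fun A B → Fun A B
  act π f .fun a = π B.∙ fun f (π ⁻¹ A.∙ a)
  act π f .Fun.mono p = B.∙-mono π (Fun.mono f (A.∙-mono (π ⁻¹) p))
  act π f .Fun.cont c l = B.isLub-∙ π (Fun.cont f c′ (A.isLub-∙ (π ⁻¹) l))
    where
    c′ : Chain A.fmposet
    c′ .at n = π ⁻¹ A.∙ at c n
    c′ .asc n = A.∙-mono (π ⁻¹) (asc c n)
    c′ .supported = map (from π) (proj₁ (supported c)) , λ n →
      A.supports-∙ (π ⁻¹) (proj₂ (supported c) n)
  act π f .Fun.fsupp = map (to π) (proj₁ (Fun.fsupp f)) , mkSupport A B (act π f .Fun.mono) λ σ fix a →
    let τ = conjugate π σ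
        b = π ⁻¹ A.∙ a
    in B.≈-trans (B.≈-sym (B.∙-inverseʳ π _)) (B.∙-cong π
         (B.≈-trans (B.≈-sym (B.∙-conjugate π σ _))
           (B.≈-trans (Fun.fun-equiv f τ (conjugate-fixes π σ fix) b)
             (Fun.cong-fun f (A.≈-trans (A.∙-conjugate π σ b)
               (A.∙-cong (π ⁻¹) (A.∙-cong σ (A.∙-inverseʳ π a))))))))

  expSet : FMSet
  expSet = record
    { setoid = record
        { Carrier       = Fun A B
        ; _≈_           = _≈ᶠ_
        ; isEquivalence = record
            { refl  = λ _ → B.≈-refl
            ; sym   = λ p a → B.≈-sym (p a)
            ; trans = λ p q a → B.≈-trans (p a) (q a)
            }
        }
    ; _∙_     = act
    ; ∙-cong  = λ π p a → B.∙-cong π (p (π ⁻¹ A.∙ a))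
    ; ∙-id    = λ f a → B.≈-trans (B.∙-id _)
        (Fun.cong-fun f (A.∙-trivial (idₚ ⁻¹) a (λ _ → refl)))
    ; ∙-∘     = λ π π′ f a → B.≈-trans (B.∙-∘ π π′ _)
        (B.∙-cong (π ∘ₚ π′) (Fun.cong-fun f (A.≈-trans (A.∙-∘ _ _ a)
          (A.∙-ext λ _ → refl))))
    ; finSupp = Fun.fsupp
    }

  expPoset : FMPoset
  expPoset = record
    { fmset          = expSet
    ; _⊑_            = _⊑ᶠ_
    ; isPartialOrder = record
        { isPreorder = record
            { isEquivalence = Setoid.isEquivalence (FMSet.setoid expSet)
            ; reflexive     = λ p a → B.⊑-reflexive (p a)
            ; trans         = λ p q a → B.⊑-trans (p a) (q a)
            }
        ; antisym = λ p q a → B.⊑-antisym (p a) (q a)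
        }
    ; ∙-mono         = λ π p a → B.∙-mono π (p (π ⁻¹ A.∙ a))
    }

  atChain : Chain expPoset → A.Carrier → Chain B.fmposet
  atChain c a .at n = fun (at c n) a
  atChain c a .asc n = asc c n a
  atChain c a .supported = proj₁ (supported c) ++ A.supp a , λ n π fix →
    B.≈-trans (chain-equiv c n π (λ l∈ → fix (∈-++⁺ˡ l∈)) a)
      (Fun.cong-fun (at c n) (A.supp-supports a π λ l∈ → fix (∈-++⁺ʳ (proj₁ (supported c)) l∈)))
    where
    chain-equiv : ∀ (c : Chain expPoset) n π → Fixes π (proj₁ (supported c)) →
                  ∀ a → π B.∙ fun (at c n) a B.≈ fun (at c n) (π A.∙ a)
    chain-equiv c n π fix a =
      B.≈-trans (B.∙-cong π (Fun.cong-fun (at c n) (A.≈-sym (A.∙-inverseˡ π a))))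
                (proj₂ (supported c) n π fix (π A.∙ a))

  ⨆ᶠ : Chain expPoset → Fun A B
  ⨆ᶠ c .fun a = B.⨆ (atChain c a)
  ⨆ᶠ c .Fun.mono {x} {y} p = proj₂ (B.⨆-lub (atChain c x)) _ λ n →
    B.⊑-trans (Fun.mono (at c n) p) (proj₁ (B.⨆-lub (atChain c y)) n)
  ⨆ᶠ c .Fun.cont = continuous A B _ (⨆ᶠ c .Fun.mono) λ d {x} l z ub →
    proj₂ (B.⨆-lub (atChain c x)) z λ m →
      proj₂ (Fun.cont (at c m) d l) z λ n →
        B.⊑-trans (proj₁ (B.⨆-lub (atChain c (at d n))) m) (ub n)
  ⨆ᶠ c .Fun.fsupp = proj₁ (supported c) , λ π fix a →
    B.isLub-unique (λ n → proj₂ (supported c) n π fix a)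
      (B.isLub-∙ π (B.⨆-lub (atChain c (π ⁻¹ A.∙ a)))) (B.⨆-lub (atChain c a))

  pointwise-isLub : ∀ (c : Chain expPoset) {f} → FMPoset.IsLub expPoset (at c) f →
                    ∀ a → B.IsLub (λ n → fun (at c n) a) (fun f a)
  pointwise-isLub c (ub , least) a = (λ n → ub n a) , λ z z-ub →
    B.⊑-trans (least (⨆ᶠ c) (λ n a → proj₁ (B.⨆-lub (atChain c a)) n) a)
              (proj₂ (B.⨆-lub (atChain c a)) z z-ub)

infixr 2 _⇒ᴰ_

_⇒ᴰ_ : FMCpo → FMCpo → FMCpo
(A ⇒ᴰ B) .FMCpo.fmposet = Exponential.expPoset A B
(A ⇒ᴰ B) .FMCpo.⨆       = Exponential.⨆ᶠ A B
(A ⇒ᴰ B) .FMCpo.⨆-lub c =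
  (λ n a → proj₁ (lub a) n) , λ g ub a → proj₂ (lub a) _ λ n → ub n a
  where
  lub : ∀ a → FMCpo.IsLub B (λ n → fun (at c n) a) (FMCpo.⨆ B (Exponential.atChain A B c a))
  lub a = FMCpo.⨆-lub B (Exponential.atChain A B c a)

curry : Hom (A ×ᴰ B) C → Hom A (B ⇒ᴰ C)
curry {A} {B} {C} f = record
  { app   = section
  ; equiv = λ π a b → C.≈-trans (Hom.equiv f π _) (Hom.cong-app f (A.≈-refl , B.∙-inverseʳ π b))
  ; mono  = λ p b → Hom.mono f (p , B.⊑-refl)
  ; cont  = continuous A (B ⇒ᴰ C) section (λ p b → Hom.mono f (p , B.⊑-refl)) λ c {a} l g ub b →
      proj₂ (Hom.cont f (pairˡ c b) (pairˡ-lub c b {a} l)) _ λ n → ub n b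
  }
  where
  module A = FMCpo A
  module B = FMCpo B
  module C = FMCpo C
  AB = A ×ᴰ B
  pairʳ : A.Carrier → Chain B.fmposet → Chain (FMCpo.fmposet AB)
  pairʳ a c .at n = a , at c n
  pairʳ a c .asc n = A.⊑-refl , asc c n
  pairʳ a c .supported = A.supp a ++ proj₁ (supported c) , λ n π fix →
    A.supp-supports a π (λ l∈ → fix (∈-++⁺ˡ l∈)) ,
    proj₂ (supported c) n π (λ l∈ → fix (∈-++⁺ʳ (A.supp a) l∈))
  pairʳ-lub : ∀ a c {b} → B.IsLub (at c) b → FMCpo.IsLub AB (at (pairʳ a c)) (a , b)
  pairʳ-lub a c (ub , least) =
    (λ n → A.⊑-refl , ub n) , λ z z-ub → proj₁ (z-ub 0) , least _ (λ n → proj₂ (z-ub n))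
  pairˡ : Chain A.fmposet → B.Carrier → Chain (FMCpo.fmposet AB)
  pairˡ c b .at n = at c n , b
  pairˡ c b .asc n = asc c n , B.⊑-refl
  pairˡ c b .supported = proj₁ (supported c) ++ B.supp b , λ n π fix →
    proj₂ (supported c) n π (λ l∈ → fix (∈-++⁺ˡ l∈)) ,
    B.supp-supports b π (λ l∈ → fix (∈-++⁺ʳ (proj₁ (supported c)) l∈))
  pairˡ-lub : ∀ c b {a} → A.IsLub (at c) a → FMCpo.IsLub AB (at (pairˡ c b)) (a , b)
  pairˡ-lub c b (ub , least) =
    (λ n → ub n , B.⊑-refl) , λ z z-ub → least _ (λ n → proj₁ (z-ub n)) , proj₂ (z-ub 0)
  section : A.Carrier → Fun B C
  section a .fun b = app f (a , b)
  section a .Fun.mono p = Hom.mono f (A.⊑-refl , p)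
  section a .Fun.cont = continuous B C _ (section a .Fun.mono) λ c l →
    proj₂ (Hom.cont f (pairʳ a c) (pairʳ-lub a c l))
  section a .Fun.fsupp = A.supp a , mkSupport B C (section a .Fun.mono) λ π fix b →
    C.≈-trans (Hom.equiv f π (a , b))
              (Hom.cong-app f (A.supp-supports a π fix , B.≈-refl))

eval : Hom ((A ⇒ᴰ B) ×ᴰ A) B
eval {A} {B} = record
  { app   = λ (f , a) → fun f a
  ; equiv = λ π (f , a) → B.∙-cong π (Fun.cong-fun f (A.≈-sym (A.∙-inverseˡ π a)))
  ; mono  = λ {x} {y} → ev-mono {x} {y}
  ; cont  = continuous ((A ⇒ᴰ B) ×ᴰ A) B (λ (f , a) → fun f a) (λ {x} {y} → ev-mono {x} {y})
      λ c {(f , a)} l z ub →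
        let fs = Hom.mapChain (π₁ {A ⇒ᴰ B} {A}) c
            as = Hom.mapChain (π₂ {A ⇒ᴰ B} {A}) c
            fs-lub = Hom.cont (π₁ {A ⇒ᴰ B} {A}) c {f , a} l
            as-lub = Hom.cont (π₂ {A ⇒ᴰ B} {A}) c {f , a} l
        in proj₂ (pointwise-isLub fs {f} fs-lub a) z λ n →
             proj₂ (Fun.cont (at fs n) as as-lub) z λ m →
               B.⊑-trans
                 (ev-mono {at fs n , at as m} {at c (n ℕ.⊔ m)}
                   ( chain-mono (FMCpo.fmposet (A ⇒ᴰ B)) fs (ℕₚ.m≤m⊔n n m)
                   , chain-mono A.fmposet as (ℕₚ.m≤n⊔m n m)))
                 (ub (n ℕ.⊔ m))
  }
  where
  module A = FMCpo A
  module B = FMCpo B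
  open Exponential A B
  ev-mono : Monotone ((A ⇒ᴰ B) ×ᴰ A) B (λ (f , a) → fun f a)
  ev-mono {f , a} {g , b} (p , q) = B.⊑-trans (p a) (Fun.mono g q)

record Pointed (A : FMCpo) : Set where
  open FMCpo A using (_⊑_; _≈_; _∙_; ⊑-antisym; ⊑-trans; ⊑-reflexive; ∙-mono; ∙-inverseʳ)
  field
    bot   : ∣ A ∣
    least : ∀ x → bot ⊑ x

  bot-equiv : ∀ π → π ∙ bot ≈ bot
  bot-equiv π = ⊑-antisym
    (⊑-trans (∙-mono π (least (π ⁻¹ ∙ bot))) (⊑-reflexive (∙-inverseʳ π bot)))
    (least _)

⇒-pointed : Pointed B → Pointed (A ⇒ᴰ B)
⇒-pointed {B} {A} p = record
  { bot   = record
      { fun   = λ _ → Pointed.bot p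
      ; mono  = λ _ → B.⊑-refl
      ; cont  = λ _ _ → (λ _ → B.⊑-refl) , λ _ ub → ub 0
      ; fsupp = [] , λ π _ _ → Pointed.bot-equiv p π
      }
  ; least = λ f a → Pointed.least p (fun f a)
  }
  where module B = FMCpo B

module LeastFixedPoint (A : FMCpo) (pointed : Pointed A) where
  open FMCpo A
  open Pointed pointed using (bot; least; bot-equiv)

  iterate : Fun A A → ℕ → Carrier
  iterate f zero    = bot
  iterate f (suc n) = fun f (iterate f n)

  iterateChain : Fun A A → Chain fmposet
  iterateChain f .at = iterate f
  iterateChain f .asc = go
    where
    go : ∀ n → iterate f n ⊑ iterate f (suc n)
    go zero    = least _
    go (suc n) = Fun.mono f (go n)
  iterateChain f .supported = proj₁ (Fun.fsupp f) , go
    where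
    go : ∀ n → Supports (proj₁ (Fun.fsupp f)) (iterate f n)
    go zero    π fix = bot-equiv π
    go (suc n) π fix = ≈-trans (Fun.fun-equiv f π fix _) (Fun.cong-fun f (go n π fix))

  lfp : Fun A A → Carrier
  lfp f = ⨆ (iterateChain f)

  lfp-least : ∀ f x → fun f x ⊑ x → lfp f ⊑ x
  lfp-least f x pre = proj₂ (⨆-lub (iterateChain f)) x go
    where
    go : ∀ n → iterate f n ⊑ x
    go zero    = least x
    go (suc n) = ⊑-trans (Fun.mono f (go n)) pre

  lfp-fixed : ∀ f → fun f (lfp f) ≈ lfp f
  lfp-fixed f = ⊑-antisym
    (proj₂ (Fun.cont f (iterateChain f) lub) (lfp f) λ n → proj₁ lub (suc n))
    (proj₂ lub _ λ { zero → least _ ; (suc n) → Fun.mono f (proj₁ lub n) })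
    where lub = ⨆-lub (iterateChain f)

  lfp-mono : ∀ {f g} → FMCpo._⊑_ (A ⇒ᴰ A) f g → lfp f ⊑ lfp g
  lfp-mono {f} {g} p =
    lfp-least f (lfp g) (⊑-trans (p (lfp g)) (⊑-reflexive (lfp-fixed g)))

  fixᴴ : Hom (A ⇒ᴰ A) A
  fixᴴ = record
    { app   = lfp
    ; equiv = λ π f → isLub-unique (iterate-equiv π f)
        (isLub-∙ π (⨆-lub (iterateChain f))) (⨆-lub (iterateChain (FMCpo._∙_ (A ⇒ᴰ A) π f)))
    ; mono  = lfp-mono
    ; cont  = continuous (A ⇒ᴰ A) A lfp lfp-mono λ c {f} l z ub →
        let w     = ⨆ (lfpChain c)
            w-lub = ⨆-lub (lfpChain c)
        in ⊑-trans
             (lfp-least f w (proj₂ (Exponential.pointwise-isLub A A c {f} l w) w λ n →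
               proj₂ (Fun.cont (at c n) (lfpChain c) w-lub) w λ m →
                 ⊑-trans (Fun.mono (at c n) (lfp-mono {at c m} {at c (n ℕ.⊔ m)}
                           (chain-mono (FMCpo.fmposet (A ⇒ᴰ A)) c (ℕₚ.m≤n⊔m n m))))
                   (⊑-trans (chain-mono (FMCpo.fmposet (A ⇒ᴰ A)) c (ℕₚ.m≤m⊔n n m) _)
                     (⊑-trans (⊑-reflexive (lfp-fixed (at c (n ℕ.⊔ m))))
                       (proj₁ w-lub (n ℕ.⊔ m))))))
             (proj₂ w-lub z ub)
    }
    where
    iterate-equiv : ∀ π f n → π ∙ iterate f n ≈ iterate (FMCpo._∙_ (A ⇒ᴰ A) π f) n
    iterate-equiv π f zero    = bot-equiv π
    iterate-equiv π f (suc n) = ∙-cong π (Fun.cong-fun f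
      (≈-trans (≈-sym (∙-inverseˡ π _)) (∙-cong (π ⁻¹) (iterate-equiv π f n))))
    lfpChain : Chain (FMCpo.fmposet (A ⇒ᴰ A)) → Chain fmposet
    lfpChain c .at n = lfp (at c n)
    lfpChain c .asc n = lfp-mono {at c n} {at c (suc n)} (asc c n)
    lfpChain c .supported = proj₁ (supported c) , λ n π fix →
      ⊑-antisym
        (⊑-trans (⊑-reflexive (eqv π (at c n))) (lfp-mono {FMCpo._∙_ (A ⇒ᴰ A) π (at c n)} {at c n}
          λ a → ⊑-reflexive (proj₂ (supported c) n π fix a)))
        (⊑-trans (lfp-mono {at c n} {FMCpo._∙_ (A ⇒ᴰ A) π (at c n)}
          λ a → ⊑-reflexive (≈-sym (proj₂ (supported c) n π fix a))) (⊑-reflexive (≈-sym (eqv π (at c n)))))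
      where
      eqv : ∀ π f → π ∙ lfp f ≈ lfp (FMCpo._∙_ (A ⇒ᴰ A) π f)
      eqv π f = isLub-unique (iterate-equiv π f)
        (isLub-∙ π (⨆-lub (iterateChain f))) (⨆-lub (iterateChain (FMCpo._∙_ (A ⇒ᴰ A) π f)))

open LeastFixedPoint public using (lfp; fixᴴ)

≡-set : (T : Set) (_∙_ : Perm → T → T) →
        (∀ x → idₚ ∙ x ≡ x) → (∀ π π′ x → π ∙ (π′ ∙ x) ≡ (π ∘ₚ π′) ∙ x) →
        (∀ x → ∃ λ L → ∀ π → Fixes π L → π ∙ x ≡ x) → FMSet
≡-set T _∙_ ∙-id ∙-∘ finSupp = record
  { setoid  = ≡.setoid T
  ; _∙_     = _∙_
  ; ∙-cong  = λ π → cong (π ∙_)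
  ; ∙-id    = ∙-id
  ; ∙-∘     = ∙-∘
  ; finSupp = finSupp
  }

trivial-set : Set → FMSet
trivial-set T = ≡-set T (λ _ x → x) (λ _ → refl) (λ _ _ _ → refl) (λ _ → [] , λ _ _ → refl)

locSet : FMSet
locSet = ≡-set Loc to (λ _ → refl) (λ _ _ _ → refl) (λ l → l ∷ [] , λ _ fix → fix (here refl))

data Val : Set where
  loc     : Loc → Val
  int     : ℤ → Val
  default : Val

loc-injective : ∀ {l l′} → loc l ≡ loc l′ → l ≡ l′
loc-injective refl = refl

int-injective : ∀ {a b} → int a ≡ int b → a ≡ b
int-injective refl = refl

_≟ᵛ_ : (v w : Val) → Dec (v ≡ w)
loc l   ≟ᵛ loc l′  = Dec.map′ (cong loc) loc-injective (l ≟ l′)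
loc _   ≟ᵛ int _   = no λ ()
loc _   ≟ᵛ default = no λ ()
int _   ≟ᵛ loc _   = no λ ()
int a   ≟ᵛ int b   = Dec.map′ (cong int) int-injective (a ℤ.≟ b)
int _   ≟ᵛ default = no λ ()
default ≟ᵛ loc _   = no λ ()
default ≟ᵛ int _   = no λ ()
default ≟ᵛ default = yes refl

valAct : Perm → Val → Val
valAct π (loc l) = loc (to π l)
valAct π (int a) = int a
valAct π default = default

valAct-inverse : ∀ π v → valAct (π ⁻¹) (valAct π v) ≡ v
valAct-inverse π (loc l) = cong loc (from-to π l)
valAct-inverse π (int a) = refl
valAct-inverse π default = refl

valAct-injective : ∀ π {v w} → valAct π v ≡ valAct π w → v ≡ w
valAct-injective π {v} {w} eq =
  trans (sym (valAct-inverse π v)) (trans (cong (valAct (π ⁻¹)) eq) (valAct-inverse π w))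

valAct-id : ∀ v → valAct idₚ v ≡ v
valAct-id (loc l) = refl
valAct-id (int a) = refl
valAct-id default = refl

valAct-∘ : ∀ π π′ v → valAct π (valAct π′ v) ≡ valAct (π ∘ₚ π′) v
valAct-∘ π π′ (loc l) = refl
valAct-∘ π π′ (int a) = refl
valAct-∘ π π′ default = refl

valLocs : Val → List Loc
valLocs (loc l) = l ∷ []
valLocs (int _) = []
valLocs default = []

valLocs-support : ∀ v π → Fixes π (valLocs v) → valAct π v ≡ v
valLocs-support (loc l) π fix = cong loc (fix (here refl))
valLocs-support (int _) π fix = refl
valLocs-support default π fix = refl

valSet : FMSet
valSet = ≡-set Val valAct valAct-id valAct-∘ (λ v → valLocs v , valLocs-support v)

Cell : Set
Cell = Val × Val

cellAct : Perm → Cell → Cell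
cellAct π (v , w) = valAct π v , valAct π w

cellAct-id : ∀ c → cellAct idₚ c ≡ c
cellAct-id (v , w) = cong₂ _,_ (valAct-id v) (valAct-id w)

cellAct-∘ : ∀ π π′ c → cellAct π (cellAct π′ c) ≡ cellAct (π ∘ₚ π′) c
cellAct-∘ π π′ (v , w) = cong₂ _,_ (valAct-∘ π π′ v) (valAct-∘ π π′ w)

cellLocs : Cell → List Loc
cellLocs (v , w) = valLocs v ++ valLocs w

cellLocs-support : ∀ c π → Fixes π (cellLocs c) → cellAct π c ≡ c
cellLocs-support (v , w) π fix = cong₂ _,_
  (valLocs-support v π (λ l∈ → fix (∈-++⁺ˡ l∈)))
  (valLocs-support w π (λ l∈ → fix (∈-++⁺ʳ (valLocs v) l∈)))

cellSet : FMSet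
cellSet = ≡-set Cell cellAct cellAct-id cellAct-∘ (λ c → cellLocs c , cellLocs-support c)

Cell? : Set
Cell? = Maybe Cell

cellAct? : Perm → Cell? → Cell?
cellAct? π = Maybe.map (cellAct π)

cellAct?-id : ∀ c → cellAct? idₚ c ≡ c
cellAct?-id (just c) = cong just (cellAct-id c)
cellAct?-id nothing  = refl

cellAct?-∘ : ∀ π π′ c → cellAct? π (cellAct? π′ c) ≡ cellAct? (π ∘ₚ π′) c
cellAct?-∘ π π′ (just c) = cong just (cellAct-∘ π π′ c)
cellAct?-∘ π π′ nothing  = refl

cellLocs? : Cell? → List Loc
cellLocs? (just c) = cellLocs c
cellLocs? nothing  = []

cellLocs?-support : ∀ c π → Fixes π (cellLocs? c) → cellAct? π c ≡ c
cellLocs?-support (just c) π fix = cong just (cellLocs-support c π fix)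
cellLocs?-support nothing  π fix = refl

cell?Set : FMSet
cell?Set =
  ≡-set Cell? cellAct? cellAct?-id cellAct?-∘ (λ c → cellLocs? c , cellLocs?-support c)

Stack : ℕ → Set
Stack = Vec Val

stackAct : ∀ {n} → Perm → Stack n → Stack n
stackAct π = Vec.map (valAct π)

stackLocs : ∀ {n} → Stack n → List Loc
stackLocs []      = []
stackLocs (v ∷ ρ) = valLocs v ++ stackLocs ρ

stackLocs-support : ∀ {n} (ρ : Stack n) π → Fixes π (stackLocs ρ) → stackAct π ρ ≡ ρ
stackLocs-support []      π fix = refl
stackLocs-support (v ∷ ρ) π fix = cong₂ _∷_
  (valLocs-support v π (λ l∈ → fix (∈-++⁺ˡ l∈)))
  (stackLocs-support ρ π (λ l∈ → fix (∈-++⁺ʳ (valLocs v) l∈)))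

stackAct-inverse : ∀ {n} π (ρ : Stack n) → stackAct (π ⁻¹) (stackAct π ρ) ≡ ρ
stackAct-inverse π []      = refl
stackAct-inverse π (v ∷ ρ) = cong₂ _∷_ (valAct-inverse π v) (stackAct-inverse π ρ)

stackSet : ℕ → FMSet
stackSet n = ≡-set (Stack n) stackAct
  (λ ρ → trans (Vecₚ.map-cong valAct-id ρ) (Vecₚ.map-id ρ))
  (λ π π′ ρ → trans (sym (Vecₚ.map-∘ (valAct π) (valAct π′) ρ)) (Vecₚ.map-cong (valAct-∘ π π′) ρ))
  (λ ρ → stackLocs ρ , stackLocs-support ρ)

-- A heap is a finite partial function; two heaps are equal iff they are
-- extensionally equal, so the order on Loc ⇀fin Val × Val is this equality.

record Heap : Set where
  field
    cells  : Loc → Cell?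
    finite : ∃ λ (L : List Loc) → ∀ {l} → l ∉ L → cells l ≡ nothing

open Heap public

infix 4 _≈ʰ_ _#_ _≐_•_
infixr 6 _∪_

_≈ʰ_ : Heap → Heap → Set
h ≈ʰ h′ = ∀ l → cells h l ≡ cells h′ l

heapAct : Perm → Heap → Heap
heapAct π h .cells l = cellAct? π (cells h (from π l))
heapAct π h .finite = map (to π) (proj₁ (finite h)) , λ {l} l∉ →
  cong (cellAct? π) (proj₂ (finite h) λ l′∈ →
    l∉ (subst (_∈ _) (to-from π l) (∈-map⁺ (to π) l′∈)))

heapLocs : Heap → List Loc
heapLocs h = proj₁ (finite h) ++ concatMap (λ l → cellLocs? (cells h l)) (proj₁ (finite h))

heapLocs-support : ∀ h π → Fixes π (heapLocs h) → heapAct π h ≈ʰ h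
heapLocs-support h π fix l = go (_∈?_ _≟_ l dom)
  where
  dom = proj₁ (finite h)
  go : Dec (l ∈ dom) → cellAct? π (cells h (from π l)) ≡ cells h l
  go (yes l∈) = trans
    (cong (λ l′ → cellAct? π (cells h l′)) (fixes-⁻¹ π fix (∈-++⁺ˡ l∈)))
    (cellLocs?-support (cells h l) π λ l′∈ →
      fix (∈-++⁺ʳ dom (∈-concatMap⁺ _ (Any.map (λ { refl → l′∈ }) l∈))))
  go (no l∉) = trans
    (cong (cellAct? π) (proj₂ (finite h) λ l′∈ →
      l∉ (subst (_∈ dom) (trans (sym (fix (∈-++⁺ˡ l′∈))) (to-from π l)) l′∈)))
    (sym (proj₂ (finite h) l∉))

heapSet : FMSet
heapSet = record
  { setoid = record
      { Carrier       = Heap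
      ; _≈_           = _≈ʰ_
      ; isEquivalence = record
          { refl  = λ _ → refl
          ; sym   = λ p l → sym (p l)
          ; trans = λ p q l → trans (p l) (q l)
          }
      }
  ; _∙_     = heapAct
  ; ∙-cong  = λ π p l → cong (cellAct? π) (p (from π l))
  ; ∙-id    = λ h l → cellAct?-id (cells h l)
  ; ∙-∘     = λ π π′ h l → cellAct?-∘ π π′ (cells h (from π′ (from π l)))
  ; finSupp = λ h → heapLocs h , heapLocs-support h
  }

module Heapₛ = FMSet heapSet

[]ʰ : Heap
[]ʰ = record { cells = λ _ → nothing ; finite = [] , λ _ → refl }

update : Loc → Cell? → Heap → Heap
update l c h .cells l′ with l′ ≟ l
... | yes _ = c
... | no  _ = cells h l′
update l c h .finite = l ∷ proj₁ (finite h) , go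
  where
  go : ∀ {l′} → l′ ∉ l ∷ proj₁ (finite h) → update l c h .cells l′ ≡ nothing
  go {l′} l′∉ with l′ ≟ l
  ... | yes refl = ⊥-elim (l′∉ (here refl))
  ... | no  _    = proj₂ (finite h) (l′∉ ∘ there)

update-cong : ∀ l c {h h′} → h ≈ʰ h′ → update l c h ≈ʰ update l c h′
update-cong l c p l′ with l′ ≟ l
... | yes _ = refl
... | no  _ = p l′

update-equiv : ∀ π l c h → heapAct π (update l c h) ≈ʰ update (to π l) (cellAct? π c) (heapAct π h)
update-equiv π l c h l′ with from π l′ ≟ l | l′ ≟ to π l
... | yes _    | yes _    = refl
... | yes refl | no l′≢   = ⊥-elim (l′≢ (sym (to-from π l′)))
... | no l′≢   | yes refl = ⊥-elim (l′≢ (from-to π l))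
... | no _     | no _     = refl

[_↦_] : Loc → Cell → Heap
[ l ↦ c ] = update l (just c) []ʰ

_∪_ : Heap → Heap → Heap
(h ∪ h′) .cells l = cells h l Maybe.<∣> cells h′ l
(h ∪ h′) .finite = proj₁ (finite h) ++ proj₁ (finite h′) , λ l∉ →
  cong₂ Maybe._<∣>_ (proj₂ (finite h) (l∉ ∘ ∈-++⁺ˡ)) (proj₂ (finite h′) (l∉ ∘ ∈-++⁺ʳ _))

∪-equiv : ∀ π h h′ → heapAct π (h ∪ h′) ≈ʰ heapAct π h ∪ heapAct π h′
∪-equiv π h h′ l with cells h (from π l)
... | just _  = refl
... | nothing = refl

_#_ : Heap → Heap → Set
h # h′ = ∀ l → cells h l ≡ nothing ⊎ cells h′ l ≡ nothing

-- The partial operation • as its graph: h₁ • h₂ is defined and equal to h.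

_≐_•_ : Heap → Heap → Heap → Set
h ≐ h₁ • h₂ = h₁ # h₂ × h ≈ʰ (h₁ ∪ h₂)

split-∙ : ∀ π {h h₁ h₂} → h ≐ h₁ • h₂ → heapAct π h ≐ heapAct π h₁ • heapAct π h₂
split-∙ π {h} {h₁} {h₂} (disj , eq) = disj′ ,
  Heapₛ.≈-trans {heapAct π h} {heapAct π (h₁ ∪ h₂)} {heapAct π h₁ ∪ heapAct π h₂}
    (Heapₛ.∙-cong π {h} {h₁ ∪ h₂} eq) (∪-equiv π h₁ h₂)
  where
  disj′ : heapAct π h₁ # heapAct π h₂
  disj′ l with disj (from π l)
  ... | inj₁ p = inj₁ (cong (cellAct? π) p)
  ... | inj₂ p = inj₂ (cong (cellAct? π) p)

-- The cell of a value in a heap; the result is nothing iff the value is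
-- not in the domain (only locations can be).

cellAt : Heap → Val → Cell?
cellAt h (loc l) = cells h l
cellAt h (int _) = nothing
cellAt h default = nothing

updateAt : Val → Cell? → Heap → Heap
updateAt (loc l) c h = update l c h
updateAt (int _) c h = h
updateAt default c h = h

component : Fin 2 → Cell → Val
component 0F (v , _) = v
component 1F (_ , w) = w

setComponent : Fin 2 → Val → Cell → Cell
setComponent 0F u (_ , w) = u , w
setComponent 1F u (v , _) = v , u

-- Variables are well-scoped and well-typed de Bruijn indices: Δ is the
-- number of stack variables in scope, Γ the list of types of identifiers.

infixr 5 _⇒_
infixr 5 val⇒_

data Type : Set where
  com  : Type
  val⇒_ : Type → Type
  _⇒_  : Type → Type → Type

Ctx : Set
Ctx = List Type

private variable
  Δ Δ′ : ℕ
  Γ Γ′ : Ctx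
  σ τ : Type

infixl 6 _⊕_ _⊖_

data Exp (Δ : ℕ) : Set where
  svar        : Fin Δ → Exp Δ
  zeroᴱ       : Exp Δ
  oneᴱ        : Exp Δ
  minus-oneᴱ  : Exp Δ
  _⊕_ _⊖_     : Exp Δ → Exp Δ → Exp Δ

infixl 8 _·_ _·ᵥ_
infixr 4 _⨾_

data Term (Δ : ℕ) (Γ : Ctx) : Type → Set where
  var           : τ ∈ Γ → Term Δ Γ τ
  lamᵥ          : Term (suc Δ) Γ τ → Term Δ Γ (val⇒ τ)
  _·ᵥ_          : Term Δ Γ (val⇒ τ) → Exp Δ → Term Δ Γ τ
  lam           : Term Δ (σ ∷ Γ) τ → Term Δ Γ (σ ⇒ τ)
  _·_           : Term Δ Γ (σ ⇒ τ) → Term Δ Γ σ → Term Δ Γ τ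
  fix           : Term Δ Γ (τ ⇒ τ) → Term Δ Γ τ
  if_≐_then_else_ : Exp Δ → Exp Δ → Term Δ Γ com → Term Δ Γ com → Term Δ Γ com
  _⨾_           : Term Δ Γ com → Term Δ Γ com → Term Δ Γ com
  let-new       : Term (suc Δ) Γ com → Term Δ Γ com
  free          : Exp Δ → Term Δ Γ com
  let-read      : Exp Δ → Fin 2 → Term (suc Δ) Γ com → Term Δ Γ com
  assign        : Exp Δ → Fin 2 → Exp Δ → Term Δ Γ com

infix  5 _≐ᴬ_ _≤ᴬ_ _↦_,_
infixr 4 _✶_
infixr 3 _∧ᴬ_

data Assn (Δ : ℕ) : Set where
  _≐ᴬ_ _≤ᴬ_  : Exp Δ → Exp Δ → Assn Δ
  _↦_,_      : Exp Δ → Exp Δ → Exp Δ → Assn Δ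
  emp        : Assn Δ
  _✶_ _∧ᴬ_   : Assn Δ → Assn Δ → Assn Δ
  ¬ᴬ_        : Assn Δ → Assn Δ
  ∃ᴬ_        : Assn (suc Δ) → Assn Δ

infixl 5 _⊗_
infix  4 _≐ᴱ_ _≐ᵀ_
infixr 3 _∧ˢ_
infixr 2 _∨ˢ_
infixr 1 _⊃_

data Spec (Δ : ℕ) (Γ : Ctx) : Set where
  ⟪_⟫_⟪_⟫      : Assn Δ → Term Δ Γ com → Assn Δ → Spec Δ Γ
  _⊗_          : Spec Δ Γ → Assn Δ → Spec Δ Γ
  _≐ᴱ_         : Exp Δ → Exp Δ → Spec Δ Γ
  _≐ᵀ_         : Term Δ Γ τ → Term Δ Γ τ → Spec Δ Γ
  _∧ˢ_ _∨ˢ_ _⊃_ : Spec Δ Γ → Spec Δ Γ → Spec Δ Γ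
  ∀ˣ ∃ˣ        : (τ : Type) → Spec Δ (τ ∷ Γ) → Spec Δ Γ
  ∀ⁱ ∃ⁱ        : Spec (suc Δ) Γ → Spec Δ Γ

lift-fin : (Fin Δ → Fin Δ′) → Fin (suc Δ) → Fin (suc Δ′)
lift-fin r zero    = zero
lift-fin r (suc i) = suc (r i)

record Ren (Δ : ℕ) (Γ : Ctx) (Δ′ : ℕ) (Γ′ : Ctx) : Set where
  field
    onStack : Fin Δ → Fin Δ′
    onId    : ∀ {τ} → τ ∈ Γ → τ ∈ Γ′

open Ren public

liftⁱ : Ren Δ Γ Δ′ Γ′ → Ren (suc Δ) Γ (suc Δ′) Γ′
liftⁱ r .onStack = lift-fin (onStack r)
liftⁱ r .onId    = onId r

liftˣ : Ren Δ Γ Δ′ Γ′ → Ren Δ (σ ∷ Γ) Δ′ (σ ∷ Γ′)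
liftˣ r .onStack = onStack r
liftˣ r .onId (here p)  = here p
liftˣ r .onId (there x) = there (onId r x)

wkⁱ : Ren Δ Γ (suc Δ) Γ
wkⁱ .onStack = suc
wkⁱ .onId x  = x

wkˣ : Ren Δ Γ Δ (σ ∷ Γ)
wkˣ .onStack i = i
wkˣ .onId      = there

renᴱ : (Fin Δ → Fin Δ′) → Exp Δ → Exp Δ′
renᴱ r (svar i)   = svar (r i)
renᴱ r zeroᴱ      = zeroᴱ
renᴱ r oneᴱ       = oneᴱ
renᴱ r minus-oneᴱ = minus-oneᴱ
renᴱ r (E ⊕ F)    = renᴱ r E ⊕ renᴱ r F
renᴱ r (E ⊖ F)    = renᴱ r E ⊖ renᴱ r F

renᵀ : Ren Δ Γ Δ′ Γ′ → Term Δ Γ τ → Term Δ′ Γ′ τ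
renᵀ r (var x)                  = var (onId r x)
renᵀ r (lamᵥ M)                 = lamᵥ (renᵀ (liftⁱ r) M)
renᵀ r (M ·ᵥ E)                 = renᵀ r M ·ᵥ renᴱ (onStack r) E
renᵀ r (lam M)                  = lam (renᵀ (liftˣ r) M)
renᵀ r (M · N)                  = renᵀ r M · renᵀ r N
renᵀ r (fix M)                  = fix (renᵀ r M)
renᵀ r (if E ≐ F then M else N) =
  if renᴱ (onStack r) E ≐ renᴱ (onStack r) F then renᵀ r M else renᵀ r N
renᵀ r (M ⨾ N)                  = renᵀ r M ⨾ renᵀ r N
renᵀ r (let-new M)              = let-new (renᵀ (liftⁱ r) M)
renᵀ r (free E)                 = free (renᴱ (onStack r) E)
renᵀ r (let-read E f M)         = let-read (renᴱ (onStack r) E) f (renᵀ (liftⁱ r) M)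
renᵀ r (assign E f F)           = assign (renᴱ (onStack r) E) f (renᴱ (onStack r) F)

renᴬ : (Fin Δ → Fin Δ′) → Assn Δ → Assn Δ′
renᴬ r (E ≐ᴬ F)      = renᴱ r E ≐ᴬ renᴱ r F
renᴬ r (E ≤ᴬ F)      = renᴱ r E ≤ᴬ renᴱ r F
renᴬ r (E ↦ E₀ , E₁) = renᴱ r E ↦ renᴱ r E₀ , renᴱ r E₁
renᴬ r emp           = emp
renᴬ r (P ✶ Q)       = renᴬ r P ✶ renᴬ r Q
renᴬ r (P ∧ᴬ Q)      = renᴬ r P ∧ᴬ renᴬ r Q
renᴬ r (¬ᴬ P)        = ¬ᴬ renᴬ r P
renᴬ r (∃ᴬ P)        = ∃ᴬ renᴬ (lift-fin r) P

renˢ : Ren Δ Γ Δ′ Γ′ → Spec Δ Γ → Spec Δ′ Γ′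
renˢ r (⟪ P ⟫ M ⟪ Q ⟫) = ⟪ renᴬ (onStack r) P ⟫ renᵀ r M ⟪ renᴬ (onStack r) Q ⟫
renˢ r (φ ⊗ P)         = renˢ r φ ⊗ renᴬ (onStack r) P
renˢ r (E ≐ᴱ F)        = renᴱ (onStack r) E ≐ᴱ renᴱ (onStack r) F
renˢ r (M ≐ᵀ N)        = renᵀ r M ≐ᵀ renᵀ r N
renˢ r (φ ∧ˢ ψ)        = renˢ r φ ∧ˢ renˢ r ψ
renˢ r (φ ∨ˢ ψ)        = renˢ r φ ∨ˢ renˢ r ψ
renˢ r (φ ⊃ ψ)         = renˢ r φ ⊃ renˢ r ψ
renˢ r (∀ˣ τ φ)        = ∀ˣ τ (renˢ (liftˣ r) φ)
renˢ r (∃ˣ τ φ)        = ∃ˣ τ (renˢ (liftˣ r) φ)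
renˢ r (∀ⁱ φ)          = ∀ⁱ (renˢ (liftⁱ r) φ)
renˢ r (∃ⁱ φ)          = ∃ⁱ (renˢ (liftⁱ r) φ)

wkᴱ : Exp Δ → Exp (suc Δ)
wkᴱ = renᴱ suc

wkᴬ : Assn Δ → Assn (suc Δ)
wkᴬ = renᴬ suc

_∨ᴬ_ : Assn Δ → Assn Δ → Assn Δ
P ∨ᴬ Q = ¬ᴬ (¬ᴬ P ∧ᴬ ¬ᴬ Q)

_≢ᴬ_ : Exp Δ → Exp Δ → Assn Δ
E ≢ᴬ F = ¬ᴬ (E ≐ᴬ F)

_⇔ˢ_ : Spec Δ Γ → Spec Δ Γ → Spec Δ Γ
φ ⇔ˢ ψ = (φ ⊃ ψ) ∧ˢ (ψ ⊃ φ)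

_↦– : Exp Δ → Assn Δ
E ↦– = ∃ᴬ ∃ᴬ (wkᴱ (wkᴱ E) ↦ svar 1F , svar 0F)

_↦–,_ : Exp Δ → Exp Δ → Assn Δ
E ↦–, E₁ = ∃ᴬ (wkᴱ E ↦ svar 0F , wkᴱ E₁)

infixr 3 _∨ᴬ_
infix  5 _≢ᴬ_ _↦– _↦–,_
infix  1 _⇔ˢ_

record Sub (Δ : ℕ) (Γ : Ctx) (Δ′ : ℕ) (Γ′ : Ctx) : Set where
  field
    forStack : Fin Δ → Exp Δ′
    forId    : ∀ {τ} → τ ∈ Γ → Term Δ′ Γ′ τ

open Sub public

lift-exp : (Fin Δ → Exp Δ′) → Fin (suc Δ) → Exp (suc Δ′)
lift-exp s zero    = svar zero
lift-exp s (suc i) = wkᴱ (s i)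

liftSubⁱ : Sub Δ Γ Δ′ Γ′ → Sub (suc Δ) Γ (suc Δ′) Γ′
liftSubⁱ s .forStack = lift-exp (forStack s)
liftSubⁱ s .forId x  = renᵀ wkⁱ (forId s x)

liftSubˣ : Sub Δ Γ Δ′ Γ′ → Sub Δ (σ ∷ Γ) Δ′ (σ ∷ Γ′)
liftSubˣ s .forStack = forStack s
liftSubˣ s .forId (here p)  = var (here p)
liftSubˣ s .forId (there x) = renᵀ wkˣ (forId s x)

subᴱ : (Fin Δ → Exp Δ′) → Exp Δ → Exp Δ′
subᴱ s (svar i)   = s i
subᴱ s zeroᴱ      = zeroᴱ
subᴱ s oneᴱ       = oneᴱ
subᴱ s minus-oneᴱ = minus-oneᴱ
subᴱ s (E ⊕ F)    = subᴱ s E ⊕ subᴱ s F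
subᴱ s (E ⊖ F)    = subᴱ s E ⊖ subᴱ s F

subᵀ : Sub Δ Γ Δ′ Γ′ → Term Δ Γ τ → Term Δ′ Γ′ τ
subᵀ s (var x)                  = forId s x
subᵀ s (lamᵥ M)                 = lamᵥ (subᵀ (liftSubⁱ s) M)
subᵀ s (M ·ᵥ E)                 = subᵀ s M ·ᵥ subᴱ (forStack s) E
subᵀ s (lam M)                  = lam (subᵀ (liftSubˣ s) M)
subᵀ s (M · N)                  = subᵀ s M · subᵀ s N
subᵀ s (fix M)                  = fix (subᵀ s M)
subᵀ s (if E ≐ F then M else N) =
  if subᴱ (forStack s) E ≐ subᴱ (forStack s) F then subᵀ s M else subᵀ s N
subᵀ s (M ⨾ N)                  = subᵀ s M ⨾ subᵀ s N
subᵀ s (let-new M)              = let-new (subᵀ (liftSubⁱ s) M)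
subᵀ s (free E)                 = free (subᴱ (forStack s) E)
subᵀ s (let-read E f M)         = let-read (subᴱ (forStack s) E) f (subᵀ (liftSubⁱ s) M)
subᵀ s (assign E f F)           = assign (subᴱ (forStack s) E) f (subᴱ (forStack s) F)

subᴬ : (Fin Δ → Exp Δ′) → Assn Δ → Assn Δ′
subᴬ s (E ≐ᴬ F)      = subᴱ s E ≐ᴬ subᴱ s F
subᴬ s (E ≤ᴬ F)      = subᴱ s E ≤ᴬ subᴱ s F
subᴬ s (E ↦ E₀ , E₁) = subᴱ s E ↦ subᴱ s E₀ , subᴱ s E₁
subᴬ s emp           = emp
subᴬ s (P ✶ Q)       = subᴬ s P ✶ subᴬ s Q
subᴬ s (P ∧ᴬ Q)      = subᴬ s P ∧ᴬ subᴬ s Q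
subᴬ s (¬ᴬ P)        = ¬ᴬ subᴬ s P
subᴬ s (∃ᴬ P)        = ∃ᴬ subᴬ (lift-exp s) P

subˢ : Sub Δ Γ Δ′ Γ′ → Spec Δ Γ → Spec Δ′ Γ′
subˢ s (⟪ P ⟫ M ⟪ Q ⟫) = ⟪ subᴬ (forStack s) P ⟫ subᵀ s M ⟪ subᴬ (forStack s) Q ⟫
subˢ s (φ ⊗ P)         = subˢ s φ ⊗ subᴬ (forStack s) P
subˢ s (E ≐ᴱ F)        = subᴱ (forStack s) E ≐ᴱ subᴱ (forStack s) F
subˢ s (M ≐ᵀ N)        = subᵀ s M ≐ᵀ subᵀ s N
subˢ s (φ ∧ˢ ψ)        = subˢ s φ ∧ˢ subˢ s ψ
subˢ s (φ ∨ˢ ψ)        = subˢ s φ ∨ˢ subˢ s ψ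
subˢ s (φ ⊃ ψ)         = subˢ s φ ⊃ subˢ s ψ
subˢ s (∀ˣ τ φ)        = ∀ˣ τ (subˢ (liftSubˣ s) φ)
subˢ s (∃ˣ τ φ)        = ∃ˣ τ (subˢ (liftSubˣ s) φ)
subˢ s (∀ⁱ φ)          = ∀ⁱ (subˢ (liftSubⁱ s) φ)
subˢ s (∃ⁱ φ)          = ∃ⁱ (subˢ (liftSubⁱ s) φ)

singleⁱ : Exp Δ → Sub (suc Δ) Γ Δ Γ
singleⁱ E .forStack zero    = E
singleⁱ E .forStack (suc i) = svar i
singleⁱ E .forId x          = var x

singleˣ : Term Δ Γ σ → Sub Δ (σ ∷ Γ) Δ Γ
singleˣ M .forStack         = svar
singleˣ M .forId (here refl) = M
singleˣ M .forId (there x)   = var x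

_[_]ⁱ : Spec (suc Δ) Γ → Exp Δ → Spec Δ Γ
φ [ E ]ⁱ = subˢ (singleⁱ E) φ

_[_]ˣ : Spec Δ (σ ∷ Γ) → Term Δ Γ σ → Spec Δ Γ
φ [ M ]ˣ = subˢ (singleˣ M) φ

addᵛ subᵛ : Val → Val → Val
addᵛ (int a) (int b) = int (a ℤ.+ b)
addᵛ _       _       = default
subᵛ (int a) (int b) = int (a ℤ.- b)
subᵛ _       _       = default

data _≤ᵛ_ : Val → Val → Set where
  int≤int : ∀ {a b} → a ℤ.≤ b → int a ≤ᵛ int b

⟦_⟧ᴱ : Exp Δ → Stack Δ → Val
⟦ svar i ⟧ᴱ     ρ = lookup ρ i
⟦ zeroᴱ ⟧ᴱ      ρ = int 0ℤ
⟦ oneᴱ ⟧ᴱ       ρ = int 1ℤ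
⟦ minus-oneᴱ ⟧ᴱ ρ = int -1ℤ
⟦ E ⊕ F ⟧ᴱ      ρ = addᵛ (⟦ E ⟧ᴱ ρ) (⟦ F ⟧ᴱ ρ)
⟦ E ⊖ F ⟧ᴱ      ρ = subᵛ (⟦ E ⟧ᴱ ρ) (⟦ F ⟧ᴱ ρ)

addᵛ-equiv : ∀ π v w → valAct π (addᵛ v w) ≡ addᵛ (valAct π v) (valAct π w)
addᵛ-equiv π (loc _) w       = refl
addᵛ-equiv π default w       = refl
addᵛ-equiv π (int a) (loc _) = refl
addᵛ-equiv π (int a) (int b) = refl
addᵛ-equiv π (int a) default = refl

subᵛ-equiv : ∀ π v w → valAct π (subᵛ v w) ≡ subᵛ (valAct π v) (valAct π w)
subᵛ-equiv π (loc _) w       = refl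
subᵛ-equiv π default w       = refl
subᵛ-equiv π (int a) (loc _) = refl
subᵛ-equiv π (int a) (int b) = refl
subᵛ-equiv π (int a) default = refl

⟦⟧ᴱ-equiv : ∀ π (E : Exp Δ) ρ → valAct π (⟦ E ⟧ᴱ ρ) ≡ ⟦ E ⟧ᴱ (stackAct π ρ)
⟦⟧ᴱ-equiv π (svar i)   ρ = sym (Vecₚ.lookup-map i (valAct π) ρ)
⟦⟧ᴱ-equiv π zeroᴱ      ρ = refl
⟦⟧ᴱ-equiv π oneᴱ       ρ = refl
⟦⟧ᴱ-equiv π minus-oneᴱ ρ = refl
⟦⟧ᴱ-equiv π (E ⊕ F)    ρ =
  trans (addᵛ-equiv π (⟦ E ⟧ᴱ ρ) _) (cong₂ addᵛ (⟦⟧ᴱ-equiv π E ρ) (⟦⟧ᴱ-equiv π F ρ))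
⟦⟧ᴱ-equiv π (E ⊖ F)    ρ =
  trans (subᵛ-equiv π (⟦ E ⟧ᴱ ρ) _) (cong₂ subᵛ (⟦⟧ᴱ-equiv π E ρ) (⟦⟧ᴱ-equiv π F ρ))

⟦_⟧ᴬ : Assn Δ → Stack Δ → Heap → Set
⟦ E ≐ᴬ F ⟧ᴬ      ρ h = ⟦ E ⟧ᴱ ρ ≡ ⟦ F ⟧ᴱ ρ
⟦ E ≤ᴬ F ⟧ᴬ      ρ h = ⟦ E ⟧ᴱ ρ ≤ᵛ ⟦ F ⟧ᴱ ρ
⟦ E ↦ E₀ , E₁ ⟧ᴬ ρ h = ∃ λ l → ⟦ E ⟧ᴱ ρ ≡ loc l × h ≈ʰ [ l ↦ (⟦ E₀ ⟧ᴱ ρ , ⟦ E₁ ⟧ᴱ ρ) ]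
⟦ emp ⟧ᴬ         ρ h = h ≈ʰ []ʰ
⟦ P ✶ Q ⟧ᴬ       ρ h = ∃ λ h₁ → ∃ λ h₂ → h ≐ h₁ • h₂ × ⟦ P ⟧ᴬ ρ h₁ × ⟦ Q ⟧ᴬ ρ h₂
⟦ P ∧ᴬ Q ⟧ᴬ      ρ h = ⟦ P ⟧ᴬ ρ h × ⟦ Q ⟧ᴬ ρ h
⟦ ¬ᴬ P ⟧ᴬ        ρ h = ¬ ⟦ P ⟧ᴬ ρ h
⟦ ∃ᴬ P ⟧ᴬ        ρ h = ∃ λ v → ⟦ P ⟧ᴬ (v ∷ ρ) h

⟦⟧ᴬ-resp : ∀ (P : Assn Δ) ρ {h h′} → h ≈ʰ h′ → ⟦ P ⟧ᴬ ρ h → ⟦ P ⟧ᴬ ρ h′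
⟦⟧ᴬ-resp (E ≐ᴬ F)      ρ eq p = p
⟦⟧ᴬ-resp (E ≤ᴬ F)      ρ eq p = p
⟦⟧ᴬ-resp (E ↦ E₀ , E₁) ρ eq (l , p , q) = l , p , λ l → trans (sym (eq l)) (q l)
⟦⟧ᴬ-resp emp           ρ eq p = λ l → trans (sym (eq l)) (p l)
⟦⟧ᴬ-resp (P ✶ Q)       ρ eq (h₁ , h₂ , (d , s) , p , q) =
  h₁ , h₂ , (d , λ l → trans (sym (eq l)) (s l)) , p , q
⟦⟧ᴬ-resp (P ∧ᴬ Q)      ρ eq (p , q) = ⟦⟧ᴬ-resp P ρ eq p , ⟦⟧ᴬ-resp Q ρ eq q
⟦⟧ᴬ-resp (¬ᴬ P)        ρ eq ¬p p = ¬p (⟦⟧ᴬ-resp P ρ (λ l → sym (eq l)) p)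
⟦⟧ᴬ-resp (∃ᴬ P)        ρ eq (v , p) = v , ⟦⟧ᴬ-resp P (v ∷ ρ) eq p

⟦⟧ᴬ-equiv : ∀ π (P : Assn Δ) ρ h → ⟦ P ⟧ᴬ ρ h → ⟦ P ⟧ᴬ (stackAct π ρ) (heapAct π h)
⟦⟧ᴬ-equiv π (E ≐ᴬ F) ρ h p =
  trans (sym (⟦⟧ᴱ-equiv π E ρ)) (trans (cong (valAct π) p) (⟦⟧ᴱ-equiv π F ρ))
⟦⟧ᴬ-equiv π (E ≤ᴬ F) ρ h p =
  ≡.subst₂ _≤ᵛ_ (⟦⟧ᴱ-equiv π E ρ) (⟦⟧ᴱ-equiv π F ρ) (≤ᵛ-equiv p)
  where
  ≤ᵛ-equiv : ∀ {v w} → v ≤ᵛ w → valAct π v ≤ᵛ valAct π w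
  ≤ᵛ-equiv (int≤int p) = int≤int p
⟦⟧ᴬ-equiv π (E ↦ E₀ , E₁) ρ h (l , p , q) =
  to π l , trans (sym (⟦⟧ᴱ-equiv π E ρ)) (cong (valAct π) p) ,
  subst (λ c → heapAct π h ≈ʰ [ to π l ↦ c ])
    (cong₂ _,_ (⟦⟧ᴱ-equiv π E₀ ρ) (⟦⟧ᴱ-equiv π E₁ ρ))
    (Heapₛ.≈-trans {heapAct π h} {heapAct π [ l ↦ c ]} {[ to π l ↦ cellAct π c ]}
      (Heapₛ.∙-cong π {h} {[ l ↦ c ]} q)
      (λ l′ → trans (update-equiv π l (just c) []ʰ l′)
                    (update-cong (to π l) _ {heapAct π []ʰ} {[]ʰ} (λ _ → refl) l′)))
  where
  c : Cell
  c = ⟦ E₀ ⟧ᴱ ρ , ⟦ E₁ ⟧ᴱ ρ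
⟦⟧ᴬ-equiv π emp ρ h p = λ l → cong (cellAct? π) (p (from π l))
⟦⟧ᴬ-equiv π (P ✶ Q) ρ h (h₁ , h₂ , s , p , q) =
  heapAct π h₁ , heapAct π h₂ , split-∙ π {h} {h₁} {h₂} s ,
  ⟦⟧ᴬ-equiv π P ρ h₁ p , ⟦⟧ᴬ-equiv π Q ρ h₂ q
⟦⟧ᴬ-equiv π (P ∧ᴬ Q) ρ h (p , q) = ⟦⟧ᴬ-equiv π P ρ h p , ⟦⟧ᴬ-equiv π Q ρ h q
⟦⟧ᴬ-equiv π (¬ᴬ P) ρ h ¬p p = ¬p
  (⟦⟧ᴬ-resp P ρ (Heapₛ.∙-inverseˡ π h)
    (subst (λ ρ′ → ⟦ P ⟧ᴬ ρ′ (heapAct (π ⁻¹) (heapAct π h))) (stackAct-inverse π ρ)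
      (⟦⟧ᴬ-equiv (π ⁻¹) P (stackAct π ρ) (heapAct π h) p)))
⟦⟧ᴬ-equiv π (∃ᴬ P) ρ h (v , p) = valAct π v , ⟦⟧ᴬ-equiv π P (v ∷ ρ) h p

-- `resp`: heaps are taken up to extensional equality.

record ℛ : Set₁ where
  field
    rel  : Heap → Heap → Set
    resp : ∀ {h₀ h₀′ h₁ h₁′} → h₀ ≈ʰ h₀′ → h₁ ≈ʰ h₁′ → rel h₀ h₁ → rel h₀′ h₁′
    supp : ∃ λ L → ∀ π → Fixes π L →
             ∀ h₀ h₁ → rel h₀ h₁ ⇔ rel (heapAct π h₀) (heapAct π h₁)

open ℛ public using (rel)

two-way : ∀ {rel : Heap → Heap → Set} {L} →
  (∀ {h₀ h₀′ h₁ h₁′} → h₀ ≈ʰ h₀′ → h₁ ≈ʰ h₁′ → rel h₀ h₁ → rel h₀′ h₁′) →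
  (∀ π → Fixes π L → ∀ h₀ h₁ → rel h₀ h₁ → rel (heapAct π h₀) (heapAct π h₁)) →
  ∀ π → Fixes π L → ∀ h₀ h₁ → rel h₀ h₁ ⇔ rel (heapAct π h₀) (heapAct π h₁)
two-way {rel} resp inv π fx h₀ h₁ = mk⇔ (inv π fx h₀ h₁) λ p →
  resp {heapAct (π ⁻¹) (heapAct π h₀)} {h₀} {heapAct (π ⁻¹) (heapAct π h₁)} {h₁}
    (Heapₛ.∙-inverseˡ π h₀) (Heapₛ.∙-inverseˡ π h₁)
    (inv (π ⁻¹) (fixes-⁻¹ π fx) (heapAct π h₀) (heapAct π h₁) p)

infixl 6 _⋆_

_⋆_ : ℛ → ℛ → ℛ
r ⋆ s = record
  { rel  = r⋆s
  ; resp = λ {h₀} {h₀′} {h₁} {h₁′} → r⋆s-resp {h₀} {h₀′} {h₁} {h₁′}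
  ; supp = L , two-way {r⋆s} {L}
      (λ {h₀} {h₀′} {h₁} {h₁′} → r⋆s-resp {h₀} {h₀′} {h₁} {h₁′}) r⋆s-inv
  }
  where
  r⋆s : Heap → Heap → Set
  r⋆s h₀ h₁ = ∃[ n₀ ] ∃[ m₀ ] ∃[ n₁ ] ∃[ m₁ ]
    h₀ ≐ n₀ • m₀ × h₁ ≐ n₁ • m₁ × rel r n₀ n₁ × rel s m₀ m₁
  r⋆s-resp : ∀ {h₀ h₀′ h₁ h₁′} → h₀ ≈ʰ h₀′ → h₁ ≈ʰ h₁′ → r⋆s h₀ h₁ → r⋆s h₀′ h₁′
  L : List Loc
  L = proj₁ (ℛ.supp r) ++ proj₁ (ℛ.supp s)
  r⋆s-inv : ∀ π → Fixes π L → ∀ h₀ h₁ → r⋆s h₀ h₁ → r⋆s (heapAct π h₀) (heapAct π h₁)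
  r⋆s-inv π fx h₀ h₁ (n₀ , m₀ , n₁ , m₁ , s₀ , s₁ , p , q) =
    heapAct π n₀ , heapAct π m₀ , heapAct π n₁ , heapAct π m₁ ,
    split-∙ π {h₀} {n₀} {m₀} s₀ , split-∙ π {h₁} {n₁} {m₁} s₁ ,
    Equivalence.to (proj₂ (ℛ.supp r) π (λ l∈ → fx (∈-++⁺ˡ l∈)) n₀ n₁) p ,
    Equivalence.to (proj₂ (ℛ.supp s) π (λ l∈ → fx (∈-++⁺ʳ (proj₁ (ℛ.supp r)) l∈)) m₀ m₁) q
  r⋆s-resp e₀ e₁ (n₀ , m₀ , n₁ , m₁ , (d₀ , s₀) , (d₁ , s₁) , p , q) =
    n₀ , m₀ , n₁ , m₁ , (d₀ , λ l → trans (sym (e₀ l)) (s₀ l)) ,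
    (d₁ , λ l → trans (sym (e₁ l)) (s₁ l)) , p , q

eq : (A : FMCpo) → (∣ A ∣ → Set) → ∣ A ∣ → ∣ A ∣ → Set
eq A D d₀ d₁ = FMCpo._≈_ A d₀ d₁ × D d₀

Heapᴰ : FMCpo
Heapᴰ = discrete heapSet

eqᴬ : Assn Δ → Stack Δ → ℛ
eqᴬ P ρ = record
  { rel  = eq Heapᴰ (⟦ P ⟧ᴬ ρ)
  ; resp = λ {h₀} {h₀′} {h₁} {h₁′} → eq-resp {h₀} {h₀′} {h₁} {h₁′}
  ; supp = stackLocs ρ ,
           two-way {eq Heapᴰ (⟦ P ⟧ᴬ ρ)}
             (λ {h₀} {h₀′} {h₁} {h₁′} → eq-resp {h₀} {h₀′} {h₁} {h₁′})
             λ π fx h₀ h₁ (e , p) →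
               Heapₛ.∙-cong π {h₀} {h₁} e ,
               subst (λ ρ′ → ⟦ P ⟧ᴬ ρ′ (heapAct π h₀)) (stackLocs-support ρ π fx)
                 (⟦⟧ᴬ-equiv π P ρ h₀ p)
  }
  where
  eq-resp : ∀ {h₀ h₀′ h₁ h₁′} → h₀ ≈ʰ h₀′ → h₁ ≈ʰ h₁′ →
            eq Heapᴰ (⟦ P ⟧ᴬ ρ) h₀ h₁ → eq Heapᴰ (⟦ P ⟧ᴬ ρ) h₀′ h₁′
  eq-resp e₀ e₁ (e , p) =
    (λ l → trans (sym (e₀ l)) (trans (e l) (e₁ l))) , ⟦⟧ᴬ-resp P ρ e₀ p

data O : Set where
  normal err ⊥ᴼ : O

infix 4 _⊑ᴼ_

data _⊑ᴼ_ : O → O → Set where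
  bot⊑ : ∀ {o} → ⊥ᴼ ⊑ᴼ o
  refl : ∀ {o} → o ⊑ᴼ o

⊑ᴼ-trans : ∀ {a b c} → a ⊑ᴼ b → b ⊑ᴼ c → a ⊑ᴼ c
⊑ᴼ-trans bot⊑ q = bot⊑
⊑ᴼ-trans refl q = q

⊑ᴼ-antisym : ∀ {a b} → a ⊑ᴼ b → b ⊑ᴼ a → a ≡ b
⊑ᴼ-antisym refl q    = refl
⊑ᴼ-antisym bot⊑ bot⊑ = refl
⊑ᴼ-antisym bot⊑ refl = refl

⊑ᴼ-flat : ∀ {a b} → a ≢ ⊥ᴼ → a ⊑ᴼ b → b ≡ a
⊑ᴼ-flat a≢⊥ bot⊑ = ⊥-elim (a≢⊥ refl)
⊑ᴼ-flat a≢⊥ refl = refl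

Oᴾ : FMPoset
Oᴾ = record
  { fmset          = trivial-set O
  ; _⊑_            = _⊑ᴼ_
  ; isPartialOrder = record
      { isPreorder = record
          { isEquivalence = ≡.isEquivalence
          ; reflexive     = λ { refl → refl }
          ; trans         = ⊑ᴼ-trans
          }
      ; antisym = ⊑ᴼ-antisym
      }
  ; ∙-mono         = λ _ p → p
  }

G : O → Set
G o = o ≡ normal ⊎ o ≡ ⊥ᴼ

homFun : Hom A B → Fun A B
homFun {A} {B} f = record
  { fun   = app f
  ; mono  = Hom.mono f
  ; cont  = Hom.cont f
  ; fsupp = [] , mkSupport A B (Hom.mono f) λ π _ a → Hom.equiv f π a
  }

𝟙 Valᴰ Locᴰ Cellᴰ Cell?ᴰ Boolᴰ : FMCpo
𝟙      = discrete (trivial-set ⊤)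
Valᴰ   = discrete valSet
Locᴰ   = discrete locSet
Cellᴰ  = discrete cellSet
Cell?ᴰ = discrete cell?Set
Boolᴰ  = discrete (trivial-set Bool)

Stackᴰ : ℕ → FMCpo
Stackᴰ n = discrete (stackSet n)

caseᴴ : (D : FMSet) (let module D = FMSet D) → (∀ {d e} → d D.≈ e → d ≡ e) →
        (F : D.Carrier → Fun X C) →
        (∀ π d x → FMCpo._≈_ C (FMCpo._∙_ C π (fun (F d) x))
                               (fun (F (π D.∙ d)) (FMCpo._∙_ X π x))) →
        Hom (discrete D ×ᴰ X) C
caseᴴ {X} {C} D ≈⇒≡ F F-equiv = record
  { app   = F′
  ; equiv = λ π (d , x) → F-equiv π d x
  ; mono  = λ {x} {y} → F-mono {x} {y}
  ; cont  = continuous DX C F′ (λ {x} {y} → F-mono {x} {y}) λ c {(d , x)} l z ub →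
      proj₂ (Fun.cont (F d) (Hom.mapChain (π₂ {discrete D} {X}) c)
                            (Hom.cont (π₂ {discrete D} {X}) c {d , x} l)) z λ n →
        subst (λ e → fun (F e) (proj₂ (at c n)) ⊑ z) (≈⇒≡ (proj₁ (proj₁ l n))) (ub n)
  }
  where
  module D = FMSet D
  open FMCpo C using (_⊑_)
  DX = discrete D ×ᴰ X
  F′ : ∣ DX ∣ → ∣ C ∣
  F′ (d , x) = fun (F d) x
  F-mono : Monotone DX C F′
  F-mono {d , x} {e , y} (p , q) with ≈⇒≡ p
  ... | refl = Fun.mono (F d) q

ifᴴ : Hom X C → Hom X C → Hom (Boolᴰ ×ᴰ X) C
ifᴴ {X} {C} f g = caseᴴ (trivial-set Bool) (λ p → p)
  (λ { true → homFun f ; false → homFun g })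
  λ { π true x → Hom.equiv f π x ; π false x → Hom.equiv g π x }

maybeᴴ : Hom X C → Hom (Cellᴰ ×ᴰ X) C → Hom (Cell?ᴰ ×ᴰ X) C
maybeᴴ f g = caseᴴ cell?Set (λ p → p)
  (λ { nothing → homFun f ; (just c) → app (curry g) c })
  λ { π nothing x → Hom.equiv f π x ; π (just c) x → Hom.equiv g π (c , x) }

expᴴ : Exp Δ → Hom (Stackᴰ Δ) Valᴰ
expᴴ {Δ} E = liftᴴ {Stackᴰ Δ} {Valᴰ} (λ p → p) ⟦ E ⟧ᴱ (cong ⟦ E ⟧ᴱ) (λ π → ⟦⟧ᴱ-equiv π E)

consᴴ : Hom (Valᴰ ×ᴰ Stackᴰ Δ) (Stackᴰ (suc Δ))
consᴴ {Δ} = liftᴴ {Valᴰ ×ᴰ Stackᴰ Δ} {Stackᴰ (suc Δ)} (λ p → p) (λ (v , ρ) → v ∷ ρ)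
  (λ { (refl , refl) → refl }) (λ _ _ → refl)

locᴴ : Hom Locᴰ Valᴰ
locᴴ = liftᴴ {Locᴰ} {Valᴰ} (λ p → p) loc (cong loc) (λ _ _ → refl)

eqᴴ : Hom (Valᴰ ×ᴰ Valᴰ) Boolᴰ
eqᴴ = liftᴴ {Valᴰ ×ᴰ Valᴰ} {Boolᴰ} (λ p → p) (λ (v , w) → does (v ≟ᵛ w))
  (λ { (refl , refl) → refl }) equiv
  where
  equiv : ∀ π vw → does (proj₁ vw ≟ᵛ proj₂ vw) ≡
                   does (valAct π (proj₁ vw) ≟ᵛ valAct π (proj₂ vw))
  equiv π (v , w) with v ≟ᵛ w | valAct π v ≟ᵛ valAct π w
  ... | yes _    | yes _ = refl
  ... | yes refl | no ¬p = ⊥-elim (¬p refl)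
  ... | no ¬p    | yes p = ⊥-elim (¬p (valAct-injective π p))
  ... | no _     | no _  = refl

componentᴴ : Fin 2 → Hom Cellᴰ Valᴰ
componentᴴ f = liftᴴ {Cellᴰ} {Valᴰ} (λ p → p) (component f) (cong (component f)) (equiv f)
  where
  equiv : ∀ f π c → valAct π (component f c) ≡ component f (cellAct π c)
  equiv 0F π c = refl
  equiv 1F π c = refl

setComponentᴴ : Fin 2 → Hom (Valᴰ ×ᴰ Cellᴰ) Cellᴰ
setComponentᴴ f = liftᴴ {Valᴰ ×ᴰ Cellᴰ} {Cellᴰ} (λ p → p) (λ (v , c) → setComponent f v c)
  (λ { (refl , refl) → refl }) (equiv f)
  where
  equiv : ∀ f π vc → cellAct π (setComponent f (proj₁ vc) (proj₂ vc)) ≡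
                     setComponent f (valAct π (proj₁ vc)) (cellAct π (proj₂ vc))
  equiv 0F π c = refl
  equiv 1F π c = refl

cellAtᴴ : Hom (Heapᴰ ×ᴰ Valᴰ) Cell?ᴰ
cellAtᴴ = liftᴴ {Heapᴰ ×ᴰ Valᴰ} {Cell?ᴰ} (λ p → p) (λ (h , v) → cellAt h v)
  (λ { {h , v} {h′ , _} (p , refl) → resp v p }) equiv
  where
  resp : ∀ {h h′} v → h ≈ʰ h′ → cellAt h v ≡ cellAt h′ v
  resp (loc l) p = p l
  resp (int _) p = refl
  resp default p = refl
  equiv : ∀ π hv → cellAct? π (cellAt (proj₁ hv) (proj₂ hv)) ≡
                   cellAt (heapAct π (proj₁ hv)) (valAct π (proj₂ hv))
  equiv π (h , loc l) = cong (λ l′ → cellAct? π (cells h l′)) (sym (from-to π l))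
  equiv π (h , int _) = refl
  equiv π (h , default) = refl

updateᴴ : Hom (Valᴰ ×ᴰ Cell?ᴰ ×ᴰ Heapᴰ) Heapᴰ
updateᴴ = liftᴴ {Valᴰ ×ᴰ Cell?ᴰ ×ᴰ Heapᴰ} {Heapᴰ} (λ p → p) (λ (v , c , h) → updateAt v c h)
  (λ { {v , c , h} {_ , _ , h′} (refl , refl , p) → resp v c {h} {h′} p })
  (λ (π : Perm) (v , c , h) → equiv π v c h)
  where
  resp : ∀ v c {h h′} → h ≈ʰ h′ → updateAt v c h ≈ʰ updateAt v c h′
  resp (loc l) c {h} {h′} p = update-cong l c {h} {h′} p
  resp (int _) c p = p
  resp default c p = p
  equiv : ∀ π v c h → heapAct π (updateAt v c h) ≈ʰ
                      updateAt (valAct π v) (cellAct? π c) (heapAct π h)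
  equiv π (loc l) c h = update-equiv π l c h
  equiv π (int _) c h = λ _ → refl
  equiv π default c h = λ _ → refl

justᴴ : Hom Cellᴰ Cell?ᴰ
justᴴ = liftᴴ {Cellᴰ} {Cell?ᴰ} (λ p → p) just (cong just) (λ _ _ → refl)

nothingᴴ : Hom X Cell?ᴰ
nothingᴴ {X} = record
  { app = λ _ → nothing ; equiv = λ _ _ → refl ; mono = λ _ → refl
  ; cont = λ _ _ → (λ _ → refl) , λ _ ub → ub 0 }

newCell : Cell
newCell = int 0ℤ , int 0ℤ

allocᴴ : Hom (Heapᴰ ×ᴰ Locᴰ) Heapᴰ
allocᴴ = liftᴴ {Heapᴰ ×ᴰ Locᴰ} {Heapᴰ} (λ p → p) (λ (h , l) → h ∪ [ l ↦ newCell ])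
  (λ { {h , l} {h′ , _} (p , refl) l′ → cong (Maybe._<∣> cells [ l ↦ newCell ] l′) (p l′) })
  (λ (π : Perm) (h , l) l′ → trans (∪-equiv π h [ l ↦ newCell ] l′)
    (cong (cells (heapAct π h) l′ Maybe.<∣>_)
      (trans (update-equiv π l (just newCell) []ʰ l′)
        (update-cong (to π l) (just newCell) {heapAct π []ʰ} {[]ʰ} (λ _ → refl) l′))))

-- Excluded middle is needed for the flat domain O to have lubs of chains.

module Semantics (em : ExcludedMiddle 0ℓ) where

  ⨆ᴼ : (c : Chain Oᴾ) → ∃ λ o → FMPoset.IsLub Oᴾ (at c) o
  ⨆ᴼ c with em {∃ λ n → at c n ≢ ⊥ᴼ}
  ... | yes (n , c≢⊥) = at c n ,
    (λ m → subst (at c m ⊑ᴼ_) (⊑ᴼ-flat c≢⊥ (chain-mono Oᴾ c (ℕₚ.m≤n⊔m m n)))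
                              (chain-mono Oᴾ c (ℕₚ.m≤m⊔n m n))) ,
    λ z ub → ub n
  ... | no ¬∃ = ⊥ᴼ , (λ m → below m) , λ _ _ → bot⊑
    where
    below : ∀ m → at c m ⊑ᴼ ⊥ᴼ
    below m with at c m in eq
    ... | ⊥ᴼ     = refl
    ... | normal = ⊥-elim (¬∃ (m , λ e → case-absurd (trans (sym eq) e)))
      where case-absurd : normal ≢ ⊥ᴼ
            case-absurd ()
    ... | err    = ⊥-elim (¬∃ (m , λ e → case-absurd (trans (sym eq) e)))
      where case-absurd : err ≢ ⊥ᴼ
            case-absurd ()

  Oᴰ : FMCpo
  Oᴰ .FMCpo.fmposet = Oᴾ
  Oᴰ .FMCpo.⨆ c     = proj₁ (⨆ᴼ c)
  Oᴰ .FMCpo.⨆-lub c = proj₂ (⨆ᴼ c)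

  Contᴰ : FMCpo
  Contᴰ = Heapᴰ ⇒ᴰ Oᴰ

  ⟦_⟧ : Type → FMCpo
  ⟦ com ⟧    = Heapᴰ ×ᴰ Contᴰ ⇒ᴰ Oᴰ
  ⟦ val⇒ τ ⟧ = Valᴰ ⇒ᴰ ⟦ τ ⟧
  ⟦ σ ⇒ τ ⟧  = ⟦ σ ⟧ ⇒ᴰ ⟦ τ ⟧

  pointed : ∀ τ → Pointed ⟦ τ ⟧
  pointed com       = ⇒-pointed record { bot = ⊥ᴼ ; least = λ _ → bot⊑ }
  pointed (val⇒ τ)  = ⇒-pointed (pointed τ)
  pointed (σ ⇒ τ)   = ⇒-pointed (pointed τ)

  ⟦_⟧ᶜ : Ctx → FMCpo
  ⟦ [] ⟧ᶜ    = 𝟙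
  ⟦ τ ∷ Γ ⟧ᶜ = ⟦ τ ⟧ ×ᴰ ⟦ Γ ⟧ᶜ

  varᴴ : τ ∈ Γ → Hom ⟦ Γ ⟧ᶜ ⟦ τ ⟧
  varᴴ (here refl) = π₁
  varᴴ (there x)   = varᴴ x ∘ᴴ π₂

  errᴴ : Hom X Oᴰ
  errᴴ = record
    { app = λ _ → err ; equiv = λ _ _ → refl ; mono = λ _ → refl
    ; cont = λ _ _ → (λ _ → refl) , λ _ ub → ub 0 }

  -- F at a fresh location; `at-fresh-any` shows that any location outside any
  -- supporting set of x gives the same result.

  module Fresh (F : Hom (Locᴰ ×ᴰ X) Oᴰ) where
    open FMCpo X

    at-fresh : ∣ X ∣ → O
    at-fresh x = app F (fresh (supp x) , x)

    swap-fresh : ∀ {L l l′ x} → Supports L x → l ∉ L → l′ ∉ L → app F (l , x) ≡ app F (l′ , x)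
    swap-fresh {L} {l} {l′} {x} s l∉ l′∉ =
      trans (Hom.equiv F (swap l l′) (l , x))
            (Hom.cong-app F (swapLoc-left l l′ , s (swap l l′) (swap-fixes l∉ l′∉)))

    any-fresh : ∀ {L L′ l l′ x} → Supports L x → l ∉ L → Supports L′ x → l′ ∉ L′ →
                app F (l , x) ≡ app F (l′ , x)
    any-fresh {L} {L′} s l∉ s′ l′∉ =
      trans (swap-fresh s l∉ (fresh-∉ (L ++ L′) ∘ ∈-++⁺ˡ))
            (swap-fresh s′ (fresh-∉ (L ++ L′) ∘ ∈-++⁺ʳ L) l′∉)

    at-fresh-any : ∀ {L l x} → Supports L x → l ∉ L → at-fresh x ≡ app F (l , x)
    at-fresh-any {x = x} s l∉ = any-fresh (supp-supports x) (fresh-∉ (supp x)) s l∉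

    at-fresh-mono : Monotone X Oᴰ at-fresh
    at-fresh-mono {x} {y} x⊑y =
      ≡.subst₂ _⊑ᴼ_
        (sym (at-fresh-any (supp-supports x) (fresh-∉ L ∘ ∈-++⁺ˡ)))
        (sym (at-fresh-any (supp-supports y) (fresh-∉ L ∘ ∈-++⁺ʳ (supp x))))
        (Hom.mono F (refl , x⊑y))
      where L = supp x ++ supp y

    freshᴴ : Hom X Oᴰ
    freshᴴ = record
      { app   = at-fresh
      ; equiv = λ π x → let l = fresh (supp x) in
          trans (Hom.equiv F π (l , x))
            (sym (at-fresh-any (supports-∙ π (supp-supports x)) (∉-map π (fresh-∉ (supp x)))))
      ; mono  = at-fresh-mono
      ; cont  = continuous X Oᴰ at-fresh at-fresh-mono λ c {x} l z ub →
          let L  = supp x ++ proj₁ (supported c)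
              ℓ  = fresh L
          in subst (_⊑ᴼ z) (sym (at-fresh-any (supp-supports x) (fresh-∉ L ∘ ∈-++⁺ˡ)))
               (proj₂ (Fun.cont (app (curry F) ℓ) c l) z λ n →
                 subst (_⊑ᴼ z) (at-fresh-any (proj₂ (supported c) n) (fresh-∉ L ∘ ∈-++⁺ʳ (supp x)))
                   (ub n))
      }
      where
      ∉-map : ∀ π {L l} → l ∉ L → to π l ∉ map (to π) L
      ∉-map π l∉ l∈ with ∈-map⁻ (to π) l∈
      ... | l′ , l′∈ , eq = l∉ (subst (_∈ _) (sym (to-injective π eq)) l′∈)

  open Fresh public using (freshᴴ)

  Ctxᴰ : ℕ → Ctx → FMCpo
  Ctxᴰ Δ Γ = Stackᴰ Δ ×ᴰ ⟦ Γ ⟧ᶜ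

  State : FMCpo → FMCpo
  State X = X ×ᴰ Heapᴰ ×ᴰ Contᴰ

  ctx : Hom (State X) X
  ctx = π₁

  heap : Hom (State X) Heapᴰ
  heap = π₁ ∘ᴴ π₂

  cont : Hom (State X) Contᴰ
  cont = π₂ ∘ᴴ π₂

  value : Exp Δ → Hom (State (Stackᴰ Δ ×ᴰ X)) Valᴰ
  value E = expᴴ E ∘ᴴ π₁ ∘ᴴ ctx

  push : Hom X Valᴰ → Hom X (Stackᴰ Δ ×ᴰ A) → Hom X (Stackᴰ (suc Δ) ×ᴰ A)
  push v x = ⟨ consᴴ ∘ᴴ ⟨ v , π₁ ∘ᴴ x ⟩ , π₂ ∘ᴴ x ⟩

  ⟦_⟧ᵀ : Term Δ Γ τ → Hom (Ctxᴰ Δ Γ) ⟦ τ ⟧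
  ⟦ var x ⟧ᵀ  = varᴴ x ∘ᴴ π₂
  ⟦ lamᵥ M ⟧ᵀ = curry (⟦ M ⟧ᵀ ∘ᴴ push π₂ π₁)
  ⟦ M ·ᵥ E ⟧ᵀ = eval ∘ᴴ ⟨ ⟦ M ⟧ᵀ , expᴴ E ∘ᴴ π₁ ⟩
  ⟦ lam M ⟧ᵀ  = curry (⟦ M ⟧ᵀ ∘ᴴ ⟨ π₁ ∘ᴴ π₁ , ⟨ π₂ , π₂ ∘ᴴ π₁ ⟩ ⟩)
  ⟦ M · N ⟧ᵀ  = eval ∘ᴴ ⟨ ⟦ M ⟧ᵀ , ⟦ N ⟧ᵀ ⟩
  ⟦ fix {τ = τ} M ⟧ᵀ = fixᴴ ⟦ τ ⟧ (pointed τ) ∘ᴴ ⟦ M ⟧ᵀ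
  ⟦ if E ≐ F then M else N ⟧ᵀ =
    ifᴴ ⟦ M ⟧ᵀ ⟦ N ⟧ᵀ ∘ᴴ ⟨ eqᴴ ∘ᴴ ⟨ expᴴ E ∘ᴴ π₁ , expᴴ F ∘ᴴ π₁ ⟩ , idᴴ ⟩
  ⟦ M ⨾ N ⟧ᵀ = curry
    (eval ∘ᴴ ⟨ ⟦ M ⟧ᵀ ∘ᴴ ctx
             , ⟨ heap , curry (eval ∘ᴴ ⟨ ⟦ N ⟧ᵀ ∘ᴴ ctx ∘ᴴ π₁ , ⟨ π₂ , cont ∘ᴴ π₁ ⟩ ⟩) ⟩ ⟩)
  ⟦ let-new M ⟧ᵀ = curry (freshᴴ
    (eval ∘ᴴ ⟨ ⟦ M ⟧ᵀ ∘ᴴ push (locᴴ ∘ᴴ π₁) (ctx ∘ᴴ π₂)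
             , ⟨ allocᴴ ∘ᴴ ⟨ heap ∘ᴴ π₂ , π₁ ⟩ , cont ∘ᴴ π₂ ⟩ ⟩))
  ⟦ free E ⟧ᵀ = curry
    (maybeᴴ errᴴ
            (eval ∘ᴴ ⟨ cont , updateᴴ ∘ᴴ ⟨ value E , ⟨ nothingᴴ , heap ⟩ ⟩ ⟩ ∘ᴴ π₂)
      ∘ᴴ ⟨ cellAtᴴ ∘ᴴ ⟨ heap , value E ⟩ , idᴴ ⟩)
  ⟦ let-read E f M ⟧ᵀ = curry
    (maybeᴴ errᴴ
            (eval ∘ᴴ ⟨ ⟦ M ⟧ᵀ ∘ᴴ push (componentᴴ f ∘ᴴ π₁) (ctx ∘ᴴ π₂)
                     , ⟨ heap , cont ⟩ ∘ᴴ π₂ ⟩)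
      ∘ᴴ ⟨ cellAtᴴ ∘ᴴ ⟨ heap , value E ⟩ , idᴴ ⟩)
  ⟦ assign E f F ⟧ᵀ = curry
    (maybeᴴ errᴴ
            (eval ∘ᴴ ⟨ cont ∘ᴴ π₂
                     , updateᴴ ∘ᴴ ⟨ value E ∘ᴴ π₂
                                  , ⟨ justᴴ ∘ᴴ setComponentᴴ f ∘ᴴ ⟨ value F ∘ᴴ π₂ , π₁ ⟩
                                    , heap ∘ᴴ π₂ ⟩ ⟩ ⟩)
      ∘ᴴ ⟨ cellAtᴴ ∘ᴴ ⟨ heap , value E ⟩ , idᴴ ⟩)

  -- The defining equations of the command clauses, in pointwise form.

  run : Term Δ Γ com → Stack Δ → ∣ ⟦ Γ ⟧ᶜ ∣ → Heap → ∣ Contᴰ ∣ → O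
  run M ρ η h k = fun (app ⟦ M ⟧ᵀ (ρ , η)) (h , k)

  module _ (ρ : Stack Δ) (η : ∣ ⟦ Γ ⟧ᶜ ∣) (h : Heap) (k : ∣ Contᴰ ∣) where

    if-eq : ∀ E F (M N : Term Δ Γ com) → run (if E ≐ F then M else N) ρ η h k ≡
      (if does (⟦ E ⟧ᴱ ρ ≟ᵛ ⟦ F ⟧ᴱ ρ) then run M ρ η h k else run N ρ η h k)
    if-eq E F M N with does (⟦ E ⟧ᴱ ρ ≟ᵛ ⟦ F ⟧ᴱ ρ)
    ... | true  = refl
    ... | false = refl

    seq-eq : ∀ (M N : Term Δ Γ com) {k′ : ∣ Contᴰ ∣} →
      (∀ h′ → fun k′ h′ ≡ run N ρ η h′ k) → run (M ⨾ N) ρ η h k ≡ run M ρ η h k′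
    seq-eq M N eq = Fun.cong-fun (app ⟦ M ⟧ᵀ (ρ , η)) ((λ _ → refl) , λ h′ → sym (eq h′))

    let-new-eq : ∀ (M : Term (suc Δ) Γ com) {l L} →
      FMCpo.Supports (State (Ctxᴰ Δ Γ)) L ((ρ , η) , h , k) → l ∉ L →
      run (let-new M) ρ η h k ≡ run M (loc l ∷ ρ) η (h ∪ [ l ↦ int 0ℤ , int 0ℤ ]) k
    let-new-eq M {l} {L} = Fresh.at-fresh-any
      (eval ∘ᴴ ⟨ ⟦ M ⟧ᵀ ∘ᴴ push (locᴴ ∘ᴴ π₁) (ctx ∘ᴴ π₂)
               , ⟨ allocᴴ ∘ᴴ ⟨ heap ∘ᴴ π₂ , π₁ ⟩ , cont ∘ᴴ π₂ ⟩ ⟩)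
      {L} {l} {(ρ , η) , h , k}

    free-eq : ∀ E → run {Δ} {Γ} (free E) ρ η h k ≡
      maybe′ (λ _ → fun k (updateAt (⟦ E ⟧ᴱ ρ) nothing h)) err (cellAt h (⟦ E ⟧ᴱ ρ))
    free-eq E with cellAt h (⟦ E ⟧ᴱ ρ)
    ... | nothing = refl
    ... | just _  = refl

    let-read-eq : ∀ E f (M : Term (suc Δ) Γ com) → run (let-read E f M) ρ η h k ≡
      maybe′ (λ c → run M (component f c ∷ ρ) η h k) err (cellAt h (⟦ E ⟧ᴱ ρ))
    let-read-eq E f M with cellAt h (⟦ E ⟧ᴱ ρ)
    ... | nothing = refl
    ... | just _  = refl

    assign-eq : ∀ E f F → run {Δ} {Γ} (assign E f F) ρ η h k ≡
      maybe′ (λ c → fun k (updateAt (⟦ E ⟧ᴱ ρ) (just (setComponent f (⟦ F ⟧ᴱ ρ) c)) h))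
             err (cellAt h (⟦ E ⟧ᴱ ρ))
    assign-eq E f F with cellAt h (⟦ E ⟧ᴱ ρ)
    ... | nothing = refl
    ... | just _  = refl

  eqG : O → O → Set
  eqG = eq Oᴰ G

  _[_⟶eqG]_ : ∣ Contᴰ ∣ → ℛ → ∣ Contᴰ ∣ → Set
  k₀ [ r ⟶eqG] k₁ = ∀ h₀ h₁ → rel r h₀ h₁ → eqG (fun k₀ h₀) (fun k₁ h₁)

  Quadruple : ℛ → ∣ ⟦ com ⟧ ∣ → ∣ ⟦ com ⟧ ∣ → ℛ → Set₁
  Quadruple r c₀ c₁ s = ∀ (r′ : ℛ) h₀ h₁ k₀ k₁ →
    rel (r ⋆ r′) h₀ h₁ → k₀ [ s ⋆ r′ ⟶eqG] k₁ → eqG (fun c₀ (h₀ , k₀)) (fun c₁ (h₁ , k₁))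

  infix 4 ⟨_,_,_,_⟩⊨_

  ⟨_,_,_,_⟩⊨_ : Stack Δ → ∣ ⟦ Γ ⟧ᶜ ∣ → ∣ ⟦ Γ ⟧ᶜ ∣ → ℛ → Spec Δ Γ → Set₁
  ⟨ ρ , η₀ , η₁ , r ⟩⊨ ⟪ P ⟫ M ⟪ Q ⟫ =
    Quadruple (eqᴬ P ρ ⋆ r) (app ⟦ M ⟧ᵀ (ρ , η₀)) (app ⟦ M ⟧ᵀ (ρ , η₁)) (eqᴬ Q ρ ⋆ r)
  ⟨ ρ , η₀ , η₁ , r ⟩⊨ (φ ⊗ P)  = ⟨ ρ , η₀ , η₁ , r ⋆ eqᴬ P ρ ⟩⊨ φ
  ⟨ ρ , η₀ , η₁ , r ⟩⊨ (E ≐ᴱ F) = Lift _ (⟦ E ⟧ᴱ ρ ≡ ⟦ F ⟧ᴱ ρ)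
  ⟨ ρ , η₀ , η₁ , r ⟩⊨ (_≐ᵀ_ {τ = τ} M N) =
    Lift _ (app ⟦ M ⟧ᵀ (ρ , η₀) ≈ app ⟦ N ⟧ᵀ (ρ , η₀) ×
            app ⟦ M ⟧ᵀ (ρ , η₁) ≈ app ⟦ N ⟧ᵀ (ρ , η₁))
    where open FMCpo ⟦ τ ⟧ using (_≈_)
  ⟨ ρ , η₀ , η₁ , r ⟩⊨ (φ ∧ˢ ψ) = ⟨ ρ , η₀ , η₁ , r ⟩⊨ φ × ⟨ ρ , η₀ , η₁ , r ⟩⊨ ψ
  ⟨ ρ , η₀ , η₁ , r ⟩⊨ (φ ∨ˢ ψ) = ⟨ ρ , η₀ , η₁ , r ⟩⊨ φ ⊎ ⟨ ρ , η₀ , η₁ , r ⟩⊨ ψ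
  ⟨ ρ , η₀ , η₁ , r ⟩⊨ (φ ⊃ ψ)  =
    ∀ s → ⟨ ρ , η₀ , η₁ , r ⋆ s ⟩⊨ φ → ⟨ ρ , η₀ , η₁ , r ⋆ s ⟩⊨ ψ
  ⟨ ρ , η₀ , η₁ , r ⟩⊨ (∀ˣ τ φ) = ∀ m n → ⟨ ρ , (m , η₀) , (n , η₁) , r ⟩⊨ φ
  ⟨ ρ , η₀ , η₁ , r ⟩⊨ (∃ˣ τ φ) = ∃[ m ] ∃[ n ] ⟨ ρ , (m , η₀) , (n , η₁) , r ⟩⊨ φ
  ⟨ ρ , η₀ , η₁ , r ⟩⊨ (∀ⁱ φ)   = ∀ v → ⟨ v ∷ ρ , η₀ , η₁ , r ⟩⊨ φ
  ⟨ ρ , η₀ , η₁ , r ⟩⊨ (∃ⁱ φ)   = ∃[ v ] ⟨ v ∷ ρ , η₀ , η₁ , r ⟩⊨ φ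

data Hole (σ : Type) (Δ : ℕ) (Γ : Ctx) : Type → Set where
  ∙    : Hole σ Δ Γ σ
  lamᵥ : Hole σ (suc Δ) Γ τ → Hole σ Δ Γ (val⇒ τ)
  _·ᵥ_ : Hole σ Δ Γ (val⇒ τ) → Exp Δ → Hole σ Δ Γ τ
  lam  : ∀ {τ′} → Hole σ Δ (τ′ ∷ Γ) τ → Hole σ Δ Γ (τ′ ⇒ τ)
  _·_  : ∀ {τ′} → Hole σ Δ Γ (τ′ ⇒ τ) → Term Δ Γ τ′ → Hole σ Δ Γ τ
  fix  : Hole σ Δ Γ (τ ⇒ τ) → Hole σ Δ Γ τ
  _⨾_  : Hole σ Δ Γ com → Term Δ Γ com → Hole σ Δ Γ com

data HoleSpec (σ : Type) (Δ : ℕ) (Γ : Ctx) : Set where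
  ⟪_⟫_⟪_⟫ : Assn Δ → Hole σ Δ Γ com → Assn Δ → HoleSpec σ Δ Γ
  _∧ˢ_    : HoleSpec σ Δ Γ → HoleSpec σ Δ Γ → HoleSpec σ Δ Γ
  ∀ˣ      : (τ : Type) → HoleSpec σ Δ (τ ∷ Γ) → HoleSpec σ Δ Γ
  ∀ⁱ      : HoleSpec σ (suc Δ) Γ → HoleSpec σ Δ Γ

renᶜ : Ren Δ Γ Δ′ Γ′ → Hole σ Δ Γ τ → Hole σ Δ′ Γ′ τ
renᶜ r ∙        = ∙
renᶜ r (lamᵥ C) = lamᵥ (renᶜ (liftⁱ r) C)
renᶜ r (C ·ᵥ E) = renᶜ r C ·ᵥ renᴱ (onStack r) E
renᶜ r (lam C)  = lam (renᶜ (liftˣ r) C)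
renᶜ r (C · M)  = renᶜ r C · renᵀ r M
renᶜ r (fix C)  = fix (renᶜ r C)
renᶜ r (C ⨾ M)  = renᶜ r C ⨾ renᵀ r M

renᵞ : Ren Δ Γ Δ′ Γ′ → HoleSpec σ Δ Γ → HoleSpec σ Δ′ Γ′
renᵞ r (⟪ P ⟫ C ⟪ Q ⟫) = ⟪ renᴬ (onStack r) P ⟫ renᶜ r C ⟪ renᴬ (onStack r) Q ⟫
renᵞ r (γ ∧ˢ δ)        = renᵞ r γ ∧ˢ renᵞ r δ
renᵞ r (∀ˣ τ γ)        = ∀ˣ τ (renᵞ (liftˣ r) γ)
renᵞ r (∀ⁱ γ)          = ∀ⁱ (renᵞ (liftⁱ r) γ)

-- Insertion of N; N is weakened under binders, so nothing is captured.

plug : Hole σ Δ Γ τ → Term Δ Γ σ → Term Δ Γ τ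
plug ∙        N = N
plug (lamᵥ C) N = lamᵥ (plug C (renᵀ wkⁱ N))
plug (C ·ᵥ E) N = plug C N ·ᵥ E
plug (lam C)  N = lam (plug C (renᵀ wkˣ N))
plug (C · M)  N = plug C N · M
plug (fix C)  N = fix (plug C N)
plug (C ⨾ M)  N = plug C N ⨾ M

_⦅_⦆ : HoleSpec σ Δ Γ → Term Δ Γ σ → Spec Δ Γ
(⟪ P ⟫ C ⟪ Q ⟫) ⦅ N ⦆ = ⟪ P ⟫ plug C N ⟪ Q ⟫
(γ ∧ˢ δ) ⦅ N ⦆ = γ ⦅ N ⦆ ∧ˢ δ ⦅ N ⦆
∀ˣ τ γ   ⦅ N ⦆ = ∀ˣ τ (γ ⦅ renᵀ wkˣ N ⦆)
∀ⁱ γ     ⦅ N ⦆ = ∀ⁱ (γ ⦅ renᵀ wkⁱ N ⦆)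

-- Natural deduction with a list Ψ of assumptions.  Side conditions i ∉ fv(_)
-- are expressed by weakening.

infix 0 _⊢_

data _⊢_ : List (Spec Δ Γ) → Spec Δ Γ → Set where

  assume : ∀ {Ψ : List (Spec Δ Γ)} {φ} → φ ∈ Ψ → Ψ ⊢ φ

  ∧-intro  : ∀ {Ψ : List (Spec Δ Γ)} {φ ψ} → Ψ ⊢ φ → Ψ ⊢ ψ → Ψ ⊢ φ ∧ˢ ψ
  ∧-elimˡ  : ∀ {Ψ : List (Spec Δ Γ)} {φ ψ} → Ψ ⊢ φ ∧ˢ ψ → Ψ ⊢ φ
  ∧-elimʳ  : ∀ {Ψ : List (Spec Δ Γ)} {φ ψ} → Ψ ⊢ φ ∧ˢ ψ → Ψ ⊢ ψ
  ∨-introˡ : ∀ {Ψ : List (Spec Δ Γ)} {φ ψ} → Ψ ⊢ φ → Ψ ⊢ φ ∨ˢ ψ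
  ∨-introʳ : ∀ {Ψ : List (Spec Δ Γ)} {φ ψ} → Ψ ⊢ ψ → Ψ ⊢ φ ∨ˢ ψ
  ∨-elim   : ∀ {Ψ : List (Spec Δ Γ)} {φ ψ χ} → Ψ ⊢ φ ∨ˢ ψ → φ ∷ Ψ ⊢ χ → ψ ∷ Ψ ⊢ χ → Ψ ⊢ χ
  ⊃-intro  : ∀ {Ψ : List (Spec Δ Γ)} {φ ψ} → φ ∷ Ψ ⊢ ψ → Ψ ⊢ φ ⊃ ψ
  ⊃-elim   : ∀ {Ψ : List (Spec Δ Γ)} {φ ψ} → Ψ ⊢ φ ⊃ ψ → Ψ ⊢ φ → Ψ ⊢ ψ

  ∀ˣ-intro : ∀ {Ψ : List (Spec Δ Γ)} {φ} → map (renˢ wkˣ) Ψ ⊢ φ → Ψ ⊢ ∀ˣ σ φ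
  ∀ˣ-elim  : ∀ {Ψ : List (Spec Δ Γ)} {φ} → Ψ ⊢ ∀ˣ σ φ → ∀ M → Ψ ⊢ φ [ M ]ˣ
  ∃ˣ-intro : ∀ {Ψ : List (Spec Δ Γ)} {φ} M → Ψ ⊢ φ [ M ]ˣ → Ψ ⊢ ∃ˣ σ φ
  ∃ˣ-elim  : ∀ {Ψ : List (Spec Δ Γ)} {φ χ} →
             Ψ ⊢ ∃ˣ σ φ → φ ∷ map (renˢ wkˣ) Ψ ⊢ renˢ wkˣ χ → Ψ ⊢ χ

  ∀ⁱ-intro : ∀ {Ψ : List (Spec Δ Γ)} {φ} → map (renˢ wkⁱ) Ψ ⊢ φ → Ψ ⊢ ∀ⁱ φ
  ∀ⁱ-elim  : ∀ {Ψ : List (Spec Δ Γ)} {φ} → Ψ ⊢ ∀ⁱ φ → ∀ E → Ψ ⊢ φ [ E ]ⁱ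
  ∃ⁱ-intro : ∀ {Ψ : List (Spec Δ Γ)} {φ} E → Ψ ⊢ φ [ E ]ⁱ → Ψ ⊢ ∃ⁱ φ
  ∃ⁱ-elim  : ∀ {Ψ : List (Spec Δ Γ)} {φ χ} →
             Ψ ⊢ ∃ⁱ φ → φ ∷ map (renˢ wkⁱ) Ψ ⊢ renˢ wkⁱ χ → Ψ ⊢ χ

  ≐ᴱ-refl  : ∀ {Ψ : List (Spec Δ Γ)} E → Ψ ⊢ E ≐ᴱ E
  ≐ᴱ-subst : ∀ {Ψ : List (Spec Δ Γ)} {E F} φ → Ψ ⊢ E ≐ᴱ F → Ψ ⊢ φ [ E ]ⁱ → Ψ ⊢ φ [ F ]ⁱ
  ≐ᵀ-refl  : ∀ {Ψ : List (Spec Δ Γ)} (M : Term Δ Γ σ) → Ψ ⊢ M ≐ᵀ M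
  ≐ᵀ-subst : ∀ {Ψ : List (Spec Δ Γ)} {M N : Term Δ Γ σ} φ →
             Ψ ⊢ M ≐ᵀ N → Ψ ⊢ φ [ M ]ˣ → Ψ ⊢ φ [ N ]ˣ

  exists : ∀ {Ψ : List (Spec Δ Γ)} {P M Q} →
    Ψ ⊢ ∀ⁱ (⟪ P ⟫ renᵀ wkⁱ M ⟪ Q ⟫) ⊃ ⟪ ∃ᴬ P ⟫ M ⟪ ∃ᴬ Q ⟫

  disjunction : ∀ {Ψ : List (Spec Δ Γ)} {P P′ M Q Q′} →
    Ψ ⊢ ⟪ P ⟫ M ⟪ Q ⟫ ∧ˢ ⟪ P′ ⟫ M ⟪ Q′ ⟫ ⊃ ⟪ P ∨ᴬ P′ ⟫ M ⟪ Q ∨ᴬ Q′ ⟫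

  conditional : ∀ {Ψ : List (Spec Δ Γ)} {P E F M N Q} →
    Ψ ⊢ ⟪ P ∧ᴬ E ≐ᴬ F ⟫ M ⟪ Q ⟫ ∧ˢ ⟪ P ∧ᴬ E ≢ᴬ F ⟫ N ⟪ Q ⟫ ⊃
        ⟪ P ⟫ if E ≐ F then M else N ⟪ Q ⟫

  sequence : ∀ {Ψ : List (Spec Δ Γ)} {P P₀ Q M N} →
    Ψ ⊢ ⟪ P ⟫ M ⟪ P₀ ⟫ ∧ˢ ⟪ P₀ ⟫ N ⟪ Q ⟫ ⊃ ⟪ P ⟫ M ⨾ N ⟪ Q ⟫

  allocate : ∀ {Ψ : List (Spec Δ Γ)} {P M Q} →
    Ψ ⊢ ∀ⁱ (⟪ wkᴬ P ✶ svar zero ↦ zeroᴱ , zeroᴱ ⟫ M ⟪ wkᴬ Q ⟫) ⊃ ⟪ P ⟫ let-new M ⟪ Q ⟫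

  -- P and E₁ may depend on the bound variable.
  read : ∀ {Ψ : List (Spec Δ Γ)} {P E E₁ M Q} →
    Ψ ⊢ ∀ⁱ (⟪ P ✶ wkᴱ E ↦ svar zero , E₁ ⟫ M ⟪ wkᴬ Q ⟫) ⊃
        ⟪ ∃ᴬ (P ✶ wkᴱ E ↦ svar zero , E₁) ⟫ let-read E 0F M ⟪ Q ⟫

  dispose : ∀ {Ψ : List (Spec Δ Γ)} {E} → Ψ ⊢ ⟪ E ↦– ⟫ free E ⟪ emp ⟫

  write : ∀ {Ψ : List (Spec Δ Γ)} {E E₁ F} → Ψ ⊢ ⟪ E ↦–, E₁ ⟫ assign E 0F F ⟪ E ↦ F , E₁ ⟫

  consequence : ∀ {Ψ : List (Spec Δ Γ)} {P P′ Q Q′ M} →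
    (∀ ρ h → ⟦ P ⟧ᴬ ρ h → ⟦ P′ ⟧ᴬ ρ h) → (∀ ρ h → ⟦ Q′ ⟧ᴬ ρ h → ⟦ Q ⟧ᴬ ρ h) →
    Ψ ⊢ ⟪ P′ ⟫ M ⟪ Q′ ⟫ ⊃ ⟪ P ⟫ M ⟪ Q ⟫

  ⊗-extend : ∀ {Ψ : List (Spec Δ Γ)} {φ P} → Ψ ⊢ φ ⊃ φ ⊗ P
  ⊗-triple : ∀ {Ψ : List (Spec Δ Γ)} {P M P′ Q} →
    Ψ ⊢ (⟪ P ⟫ M ⟪ P′ ⟫ ⊗ Q) ⇔ˢ ⟪ P ✶ Q ⟫ M ⟪ P′ ✶ Q ⟫
  ⊗-≐ᴱ : ∀ {Ψ : List (Spec Δ Γ)} {E F Q} → Ψ ⊢ ((E ≐ᴱ F) ⊗ Q) ⇔ˢ (E ≐ᴱ F)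
  ⊗-≐ᵀ : ∀ {Ψ : List (Spec Δ Γ)} {M N : Term Δ Γ σ} {Q} → Ψ ⊢ ((M ≐ᵀ N) ⊗ Q) ⇔ˢ (M ≐ᵀ N)
  ⊗-⊗  : ∀ {Ψ : List (Spec Δ Γ)} {φ P Q} → Ψ ⊢ (φ ⊗ P ⊗ Q) ⇔ˢ (φ ⊗ (P ✶ Q))
  ⊗-⊃  : ∀ {Ψ : List (Spec Δ Γ)} {φ ψ P} → Ψ ⊢ ((φ ⊃ ψ) ⊗ P) ⇔ˢ (φ ⊗ P ⊃ ψ ⊗ P)
  ⊗-∧  : ∀ {Ψ : List (Spec Δ Γ)} {φ ψ P} → Ψ ⊢ ((φ ∧ˢ ψ) ⊗ P) ⇔ˢ (φ ⊗ P ∧ˢ ψ ⊗ P)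
  ⊗-∨  : ∀ {Ψ : List (Spec Δ Γ)} {φ ψ P} → Ψ ⊢ ((φ ∨ˢ ψ) ⊗ P) ⇔ˢ (φ ⊗ P ∨ˢ ψ ⊗ P)
  ⊗-∀ˣ : ∀ {Ψ : List (Spec Δ Γ)} {φ P} → Ψ ⊢ (∀ˣ τ φ ⊗ P) ⇔ˢ ∀ˣ τ (φ ⊗ P)
  ⊗-∃ˣ : ∀ {Ψ : List (Spec Δ Γ)} {φ P} → Ψ ⊢ (∃ˣ τ φ ⊗ P) ⇔ˢ ∃ˣ τ (φ ⊗ P)
  ⊗-∀ⁱ : ∀ {Ψ : List (Spec Δ Γ)} {φ P} → Ψ ⊢ (∀ⁱ φ ⊗ P) ⇔ˢ ∀ⁱ (φ ⊗ wkᴬ P)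
  ⊗-∃ⁱ : ∀ {Ψ : List (Spec Δ Γ)} {φ P} → Ψ ⊢ (∃ⁱ φ ⊗ P) ⇔ˢ ∃ⁱ (φ ⊗ wkᴬ P)

  fix-induction : ∀ {Ψ : List (Spec Δ Γ)} (γ : HoleSpec σ Δ Γ) (M : Term Δ Γ (σ ⇒ σ)) →
    Ψ ⊢ ∀ˣ σ (renᵞ wkˣ γ ⦅ var (here refl) ⦆ ⊃
              renᵞ wkˣ γ ⦅ renᵀ wkˣ M · var (here refl) ⦆) ⊃
        γ ⦅ fix M ⦆

{-# OPTIONS --safe #-}
module Submission where

-- Relations on heaps form a commutative monoid under ⋆ up to mutual inclusion, with
-- unit eqᴬ emp, and satisfaction is a Kripke semantics over it: it is invariant under
-- mutual inclusion and preserved by r ↦ r ⋆ s, which accounts for intuitionistic logic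
-- and invariant extension.  A semantic triple at r holds iff the obligation for one fixed
-- frame w holds for every w = r ⋆ t, and each triple axiom already holds frame by frame.
-- For fixed-point induction, a term with a hole denotes a strict continuous function of
-- the value in the hole, so the pairs of values satisfying γ contain (⊥, ⊥) and are closed
-- under lubs of pairs of chains; the premise, used at the unit world extension, carries γ
-- along the two Kleene chains of fix M.

open import Axiom.ExcludedMiddle using (ExcludedMiddle)
open import Algebra.Bundles using (CommutativeMonoid)
import Algebra.Properties.CommutativeSemigroup as CommutativeSemigroupₚ
open import Data.Bool using (true; false; if_then_else_)
open import Data.Empty using (⊥-elim)
open import Data.Fin using (Fin; zero; suc)
open import Data.Fin.Patterns using (0F)
open import Data.List using (List; []; _∷_; _++_; map)
open import Data.List.Membership.Propositional using (_∈_; _∉_)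
open import Data.List.Membership.Propositional.Properties using (∈-++⁺ˡ; ∈-++⁺ʳ; ∈-map⁻)
open import Data.List.Relation.Unary.Any using (here; there)
open import Data.Maybe using (just; nothing; maybe′; _<∣>_)
open import Data.Nat using (ℕ; zero; suc)
open import Data.Nat.Properties using (_≟_)
open import Data.Product using (_×_; _,_; proj₁; proj₂)
open import Data.Sum using (_⊎_; inj₁; inj₂) renaming (map to ⊎-map; swap to ⊎-swap)
open import Data.Vec using ([]; _∷_; lookup)
open import Function using (_∘_; _⇔_; mk⇔; Equivalence)
open import Level using (0ℓ; lift)
open import Relation.Binary.PropositionalEquality
  using (_≡_; refl; sym; trans; cong; cong₂; subst; subst₂)
open import Relation.Nullary using (Dec; yes; no; does)
open import Defs

-- Equality in an FM-set is a setoid equality and heaps agree only extensionally, so denotations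
-- cannot simply be rewritten inside a specification. Renaming, substitution and replacement of
-- equals are therefore all phrased as agreement of two phrases over a relation between their
-- environments and worlds. Each constructor gets one congruence lemma over an arbitrary relation;
-- the particular relation matters only at variables and when it is lifted under a binder.
--
-- Two features of the semantics carry the rules for triples. `eqᴬ` is diagonal: the parts of the
-- two heaps described by an assertion agree, so existential witnesses and the values read coincide
-- on both sides, and only the frames and the identifier environments may differ. Results are
-- compared in `eqG`: `err` lies outside `G`, so the axioms that access a cell must exhibit it in
-- both heaps, while `⊥ᴼ` lies inside, so common divergence satisfies every triple. The latter is
-- what starts the fixed-point induction.

private variable
  Δ Δ′ : ℕ
  Γ Γ′ : Ctx
  σ τ : Type

-- Heap splittings

<∣>-comm : ∀ {x y : Cell?} → x ≡ nothing ⊎ y ≡ nothing → (x <∣> y) ≡ (y <∣> x)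
<∣>-comm {nothing} {nothing} _        = refl
<∣>-comm {nothing} {just _}  _        = refl
<∣>-comm {just _}  {nothing} _        = refl
<∣>-comm {just _}  {just _}  (inj₁ ())
<∣>-comm {just _}  {just _}  (inj₂ ())

-- This is `•-assoc` at a single location. If `a` is defined, disjointness makes `b` undefined, so
-- `y` is defined and `c` is undefined; if `a` is undefined, `y` is `b`.
<∣>-assoc : ∀ {x y a b c : Cell?} → y ≡ nothing ⊎ c ≡ nothing → x ≡ (y <∣> c) →
  a ≡ nothing ⊎ b ≡ nothing → y ≡ (a <∣> b) →
  (a ≡ nothing ⊎ (b <∣> c) ≡ nothing) × x ≡ (a <∣> (b <∣> c)) × (b ≡ nothing ⊎ c ≡ nothing)
<∣>-assoc {a = nothing}              y#c         refl _         refl = inj₁ refl , refl , y#c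
<∣>-assoc {a = just _} {b = nothing} (inj₂ refl) refl _         refl = inj₂ refl , refl , inj₁ refl
<∣>-assoc {a = just _} {b = just _}  _           _    (inj₁ ()) _
<∣>-assoc {a = just _} {b = just _}  _           _    (inj₂ ()) _

•-comm : ∀ h a b → h ≐ a • b → h ≐ b • a
•-comm h a b (a#b , eq) = (λ l → ⊎-swap (a#b l)) , λ l → trans (eq l) (<∣>-comm (a#b l))

•-assoc : ∀ h y a b c → h ≐ y • c → y ≐ a • b → (h ≐ a • (b ∪ c)) × ((b ∪ c) ≐ b • c)
•-assoc h y a b c (y#c , h≈) (a#b , y≈) =
  ((λ l → proj₁ (at-loc l)) , λ l → proj₁ (proj₂ (at-loc l))) ,
  (λ l → proj₂ (proj₂ (at-loc l))) , λ _ → refl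
  where at-loc = λ l → <∣>-assoc (y#c l) (h≈ l) (a#b l) (y≈ l)

•-identityʳ : ∀ h → h ≐ h • []ʰ
•-identityʳ h = (λ _ → inj₂ refl) , λ l → <∣>-comm {nothing} (inj₁ refl)

•-unitˡ : ∀ h a b → h ≐ a • b → a ≈ʰ []ʰ → h ≈ʰ b
•-unitˡ h a b (_ , h≈) a≈ l = trans (h≈ l) (cong (_<∣> cells b l) (a≈ l))

•-functional : ∀ h h′ a a′ b b′ → h ≐ a • b → h′ ≐ a′ • b′ → a ≈ʰ a′ → b ≈ʰ b′ → h ≈ʰ h′
•-functional h h′ a a′ b b′ (_ , h≈) (_ , h′≈) a≈ b≈ l =
  trans (h≈ l) (trans (cong₂ _<∣>_ (a≈ l) (b≈ l)) (sym (h′≈ l)))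

•-cells : ∀ h a b {l c} → h ≐ a • b → cells a l ≡ just c → cells h l ≡ just c
•-cells h a b {l} (_ , h≈) eq = trans (h≈ l) (cong (_<∣> cells b l) eq)

cells-update : ∀ l x h → cells (update l x h) l ≡ x
cells-update l x h with l ≟ l
... | yes _  = refl
... | no l≢l = ⊥-elim (l≢l refl)

[↦]-disjoint : ∀ h l c → cells h l ≡ nothing → h # [ l ↦ c ]
[↦]-disjoint h l c l∉h l′ with l′ ≟ l
... | yes refl = inj₁ l∉h
... | no _     = inj₂ refl

-- The new cell joins the footprint `a` and leaves the frame `b` untouched: associativity, applied
-- after exchanging `a` and `b`.
•-extend : ∀ h a b l c → h ≐ a • b → cells h l ≡ nothing →
  ((h ∪ [ l ↦ c ]) ≐ (a ∪ [ l ↦ c ]) • b) × ((a ∪ [ l ↦ c ]) ≐ a • [ l ↦ c ])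
•-extend h a b l c h≐ l∉h with
  •-assoc (h ∪ [ l ↦ c ]) h b a [ l ↦ c ]
    ([↦]-disjoint h l c l∉h , λ _ → refl) (•-comm h a b h≐)
... | s , t = •-comm (h ∪ [ l ↦ c ]) b (a ∪ [ l ↦ c ]) s , t

-- The footprint `p` owns exactly the cell `l`, so disjointness keeps `l` out of the frame `m`.
-- Taking `x` to be `nothing` serves `free`, a defined cell serves assignment.
•-update : ∀ h p m l c x → h ≐ p • m → p ≈ʰ [ l ↦ c ] → update l x h ≐ update l x []ʰ • m
•-update h p m l c x (p#m , h≈) p≈ = disjoint , agree
  where
  l∉m : cells m l ≡ nothing
  l∉m with p#m l
  ... | inj₂ eq = eq
  ... | inj₁ eq with () ← trans (sym eq) (trans (p≈ l) (cells-update l (just c) []ʰ))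
  disjoint : update l x []ʰ # m
  disjoint l′ with l′ ≟ l
  ... | yes refl = inj₂ l∉m
  ... | no _     = inj₁ refl
  agree : update l x h ≈ʰ update l x []ʰ ∪ m
  agree l′ with l′ ≟ l | p≈ l′
  ... | yes refl | _  = trans (<∣>-comm {nothing} (inj₁ refl)) (cong (x <∣>_) (sym l∉m))
  ... | no _     | eq = trans (h≈ l′) (cong (_<∣> cells m l′) eq)

update-nothing-[] : ∀ l → update l nothing []ʰ ≈ʰ []ʰ
update-nothing-[] l l′ with l′ ≟ l
... | yes _ = refl
... | no  _ = refl

-- Relations on heaps

infix 4 _⊆_ _≅_

record _⊆_ (r s : ℛ) : Set where
  constructor inclusion
  field include : ∀ h₀ h₁ → rel r h₀ h₁ → rel s h₀ h₁

open _⊆_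

_≅_ : ℛ → ℛ → Set
r ≅ s = r ⊆ s × s ⊆ r

⊆-refl : ∀ {r} → r ⊆ r
⊆-refl = inclusion λ _ _ p → p

⊆-trans : ∀ {r s t} → r ⊆ s → s ⊆ t → r ⊆ t
⊆-trans p q = inclusion λ h₀ h₁ x → include q h₀ h₁ (include p h₀ h₁ x)

⋆-mono : ∀ {r r′ s s′} → r ⊆ r′ → s ⊆ s′ → (r ⋆ s) ⊆ (r′ ⋆ s′)
⋆-mono p q = inclusion λ h₀ h₁ (n₀ , m₀ , n₁ , m₁ , s₀ , s₁ , x , y) →
  n₀ , m₀ , n₁ , m₁ , s₀ , s₁ , include p n₀ n₁ x , include q m₀ m₁ y

⋆-swap : ∀ r s → (r ⋆ s) ⊆ (s ⋆ r)
⋆-swap r s = inclusion λ h₀ h₁ (n₀ , m₀ , n₁ , m₁ , s₀ , s₁ , x , y) →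
  m₀ , n₀ , m₁ , n₁ , •-comm h₀ n₀ m₀ s₀ , •-comm h₁ n₁ m₁ s₁ , y , x

⋆-reassoc : ∀ r s t → (r ⋆ s ⋆ t) ⊆ (r ⋆ (s ⋆ t))
⋆-reassoc r s t = inclusion
  λ h₀ h₁ (n₀ , c₀ , n₁ , c₁ , s₀ , s₁ , (a₀ , b₀ , a₁ , b₁ , t₀ , t₁ , x , y) , z) →
    let u₀ , v₀ = •-assoc h₀ n₀ a₀ b₀ c₀ s₀ t₀
        u₁ , v₁ = •-assoc h₁ n₁ a₁ b₁ c₁ s₁ t₁
    in a₀ , b₀ ∪ c₀ , a₁ , b₁ ∪ c₁ , u₀ , u₁ , x , (b₀ , c₀ , b₁ , c₁ , v₀ , v₁ , y , z)

⋆-comm : ∀ r s → (r ⋆ s) ≅ (s ⋆ r)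
⋆-comm r s = ⋆-swap r s , ⋆-swap s r

⋆-assoc : ∀ r s t → (r ⋆ s ⋆ t) ≅ (r ⋆ (s ⋆ t))
⋆-assoc r s t = ⋆-reassoc r s t ,
  -- The converse comes from the forward inclusion by rotating the factors: r(st), (st)r, s(tr),
  -- (tr)s, t(rs), (rs)t.
  ⊆-trans (⋆-swap r (s ⋆ t)) (⊆-trans (⋆-reassoc s t r) (⊆-trans (⋆-swap s (t ⋆ r))
    (⊆-trans (⋆-reassoc t r s) (⋆-swap t (r ⋆ s)))))

ε : ℛ
ε = eqᴬ emp []

⋆-identityˡ : ∀ r → (ε ⋆ r) ≅ r
⋆-identityˡ r =
  (inclusion λ h₀ h₁ (n₀ , m₀ , n₁ , m₁ , s₀ , s₁ , (n₀≈n₁ , n₀≈[]) , x) →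
    ℛ.resp r (λ l → sym (•-unitˡ h₀ n₀ m₀ s₀ n₀≈[] l))
      (λ l → sym (•-unitˡ h₁ n₁ m₁ s₁ (λ l → trans (sym (n₀≈n₁ l)) (n₀≈[] l)) l)) x) ,
  inclusion λ h₀ h₁ x → []ʰ , h₀ , []ʰ , h₁ ,
    •-comm h₀ h₀ []ʰ (•-identityʳ h₀) , •-comm h₁ h₁ []ʰ (•-identityʳ h₁) ,
    ((λ _ → refl) , λ _ → refl) , x

⋆-commutativeMonoid : CommutativeMonoid _ _
⋆-commutativeMonoid = record
  { Carrier = ℛ
  ; _≈_     = _≅_
  ; _∙_     = _⋆_
  ; ε       = ε
  ; isCommutativeMonoid = record
    { isMonoid = record
      { isSemigroup = record
        { isMagma = record
          { isEquivalence = record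
            { refl  = ⊆-refl , ⊆-refl
            ; sym   = λ (p , q) → q , p
            ; trans = λ (p , q) (p′ , q′) → ⊆-trans p p′ , ⊆-trans q′ q
            }
          ; ∙-cong = λ (p , q) (p′ , q′) → ⋆-mono p p′ , ⋆-mono q q′
          }
        ; assoc = ⋆-assoc
        }
      ; identity = ⋆-identityˡ ,
          λ r → ⊆-trans (⋆-swap r ε) (proj₁ (⋆-identityˡ r)) ,
                ⊆-trans (proj₂ (⋆-identityˡ r)) (⋆-swap ε r)
      }
    ; comm = ⋆-comm
    }
  }

module ℛₘ = CommutativeMonoid ⋆-commutativeMonoid
open CommutativeSemigroupₚ ℛₘ.commutativeSemigroup using (xy∙z≈xz∙y; xy∙z≈x∙zy; x∙yz≈xz∙y)

-- Renaming and substitution in expressions and assertions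

StackRel : ℕ → ℕ → Set₁
StackRel Δ′ Δ = Stack Δ′ → Stack Δ → Set

_↑ : StackRel Δ′ Δ → StackRel (suc Δ′) (suc Δ)
(S ↑) (v′ ∷ ρ′) (v ∷ ρ) = v′ ≡ v × S ρ′ ρ

record ExpEq (S : StackRel Δ′ Δ) (E′ : Exp Δ′) (E : Exp Δ) : Set where
  constructor exp-eq
  field ⟦⟧-eq : ∀ ρ′ ρ → S ρ′ ρ → ⟦ E′ ⟧ᴱ ρ′ ≡ ⟦ E ⟧ᴱ ρ

-- An equivalence rather than an implication, because `¬ᴬ` reverses the direction in the induction.
record AssnEq (S : StackRel Δ′ Δ) (P′ : Assn Δ′) (P : Assn Δ) : Set where
  constructor assn-eq
  field ⟦⟧-⇔ : ∀ ρ′ ρ → S ρ′ ρ → ∀ h → ⟦ P′ ⟧ᴬ ρ′ h ⇔ ⟦ P ⟧ᴬ ρ h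

  fwd : ∀ ρ′ ρ → S ρ′ ρ → ∀ h → ⟦ P′ ⟧ᴬ ρ′ h → ⟦ P ⟧ᴬ ρ h
  fwd ρ′ ρ s h = Equivalence.to (⟦⟧-⇔ ρ′ ρ s h)

  bwd : ∀ ρ′ ρ → S ρ′ ρ → ∀ h → ⟦ P ⟧ᴬ ρ h → ⟦ P′ ⟧ᴬ ρ′ h
  bwd ρ′ ρ s h = Equivalence.from (⟦⟧-⇔ ρ′ ρ s h)

open ExpEq
open AssnEq

eqᴬ-cong : ∀ {S : StackRel Δ′ Δ} {P′ P} → AssnEq S P′ P → ∀ ρ′ ρ → S ρ′ ρ → eqᴬ P′ ρ′ ≅ eqᴬ P ρ
eqᴬ-cong e ρ′ ρ s =
  inclusion (λ h₀ h₁ (h₀≈h₁ , p) → h₀≈h₁ , fwd e ρ′ ρ s h₀ p) ,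
  inclusion (λ h₀ h₁ (h₀≈h₁ , p) → h₀≈h₁ , bwd e ρ′ ρ s h₀ p)

module _ {S : StackRel Δ′ Δ} where

  ⊕-cong : ∀ {E′ F′ E F} → ExpEq S E′ E → ExpEq S F′ F → ExpEq S (E′ ⊕ F′) (E ⊕ F)
  ⊕-cong e f = exp-eq λ ρ′ ρ s → cong₂ addᵛ (⟦⟧-eq e ρ′ ρ s) (⟦⟧-eq f ρ′ ρ s)

  ⊖-cong : ∀ {E′ F′ E F} → ExpEq S E′ E → ExpEq S F′ F → ExpEq S (E′ ⊖ F′) (E ⊖ F)
  ⊖-cong e f = exp-eq λ ρ′ ρ s → cong₂ subᵛ (⟦⟧-eq e ρ′ ρ s) (⟦⟧-eq f ρ′ ρ s)

  ≐ᴬ-cong : ∀ {E′ F′ E F} → ExpEq S E′ E → ExpEq S F′ F → AssnEq S (E′ ≐ᴬ F′) (E ≐ᴬ F)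
  ≐ᴬ-cong e f = assn-eq λ ρ′ ρ s h → mk⇔
    (subst₂ _≡_ (⟦⟧-eq e ρ′ ρ s) (⟦⟧-eq f ρ′ ρ s))
    (subst₂ _≡_ (sym (⟦⟧-eq e ρ′ ρ s)) (sym (⟦⟧-eq f ρ′ ρ s)))

  ≤ᴬ-cong : ∀ {E′ F′ E F} → ExpEq S E′ E → ExpEq S F′ F → AssnEq S (E′ ≤ᴬ F′) (E ≤ᴬ F)
  ≤ᴬ-cong e f = assn-eq λ ρ′ ρ s h → mk⇔
    (subst₂ _≤ᵛ_ (⟦⟧-eq e ρ′ ρ s) (⟦⟧-eq f ρ′ ρ s))
    (subst₂ _≤ᵛ_ (sym (⟦⟧-eq e ρ′ ρ s)) (sym (⟦⟧-eq f ρ′ ρ s)))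

  ↦-cong : ∀ {E′ F′ G′ E F G} → ExpEq S E′ E → ExpEq S F′ F → ExpEq S G′ G →
    AssnEq S (E′ ↦ F′ , G′) (E ↦ F , G)
  ↦-cong {E′} {F′} {G′} {E} {F} {G} e f g = assn-eq λ ρ′ ρ s h → mk⇔
    (λ (l , p , q) → l , trans (sym (⟦⟧-eq e ρ′ ρ s)) p ,
      subst (λ c → h ≈ʰ [ l ↦ c ]) (cong₂ _,_ (⟦⟧-eq f ρ′ ρ s) (⟦⟧-eq g ρ′ ρ s)) q)
    (λ (l , p , q) → l , trans (⟦⟧-eq e ρ′ ρ s) p ,
      subst (λ c → h ≈ʰ [ l ↦ c ]) (sym (cong₂ _,_ (⟦⟧-eq f ρ′ ρ s) (⟦⟧-eq g ρ′ ρ s))) q)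

  emp-cong : AssnEq S emp emp
  emp-cong = assn-eq λ _ _ _ _ → mk⇔ (λ p → p) (λ p → p)

  ✶-cong : ∀ {P′ Q′ P Q} → AssnEq S P′ P → AssnEq S Q′ Q → AssnEq S (P′ ✶ Q′) (P ✶ Q)
  ✶-cong e f = assn-eq λ ρ′ ρ s h → mk⇔
    (λ (h₁ , h₂ , h≐ , p , q) → h₁ , h₂ , h≐ , fwd e ρ′ ρ s h₁ p , fwd f ρ′ ρ s h₂ q)
    (λ (h₁ , h₂ , h≐ , p , q) → h₁ , h₂ , h≐ , bwd e ρ′ ρ s h₁ p , bwd f ρ′ ρ s h₂ q)

  ∧ᴬ-cong : ∀ {P′ Q′ P Q} → AssnEq S P′ P → AssnEq S Q′ Q → AssnEq S (P′ ∧ᴬ Q′) (P ∧ᴬ Q)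
  ∧ᴬ-cong e f = assn-eq λ ρ′ ρ s h → mk⇔
    (λ (p , q) → fwd e ρ′ ρ s h p , fwd f ρ′ ρ s h q)
    (λ (p , q) → bwd e ρ′ ρ s h p , bwd f ρ′ ρ s h q)

  ¬ᴬ-cong : ∀ {P′ P} → AssnEq S P′ P → AssnEq S (¬ᴬ P′) (¬ᴬ P)
  ¬ᴬ-cong e = assn-eq λ ρ′ ρ s h → mk⇔
    (λ ¬p p → ¬p (bwd e ρ′ ρ s h p)) (λ ¬p p → ¬p (fwd e ρ′ ρ s h p))

  ∃ᴬ-cong : ∀ {P′ P} → AssnEq (S ↑) P′ P → AssnEq S (∃ᴬ P′) (∃ᴬ P)
  ∃ᴬ-cong e = assn-eq λ ρ′ ρ s h → mk⇔
    (λ (v , p) → v , fwd e (v ∷ ρ′) (v ∷ ρ) (refl , s) h p)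
    (λ (v , p) → v , bwd e (v ∷ ρ′) (v ∷ ρ) (refl , s) h p)

-- Mediates at binders: `∃ᴬ-cong` asks for agreement over `S ↑`, whereas the induction hypothesis
-- speaks about the lifted renaming or substitution.
AssnEq-narrow : ∀ {S T : StackRel Δ′ Δ} {P′ P} → (∀ ρ′ ρ → T ρ′ ρ → S ρ′ ρ) →
  AssnEq S P′ P → AssnEq T P′ P
AssnEq-narrow T⊆S e = assn-eq λ ρ′ ρ t → ⟦⟧-⇔ e ρ′ ρ (T⊆S ρ′ ρ t)

-- A renaming or substitution syntax ↦ syntax′ induces the relation between stacks of the
-- target context and stacks of the source context under which the two denotations agree.
RenStack : (Fin Δ → Fin Δ′) → StackRel Δ′ Δ
RenStack f ρ′ ρ = ∀ i → lookup ρ′ (f i) ≡ lookup ρ i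

SubStack : (Fin Δ → Exp Δ′) → StackRel Δ′ Δ
SubStack s ρ′ ρ = ∀ i → ⟦ s i ⟧ᴱ ρ′ ≡ lookup ρ i

renᴱ-eq : (f : Fin Δ → Fin Δ′) (E : Exp Δ) → ExpEq (RenStack f) (renᴱ f E) E
renᴱ-eq f (svar i)   = exp-eq λ _ _ s → s i
renᴱ-eq f zeroᴱ      = exp-eq λ _ _ _ → refl
renᴱ-eq f oneᴱ       = exp-eq λ _ _ _ → refl
renᴱ-eq f minus-oneᴱ = exp-eq λ _ _ _ → refl
renᴱ-eq f (E ⊕ F)    = ⊕-cong (renᴱ-eq f E) (renᴱ-eq f F)
renᴱ-eq f (E ⊖ F)    = ⊖-cong (renᴱ-eq f E) (renᴱ-eq f F)

subᴱ-eq : (s : Fin Δ → Exp Δ′) (E : Exp Δ) → ExpEq (SubStack s) (subᴱ s E) E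
subᴱ-eq s (svar i)   = exp-eq λ _ _ t → t i
subᴱ-eq s zeroᴱ      = exp-eq λ _ _ _ → refl
subᴱ-eq s oneᴱ       = exp-eq λ _ _ _ → refl
subᴱ-eq s minus-oneᴱ = exp-eq λ _ _ _ → refl
subᴱ-eq s (E ⊕ F)    = ⊕-cong (subᴱ-eq s E) (subᴱ-eq s F)
subᴱ-eq s (E ⊖ F)    = ⊖-cong (subᴱ-eq s E) (subᴱ-eq s F)

RenStack-↑ : ∀ (f : Fin Δ → Fin Δ′) ρ′ ρ → (RenStack f ↑) ρ′ ρ → RenStack (lift-fin f) ρ′ ρ
RenStack-↑ f (_ ∷ _) (_ ∷ _) (v≡ , s) zero    = v≡
RenStack-↑ f (_ ∷ _) (_ ∷ _) (v≡ , s) (suc i) = s i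

SubStack-↑ : ∀ (s : Fin Δ → Exp Δ′) ρ′ ρ → (SubStack s ↑) ρ′ ρ → SubStack (lift-exp s) ρ′ ρ
SubStack-↑ s (_ ∷ _)  (_ ∷ _) (v≡ , t) zero    = v≡
SubStack-↑ s (v ∷ ρ′) (_ ∷ _) (v≡ , t) (suc i) =
  -- Lifting weakens the substituted expression, so substitution rests on the result for renaming.
  trans (⟦⟧-eq (renᴱ-eq suc (s i)) (v ∷ ρ′) ρ′ λ _ → refl) (t i)

renᴬ-eq : (f : Fin Δ → Fin Δ′) (P : Assn Δ) → AssnEq (RenStack f) (renᴬ f P) P
renᴬ-eq f (E ≐ᴬ F)    = ≐ᴬ-cong (renᴱ-eq f E) (renᴱ-eq f F)
renᴬ-eq f (E ≤ᴬ F)    = ≤ᴬ-cong (renᴱ-eq f E) (renᴱ-eq f F)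
renᴬ-eq f (E ↦ F , G) = ↦-cong (renᴱ-eq f E) (renᴱ-eq f F) (renᴱ-eq f G)
renᴬ-eq f emp         = emp-cong
renᴬ-eq f (P ✶ Q)     = ✶-cong (renᴬ-eq f P) (renᴬ-eq f Q)
renᴬ-eq f (P ∧ᴬ Q)    = ∧ᴬ-cong (renᴬ-eq f P) (renᴬ-eq f Q)
renᴬ-eq f (¬ᴬ P)      = ¬ᴬ-cong (renᴬ-eq f P)
renᴬ-eq f (∃ᴬ P)      = ∃ᴬ-cong (AssnEq-narrow (RenStack-↑ f) (renᴬ-eq (lift-fin f) P))

subᴬ-eq : (s : Fin Δ → Exp Δ′) (P : Assn Δ) → AssnEq (SubStack s) (subᴬ s P) P
subᴬ-eq s (E ≐ᴬ F)    = ≐ᴬ-cong (subᴱ-eq s E) (subᴱ-eq s F)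
subᴬ-eq s (E ≤ᴬ F)    = ≤ᴬ-cong (subᴱ-eq s E) (subᴱ-eq s F)
subᴬ-eq s (E ↦ F , G) = ↦-cong (subᴱ-eq s E) (subᴱ-eq s F) (subᴱ-eq s G)
subᴬ-eq s emp         = emp-cong
subᴬ-eq s (P ✶ Q)     = ✶-cong (subᴬ-eq s P) (subᴬ-eq s Q)
subᴬ-eq s (P ∧ᴬ Q)    = ∧ᴬ-cong (subᴬ-eq s P) (subᴬ-eq s Q)
subᴬ-eq s (¬ᴬ P)      = ¬ᴬ-cong (subᴬ-eq s P)
subᴬ-eq s (∃ᴬ P)      = ∃ᴬ-cong (AssnEq-narrow (SubStack-↑ s) (subᴬ-eq (lift-exp s) P))

≡-stackᴱ-eq : (E : Exp Δ) → ExpEq _≡_ E E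
≡-stackᴱ-eq E = exp-eq λ { _ _ refl → refl }

≡-stackᴬ-eq : (P : Assn Δ) → AssnEq _≡_ P P
≡-stackᴬ-eq P = assn-eq λ { _ _ refl h → mk⇔ (λ p → p) (λ p → p) }

wkᴱ-eq : ∀ (E : Exp Δ) v ρ → ⟦ wkᴱ E ⟧ᴱ (v ∷ ρ) ≡ ⟦ E ⟧ᴱ ρ
wkᴱ-eq E v ρ = ⟦⟧-eq (renᴱ-eq suc E) (v ∷ ρ) ρ λ _ → refl

wkᴬ-⇔ : ∀ (P : Assn Δ) v ρ h → ⟦ wkᴬ P ⟧ᴬ (v ∷ ρ) h ⇔ ⟦ P ⟧ᴬ ρ h
wkᴬ-⇔ P v ρ = ⟦⟧-⇔ (renᴬ-eq suc P) (v ∷ ρ) ρ λ _ → refl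

eqᴬ-wk : ∀ (P : Assn Δ) v ρ → eqᴬ (wkᴬ P) (v ∷ ρ) ≅ eqᴬ P ρ
eqᴬ-wk P v ρ = eqᴬ-cong (renᴬ-eq suc P) (v ∷ ρ) ρ λ _ → refl

eqᴬ-mono : ∀ (P Q : Assn Δ) ρ → (∀ h → ⟦ P ⟧ᴬ ρ h → ⟦ Q ⟧ᴬ ρ h) → eqᴬ P ρ ⊆ eqᴬ Q ρ
eqᴬ-mono P Q ρ P⊆Q = inclusion λ h₀ h₁ (h₀≈h₁ , p) → h₀≈h₁ , P⊆Q h₀ p

-- On the right the two heaps are split independently, but corresponding parts are equal, and the
-- graph of • is functional. On the left one splitting is used for both heaps.
eqᴬ-✶ : ∀ (P Q : Assn Δ) ρ → eqᴬ (P ✶ Q) ρ ≅ (eqᴬ P ρ ⋆ eqᴬ Q ρ)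
eqᴬ-✶ P Q ρ =
  (inclusion λ h₀ h₁ (h₀≈h₁ , a , b , (a#b , h₀≈) , p , q) →
    a , b , a , b , (a#b , h₀≈) , (a#b , λ l → trans (sym (h₀≈h₁ l)) (h₀≈ l)) ,
    ((λ _ → refl) , p) , (λ _ → refl) , q) ,
  inclusion λ h₀ h₁ (a₀ , b₀ , a₁ , b₁ , s₀ , s₁ , (a≈ , p) , (b≈ , q)) →
    •-functional h₀ h₁ a₀ a₁ b₀ b₁ s₀ s₁ a≈ b≈ , a₀ , b₀ , s₀ , p , q

module Soundness (em : ExcludedMiddle 0ℓ) where
  open Semantics em

  private module Dom (τ : Type) = FMCpo ⟦ τ ⟧

  _⊢_≈_ : ∀ τ → ∣ ⟦ τ ⟧ ∣ → ∣ ⟦ τ ⟧ ∣ → Set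
  τ ⊢ d ≈ e = Dom._≈_ τ d e

  Env : Ctx → Set
  Env Γ = ∣ ⟦ Γ ⟧ᶜ ∣

  -- Renaming and substitution in terms

  record EnvRel (Δ′ : ℕ) (Γ′ : Ctx) (Δ : ℕ) (Γ : Ctx) : Set₁ where
    field
      stacks : StackRel Δ′ Δ
      -- The target stack is needed because a substituted term may mention stack variables.
      ids    : Stack Δ′ → Env Γ′ → Env Γ → Set

  open EnvRel

  _↑ⁱ : EnvRel Δ′ Γ′ Δ Γ → EnvRel (suc Δ′) Γ′ (suc Δ) Γ
  (R ↑ⁱ) .stacks          = stacks R ↑
  (R ↑ⁱ) .ids (v ∷ ρ) η′ η = ids R ρ η′ η

  _↑ˣ : EnvRel Δ′ Γ′ Δ Γ → EnvRel Δ′ (τ ∷ Γ′) Δ (τ ∷ Γ)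
  (R ↑ˣ) .stacks = stacks R
  _↑ˣ {τ = τ} R .ids ρ (m′ , η′) (m , η) = τ ⊢ m′ ≈ m × ids R ρ η′ η

  infix 4 _⊆ᴱ_

  record _⊆ᴱ_ (R T : EnvRel Δ′ Γ′ Δ Γ) : Set where
    constructor _and_
    field
      stacks⊆ : ∀ ρ′ ρ → stacks R ρ′ ρ → stacks T ρ′ ρ
      ids⊆    : ∀ ρ′ η′ η → ids R ρ′ η′ η → ids T ρ′ η′ η

  open _⊆ᴱ_

  record TermEq (R : EnvRel Δ′ Γ′ Δ Γ) (M′ : Term Δ′ Γ′ τ) (M : Term Δ Γ τ) : Set where
    constructor term-eq
    field
      ⟦⟧-≈ : ∀ ρ′ ρ η′ η → stacks R ρ′ ρ → ids R ρ′ η′ η →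
             τ ⊢ app ⟦ M′ ⟧ᵀ (ρ′ , η′) ≈ app ⟦ M ⟧ᵀ (ρ , η)

  open TermEq

  TermEq-narrow : ∀ {R T : EnvRel Δ′ Γ′ Δ Γ} {M′ : Term Δ′ Γ′ τ} {M} →
    R ⊆ᴱ T → TermEq T M′ M → TermEq R M′ M
  TermEq-narrow R⊆T e = term-eq λ ρ′ ρ η′ η s t →
    ⟦⟧-≈ e ρ′ ρ η′ η (stacks⊆ R⊆T ρ′ ρ s) (ids⊆ R⊆T ρ′ η′ η t)

  -- The continuation `λ h′. ⟦N⟧(h′, k)` exactly as it occurs inside `⟦ M ⨾ N ⟧ᵀ`, named so that it
  -- can be passed to `M` as an element of `Contᴰ`.
  seqCont : Term Δ Γ com → Hom (State (Ctxᴰ Δ Γ)) Contᴰ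
  seqCont N = curry (eval ∘ᴴ ⟨ ⟦ N ⟧ᵀ ∘ᴴ ctx ∘ᴴ π₁ , ⟨ π₂ , cont ∘ᴴ π₁ ⟩ ⟩)

  seqCont-eq : ∀ (M N : Term Δ Γ com) ρ η h k →
    run (M ⨾ N) ρ η h k ≡ run M ρ η h (app (seqCont N) ((ρ , η) , h , k))
  seqCont-eq M N ρ η h k = seq-eq ρ η h k M N {app (seqCont N) ((ρ , η) , h , k)} λ _ → refl

  TermEq-run : ∀ {R : EnvRel Δ′ Γ′ Δ Γ} {M′ M} → TermEq R M′ M → ∀ ρ′ ρ η′ η →
    stacks R ρ′ ρ → ids R ρ′ η′ η → ∀ h k → run M′ ρ′ η′ h k ≡ run M ρ η h k
  TermEq-run e ρ′ ρ η′ η s t h k = ⟦⟧-≈ e ρ′ ρ η′ η s t (h , k)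

  module _ {R : EnvRel Δ′ Γ′ Δ Γ} where

    lamᵥ-cong : ∀ {M′ : Term _ Γ′ τ} {M} → TermEq (R ↑ⁱ) M′ M → TermEq R (lamᵥ M′) (lamᵥ M)
    lamᵥ-cong e = term-eq λ ρ′ ρ η′ η s t v → ⟦⟧-≈ e (v ∷ ρ′) (v ∷ ρ) η′ η (refl , s) t

    ·ᵥ-cong : ∀ {M′ : Term _ Γ′ (val⇒ τ)} {M E′ E} → TermEq R M′ M → ExpEq (stacks R) E′ E →
      TermEq R (M′ ·ᵥ E′) (M ·ᵥ E)
    ·ᵥ-cong {τ = τ} {M′} {M} {E′} {E} e f = term-eq λ ρ′ ρ η′ η s t →
      Dom.≈-trans τ (⟦⟧-≈ e ρ′ ρ η′ η s t (⟦ E′ ⟧ᴱ ρ′))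
        (Fun.cong-fun (app ⟦ M ⟧ᵀ (ρ , η)) (⟦⟧-eq f ρ′ ρ s))

    lam-cong : ∀ {M′ : Term _ (σ ∷ Γ′) τ} {M} → TermEq (R ↑ˣ) M′ M → TermEq R (lam M′) (lam M)
    lam-cong {σ = σ} e = term-eq λ ρ′ ρ η′ η s t m →
      ⟦⟧-≈ e ρ′ ρ (m , η′) (m , η) s (Dom.≈-refl σ , t)

    ·-cong : ∀ {M′ : Term _ Γ′ (σ ⇒ τ)} {M N′ N} → TermEq R M′ M → TermEq R N′ N →
      TermEq R (M′ · N′) (M · N)
    ·-cong {τ = τ} {M′} {M} {N′} e f = term-eq λ ρ′ ρ η′ η s t →
      Dom.≈-trans τ (⟦⟧-≈ e ρ′ ρ η′ η s t (app ⟦ N′ ⟧ᵀ (ρ′ , η′)))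
        (Fun.cong-fun (app ⟦ M ⟧ᵀ (ρ , η)) (⟦⟧-≈ f ρ′ ρ η′ η s t))

    fix-cong : ∀ {M′ : Term _ Γ′ (τ ⇒ τ)} {M} → TermEq R M′ M → TermEq R (fix M′) (fix M)
    fix-cong {τ = τ} {M′} {M} e = term-eq λ ρ′ ρ η′ η s t →
      Hom.cong-app (fixᴴ ⟦ τ ⟧ (pointed τ)) {app ⟦ M′ ⟧ᵀ (ρ′ , η′)} {app ⟦ M ⟧ᵀ (ρ , η)}
        (⟦⟧-≈ e ρ′ ρ η′ η s t)

    if-cong : ∀ {E′ F′ E F M′ N′ M N} → ExpEq (stacks R) E′ E → ExpEq (stacks R) F′ F →
      TermEq R M′ M → TermEq R N′ N →
      TermEq R (if E′ ≐ F′ then M′ else N′) (if E ≐ F then M else N)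
    if-cong {E = E} {F} {M′} {N′} {M} {N} e f m n = term-eq λ ρ′ ρ η′ η s t a →
      trans (cong₂ (λ v w → fun (app (ifᴴ ⟦ M′ ⟧ᵀ ⟦ N′ ⟧ᵀ) (app eqᴴ (v , w) , ρ′ , η′)) a)
                   (⟦⟧-eq e ρ′ ρ s) (⟦⟧-eq f ρ′ ρ s))
            (branch ρ′ ρ η′ η s t (app eqᴴ (⟦ E ⟧ᴱ ρ , ⟦ F ⟧ᴱ ρ)) a)
      where
      branch : ∀ ρ′ ρ η′ η → stacks R ρ′ ρ → ids R ρ′ η′ η → ∀ b a →
        fun (app (ifᴴ ⟦ M′ ⟧ᵀ ⟦ N′ ⟧ᵀ) (b , ρ′ , η′)) a ≡
        fun (app (ifᴴ ⟦ M ⟧ᵀ ⟦ N ⟧ᵀ) (b , ρ , η)) a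
      branch ρ′ ρ η′ η s t true  a = ⟦⟧-≈ m ρ′ ρ η′ η s t a
      branch ρ′ ρ η′ η s t false a = ⟦⟧-≈ n ρ′ ρ η′ η s t a

    ⨾-cong : ∀ {M′ N′ M N} → TermEq R M′ M → TermEq R N′ N → TermEq R (M′ ⨾ N′) (M ⨾ N)
    ⨾-cong {M′} {N′} {M} {N} m n = term-eq go
      where
      go : ∀ ρ′ ρ η′ η → stacks R ρ′ ρ → ids R ρ′ η′ η →
        com ⊢ app ⟦ M′ ⨾ N′ ⟧ᵀ (ρ′ , η′) ≈ app ⟦ M ⨾ N ⟧ᵀ (ρ , η)
      go ρ′ ρ η′ η s t (h , k) =
        trans (seqCont-eq M′ N′ ρ′ η′ h k)
          (trans (TermEq-run m ρ′ ρ η′ η s t h k′)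
            -- `seq-eq` accepts any continuation that agrees pointwise with running `N`, so the one
            -- built from `N′` can be kept on both sides.
            (sym (seq-eq ρ η h k M N {k′} λ h′ → TermEq-run n ρ′ ρ η′ η s t h′ k)))
        where k′ = app (seqCont N′) ((ρ′ , η′) , h , k)

    -- The two sides choose their fresh locations from different supports. The result does not
    -- depend on the choice, so both are moved to one location fresh for both states.
    let-new-cong : ∀ {M′ M} → TermEq (R ↑ⁱ) M′ M → TermEq R (let-new M′) (let-new M)
    let-new-cong {M′} {M} e = term-eq λ ρ′ ρ η′ η s t (h , k) →
      let X′ = State (Ctxᴰ Δ′ Γ′)
          X  = State (Ctxᴰ Δ Γ)
          L′ = FMCpo.supp X′ ((ρ′ , η′) , h , k)
          L  = FMCpo.supp X ((ρ , η) , h , k)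
          l  = fresh (L′ ++ L)
      in trans (let-new-eq ρ′ η′ h k M′ {l} {L′} (FMCpo.supp-supports X′ ((ρ′ , η′) , h , k))
                 (fresh-∉ (L′ ++ L) ∘ ∈-++⁺ˡ))
        (trans (⟦⟧-≈ e (loc l ∷ ρ′) (loc l ∷ ρ) η′ η (refl , s) t _)
          (sym (let-new-eq ρ η h k M {l} {L} (FMCpo.supp-supports X ((ρ , η) , h , k))
                 (fresh-∉ (L′ ++ L) ∘ ∈-++⁺ʳ L′))))

    free-cong : ∀ {E′ E} → ExpEq (stacks R) E′ E → TermEq R (free E′) (free E)
    free-cong {E′} {E} e = term-eq λ ρ′ ρ η′ η s t (h , k) →
      trans (free-eq {Γ = Γ′} ρ′ η′ h k E′)
        (trans (cong (λ v → maybe′ (λ _ → fun k (updateAt v nothing h)) err (cellAt h v))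
                 (⟦⟧-eq e ρ′ ρ s))
          (sym (free-eq {Γ = Γ} ρ η h k E)))

    let-read-cong : ∀ {E′ E f M′ M} → ExpEq (stacks R) E′ E → TermEq (R ↑ⁱ) M′ M →
      TermEq R (let-read E′ f M′) (let-read E f M)
    let-read-cong {E′} {E} {f} {M′} {M} e m = term-eq λ ρ′ ρ η′ η s t (h , k) →
      trans (let-read-eq ρ′ η′ h k E′ f M′)
        (trans (cong (λ v → maybe′ (λ c → run M′ (component f c ∷ ρ′) η′ h k) err (cellAt h v))
                 (⟦⟧-eq e ρ′ ρ s))
          (trans (body ρ′ ρ η′ η h k s t (cellAt h (⟦ E ⟧ᴱ ρ)))
            (sym (let-read-eq ρ η h k E f M))))
      where
      body : ∀ ρ′ ρ η′ η h k → stacks R ρ′ ρ → ids R ρ′ η′ η → ∀ x →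
        maybe′ (λ c → run M′ (component f c ∷ ρ′) η′ h k) err x ≡
        maybe′ (λ c → run M (component f c ∷ ρ) η h k) err x
      body ρ′ ρ η′ η h k s t nothing  = refl
      body ρ′ ρ η′ η h k s t (just c) =
        ⟦⟧-≈ m (component f c ∷ ρ′) (component f c ∷ ρ) η′ η (refl , s) t (h , k)

    assign-cong : ∀ {E′ F′ E F f} → ExpEq (stacks R) E′ E → ExpEq (stacks R) F′ F →
      TermEq R (assign E′ f F′) (assign E f F)
    assign-cong {E′} {F′} {E} {F} {f} e e′ = term-eq λ ρ′ ρ η′ η s t (h , k) →
      trans (assign-eq {Γ = Γ′} ρ′ η′ h k E′ f F′)
        (trans (cong₂ (λ v w → maybe′ (λ c → fun k (updateAt v (just (setComponent f w c)) h))
                                      err (cellAt h v))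
                 (⟦⟧-eq e ρ′ ρ s) (⟦⟧-eq e′ ρ′ ρ s))
          (sym (assign-eq {Γ = Γ} ρ η h k E f F)))

  renRel : Ren Δ Γ Δ′ Γ′ → EnvRel Δ′ Γ′ Δ Γ
  renRel f .stacks       = RenStack (onStack f)
  renRel f .ids ρ′ η′ η = ∀ {τ} (x : τ ∈ _) → τ ⊢ app (varᴴ (onId f x)) η′ ≈ app (varᴴ x) η

  subRel : Sub Δ Γ Δ′ Γ′ → EnvRel Δ′ Γ′ Δ Γ
  subRel s .stacks       = SubStack (forStack s)
  subRel s .ids ρ′ η′ η = ∀ {τ} (x : τ ∈ _) → τ ⊢ app ⟦ forId s x ⟧ᵀ (ρ′ , η′) ≈ app (varᴴ x) η

  ≈Rel : ∀ Δ Γ → EnvRel Δ Γ Δ Γ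
  ≈Rel Δ Γ .stacks      = _≡_
  ≈Rel Δ Γ .ids _ η′ η = FMCpo._≈_ ⟦ Γ ⟧ᶜ η′ η

  renRel-↑ⁱ : (f : Ren Δ Γ Δ′ Γ′) → renRel f ↑ⁱ ⊆ᴱ renRel (liftⁱ f)
  renRel-↑ⁱ f = RenStack-↑ (onStack f) and λ { (_ ∷ _) η′ η t → t }

  renRel-↑ˣ : (f : Ren Δ Γ Δ′ Γ′) → (renRel f ↑ˣ) ⊆ᴱ renRel (liftˣ {σ = σ} f)
  renRel-↑ˣ f = (λ _ _ s → s) and
    λ { ρ (_ , _) (_ , _) (m≈ , t) (here refl) → m≈
      ; ρ (_ , _) (_ , _) (m≈ , t) (there x)   → t x }

  renᵀ-eq : (f : Ren Δ Γ Δ′ Γ′) (M : Term Δ Γ τ) → TermEq (renRel f) (renᵀ f M) M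
  renᵀ-eq f (var x)     = term-eq λ _ _ _ _ _ t → t x
  renᵀ-eq f (lamᵥ M)    = lamᵥ-cong (TermEq-narrow (renRel-↑ⁱ f) (renᵀ-eq (liftⁱ f) M))
  renᵀ-eq f (M ·ᵥ E)    = ·ᵥ-cong (renᵀ-eq f M) (renᴱ-eq (onStack f) E)
  renᵀ-eq f (lam M)     = lam-cong (TermEq-narrow (renRel-↑ˣ f) (renᵀ-eq (liftˣ f) M))
  renᵀ-eq f (M · N)     = ·-cong (renᵀ-eq f M) (renᵀ-eq f N)
  renᵀ-eq f (fix M)     = fix-cong (renᵀ-eq f M)
  renᵀ-eq f (if E ≐ F then M else N) =
    if-cong (renᴱ-eq (onStack f) E) (renᴱ-eq (onStack f) F) (renᵀ-eq f M) (renᵀ-eq f N)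
  renᵀ-eq f (M ⨾ N)     = ⨾-cong (renᵀ-eq f M) (renᵀ-eq f N)
  renᵀ-eq f (let-new M) = let-new-cong (TermEq-narrow (renRel-↑ⁱ f) (renᵀ-eq (liftⁱ f) M))
  renᵀ-eq f (free E)    = free-cong (renᴱ-eq (onStack f) E)
  renᵀ-eq f (let-read E _ M) = let-read-cong (renᴱ-eq (onStack f) E)
    (TermEq-narrow (renRel-↑ⁱ f) (renᵀ-eq (liftⁱ f) M))
  renᵀ-eq f (assign E _ F)   = assign-cong (renᴱ-eq (onStack f) E) (renᴱ-eq (onStack f) F)

  wkⁱ-eq : ∀ (M : Term Δ Γ τ) v ρ η →
    τ ⊢ app ⟦ renᵀ wkⁱ M ⟧ᵀ (v ∷ ρ , η) ≈ app ⟦ M ⟧ᵀ (ρ , η)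
  wkⁱ-eq M v ρ η = ⟦⟧-≈ (renᵀ-eq wkⁱ M) (v ∷ ρ) ρ η η (λ _ → refl) λ {τ} _ → Dom.≈-refl τ

  wkˣ-eq : ∀ (M : Term Δ Γ τ) ρ (m : ∣ ⟦ σ ⟧ ∣) η →
    τ ⊢ app ⟦ renᵀ (wkˣ {σ = σ}) M ⟧ᵀ (ρ , m , η) ≈ app ⟦ M ⟧ᵀ (ρ , η)
  wkˣ-eq M ρ m η = ⟦⟧-≈ (renᵀ-eq wkˣ M) ρ ρ (m , η) η (λ _ → refl) λ {τ} _ → Dom.≈-refl τ

  subRel-↑ⁱ : (s : Sub Δ Γ Δ′ Γ′) → subRel s ↑ⁱ ⊆ᴱ subRel (liftSubⁱ s)
  subRel-↑ⁱ s = SubStack-↑ (forStack s) and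
    λ { (v ∷ ρ) η′ η t {τ} x → Dom.≈-trans τ (wkⁱ-eq (forId s x) v ρ η′) (t x) }

  subRel-↑ˣ : (s : Sub Δ Γ Δ′ Γ′) → (subRel s ↑ˣ) ⊆ᴱ subRel (liftSubˣ {σ = σ} s)
  subRel-↑ˣ s = (λ _ _ t → t) and
    λ { ρ (_ , _)  (_ , _) (m≈ , t)     (here refl) → m≈
      ; ρ (m , η′) (_ , _) (m≈ , t) {τ} (there x)   →
          Dom.≈-trans τ (wkˣ-eq (forId s x) ρ m η′) (t x) }

  subᵀ-eq : (s : Sub Δ Γ Δ′ Γ′) (M : Term Δ Γ τ) → TermEq (subRel s) (subᵀ s M) M
  subᵀ-eq s (var x)     = term-eq λ _ _ _ _ _ t → t x
  subᵀ-eq s (lamᵥ M)    = lamᵥ-cong (TermEq-narrow (subRel-↑ⁱ s) (subᵀ-eq (liftSubⁱ s) M))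
  subᵀ-eq s (M ·ᵥ E)    = ·ᵥ-cong (subᵀ-eq s M) (subᴱ-eq (forStack s) E)
  subᵀ-eq s (lam M)     = lam-cong (TermEq-narrow (subRel-↑ˣ s) (subᵀ-eq (liftSubˣ s) M))
  subᵀ-eq s (M · N)     = ·-cong (subᵀ-eq s M) (subᵀ-eq s N)
  subᵀ-eq s (fix M)     = fix-cong (subᵀ-eq s M)
  subᵀ-eq s (if E ≐ F then M else N) =
    if-cong (subᴱ-eq (forStack s) E) (subᴱ-eq (forStack s) F) (subᵀ-eq s M) (subᵀ-eq s N)
  subᵀ-eq s (M ⨾ N)     = ⨾-cong (subᵀ-eq s M) (subᵀ-eq s N)
  subᵀ-eq s (let-new M) = let-new-cong (TermEq-narrow (subRel-↑ⁱ s) (subᵀ-eq (liftSubⁱ s) M))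
  subᵀ-eq s (free E)    = free-cong (subᴱ-eq (forStack s) E)
  subᵀ-eq s (let-read E _ M) = let-read-cong (subᴱ-eq (forStack s) E)
    (TermEq-narrow (subRel-↑ⁱ s) (subᵀ-eq (liftSubⁱ s) M))
  subᵀ-eq s (assign E _ F)   = assign-cong (subᴱ-eq (forStack s) E) (subᴱ-eq (forStack s) F)

  ≈ᵀ-eq : (M : Term Δ Γ τ) → TermEq (≈Rel Δ Γ) M M
  ≈ᵀ-eq M = term-eq λ { ρ _ η′ η refl t → Hom.cong-app ⟦ M ⟧ᵀ {ρ , η′} {ρ , η} (refl , t) }

  -- Renaming and substitution in specifications, and change of world

  -- Contravariant in the precondition and covariant in the postcondition. It serves change of
  -- world, transfer along equal denotations, the consequence rule and the regrouping of invariants.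
  Quadruple-resp : ∀ {r r′ s s′ c₀ c₀′ c₁ c₁′} → r ⊆ r′ → s′ ⊆ s →
    com ⊢ c₀′ ≈ c₀ → com ⊢ c₁′ ≈ c₁ → Quadruple r′ c₀′ c₁′ s′ → Quadruple r c₀ c₁ s
  Quadruple-resp r⊆r′ s′⊆s c₀≈ c₁≈ quad t h₀ h₁ k₀ k₁ x k =
    subst₂ eqG (c₀≈ (h₀ , k₀)) (c₁≈ (h₁ , k₁))
      (quad t h₀ h₁ k₀ k₁ (include (⋆-mono r⊆r′ (⊆-refl {t})) h₀ h₁ x)
        λ h₀ h₁ y → k h₀ h₁ (include (⋆-mono s′⊆s (⊆-refl {t})) h₀ h₁ y))

  -- The frame quantified in the given quadruple is instantiated with `t ⋆ u`, which absorbs the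
  -- added `t`.
  Quadruple-frame : ∀ {r s c₀ c₁} → Quadruple r c₀ c₁ s → ∀ t → Quadruple (r ⋆ t) c₀ c₁ (s ⋆ t)
  Quadruple-frame {r} {s} quad t u h₀ h₁ k₀ k₁ x k =
    quad (t ⋆ u) h₀ h₁ k₀ k₁ (include (proj₁ (⋆-assoc r t u)) h₀ h₁ x)
      λ h₀ h₁ y → k h₀ h₁ (include (proj₂ (⋆-assoc s t u)) h₀ h₁ y)

  World : ℕ → Ctx → Set₁
  World Δ Γ = Stack Δ × Env Γ × Env Γ × ℛ

  infix 0 _⊩_

  _⊩_ : World Δ Γ → Spec Δ Γ → Set₁
  (ρ , η₀ , η₁ , r) ⊩ φ = ⟨ ρ , η₀ , η₁ , r ⟩⊨ φ

  Match : EnvRel Δ′ Γ′ Δ Γ → World Δ′ Γ′ → World Δ Γ → Set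
  Match R (ρ′ , η₀′ , η₁′ , r′) (ρ , η₀ , η₁ , r) =
    stacks R ρ′ ρ × ids R ρ′ η₀′ η₀ × ids R ρ′ η₁′ η₁ × r′ ≅ r

  -- Both directions are carried along because `⊃` is contravariant in its premise.
  record SpecEq (R : EnvRel Δ′ Γ′ Δ Γ) (φ′ : Spec Δ′ Γ′) (φ : Spec Δ Γ) : Set₁ where
    constructor spec-eq
    field
      sat⇒ : ∀ w′ w → Match R w′ w → w′ ⊩ φ′ → w ⊩ φ
      sat⇐ : ∀ w′ w → Match R w′ w → w ⊩ φ → w′ ⊩ φ′

  open SpecEq

  SpecEq-⇔ : ∀ {R : EnvRel Δ′ Γ′ Δ Γ} {φ′ φ} → SpecEq R φ′ φ →
    ∀ w′ w → Match R w′ w → (w′ ⊩ φ′) ⇔ (w ⊩ φ)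
  SpecEq-⇔ e w′ w m = mk⇔ (sat⇒ e w′ w m) (sat⇐ e w′ w m)

  SpecEq-narrow : ∀ {R T : EnvRel Δ′ Γ′ Δ Γ} {φ′ φ} → R ⊆ᴱ T → SpecEq T φ′ φ → SpecEq R φ′ φ
  SpecEq-narrow {R = R} {T} R⊆T e = spec-eq
    (λ w′ w m → sat⇒ e w′ w (match w′ w m)) (λ w′ w m → sat⇐ e w′ w (match w′ w m))
    where
    match : ∀ w′ w → Match R w′ w → Match T w′ w
    match (ρ′ , η₀′ , η₁′ , r′) (ρ , η₀ , η₁ , r) (s , t₀ , t₁ , r′≅r) =
      stacks⊆ R⊆T ρ′ ρ s , ids⊆ R⊆T ρ′ η₀′ η₀ t₀ , ids⊆ R⊆T ρ′ η₁′ η₁ t₁ , r′≅r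

  module _ {R : EnvRel Δ′ Γ′ Δ Γ} where

    ⟪⟫-cong : ∀ {P′ M′ Q′ P M Q} → AssnEq (stacks R) P′ P → TermEq R M′ M →
      AssnEq (stacks R) Q′ Q → SpecEq R (⟪ P′ ⟫ M′ ⟪ Q′ ⟫) (⟪ P ⟫ M ⟪ Q ⟫)
    ⟪⟫-cong {P′} {M′} {Q′} {P} {M} {Q} p m q = spec-eq forth back
      where
      forth : ∀ w′ w → Match R w′ w → w′ ⊩ ⟪ P′ ⟫ M′ ⟪ Q′ ⟫ → w ⊩ ⟪ P ⟫ M ⟪ Q ⟫
      forth (ρ′ , η₀′ , η₁′ , r′) (ρ , η₀ , η₁ , r) (s , t₀ , t₁ , r′⊆r , r⊆r′) =
        Quadruple-resp {c₀ = app ⟦ M ⟧ᵀ (ρ , η₀)} {app ⟦ M′ ⟧ᵀ (ρ′ , η₀′)}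
          {app ⟦ M ⟧ᵀ (ρ , η₁)} {app ⟦ M′ ⟧ᵀ (ρ′ , η₁′)}
          (⋆-mono (proj₂ (eqᴬ-cong p ρ′ ρ s)) r⊆r′) (⋆-mono (proj₁ (eqᴬ-cong q ρ′ ρ s)) r′⊆r)
          (⟦⟧-≈ m ρ′ ρ η₀′ η₀ s t₀) (⟦⟧-≈ m ρ′ ρ η₁′ η₁ s t₁)
      back : ∀ w′ w → Match R w′ w → w ⊩ ⟪ P ⟫ M ⟪ Q ⟫ → w′ ⊩ ⟪ P′ ⟫ M′ ⟪ Q′ ⟫
      back (ρ′ , η₀′ , η₁′ , r′) (ρ , η₀ , η₁ , r) (s , t₀ , t₁ , r′⊆r , r⊆r′) =
        Quadruple-resp {c₀ = app ⟦ M′ ⟧ᵀ (ρ′ , η₀′)} {app ⟦ M ⟧ᵀ (ρ , η₀)}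
          {app ⟦ M′ ⟧ᵀ (ρ′ , η₁′)} {app ⟦ M ⟧ᵀ (ρ , η₁)}
          (⋆-mono (proj₁ (eqᴬ-cong p ρ′ ρ s)) r′⊆r) (⋆-mono (proj₂ (eqᴬ-cong q ρ′ ρ s)) r⊆r′)
          (λ a → sym (⟦⟧-≈ m ρ′ ρ η₀′ η₀ s t₀ a)) (λ a → sym (⟦⟧-≈ m ρ′ ρ η₁′ η₁ s t₁ a))

    ⊗-cong : ∀ {φ′ P′ φ P} → SpecEq R φ′ φ → AssnEq (stacks R) P′ P → SpecEq R (φ′ ⊗ P′) (φ ⊗ P)
    ⊗-cong e p = spec-eq
      (λ { (ρ′ , _) (ρ , _) (s , t₀ , t₁ , r≅) →
           sat⇒ e _ _ (s , t₀ , t₁ , ℛₘ.∙-cong r≅ (eqᴬ-cong p ρ′ ρ s)) })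
      (λ { (ρ′ , _) (ρ , _) (s , t₀ , t₁ , r≅) →
           sat⇐ e _ _ (s , t₀ , t₁ , ℛₘ.∙-cong r≅ (eqᴬ-cong p ρ′ ρ s)) })

    ≐ᴱ-cong : ∀ {E′ F′ E F} → ExpEq (stacks R) E′ E → ExpEq (stacks R) F′ F →
      SpecEq R (E′ ≐ᴱ F′) (E ≐ᴱ F)
    ≐ᴱ-cong e f = spec-eq
      (λ { (ρ′ , _) (ρ , _) (s , _) (lift eq) →
           lift (subst₂ _≡_ (⟦⟧-eq e ρ′ ρ s) (⟦⟧-eq f ρ′ ρ s) eq) })
      (λ { (ρ′ , _) (ρ , _) (s , _) (lift eq) →
           lift (subst₂ _≡_ (sym (⟦⟧-eq e ρ′ ρ s)) (sym (⟦⟧-eq f ρ′ ρ s)) eq) })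

    ≐ᵀ-cong : ∀ {M′ N′ : Term Δ′ Γ′ τ} {M N} → TermEq R M′ M → TermEq R N′ N →
      SpecEq R (M′ ≐ᵀ N′) (M ≐ᵀ N)
    ≐ᵀ-cong {τ = τ} {M′} {N′} {M} {N} m n = spec-eq forth back
      where
      forth : ∀ w′ w → Match R w′ w → w′ ⊩ M′ ≐ᵀ N′ → w ⊩ M ≐ᵀ N
      forth (ρ′ , η₀′ , η₁′ , _) (ρ , η₀ , η₁ , _) (s , t₀ , t₁ , _) (lift (eq₀ , eq₁)) =
        lift (transfer η₀′ η₀ t₀ eq₀ , transfer η₁′ η₁ t₁ eq₁)
        where
        transfer : ∀ η′ η → ids R ρ′ η′ η →
          τ ⊢ app ⟦ M′ ⟧ᵀ (ρ′ , η′) ≈ app ⟦ N′ ⟧ᵀ (ρ′ , η′) →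
          τ ⊢ app ⟦ M ⟧ᵀ (ρ , η) ≈ app ⟦ N ⟧ᵀ (ρ , η)
        transfer η′ η t eq = Dom.≈-trans τ (Dom.≈-sym τ (⟦⟧-≈ m ρ′ ρ η′ η s t))
          (Dom.≈-trans τ eq (⟦⟧-≈ n ρ′ ρ η′ η s t))
      back : ∀ w′ w → Match R w′ w → w ⊩ M ≐ᵀ N → w′ ⊩ M′ ≐ᵀ N′
      back (ρ′ , η₀′ , η₁′ , _) (ρ , η₀ , η₁ , _) (s , t₀ , t₁ , _) (lift (eq₀ , eq₁)) =
        lift (transfer η₀′ η₀ t₀ eq₀ , transfer η₁′ η₁ t₁ eq₁)
        where
        transfer : ∀ η′ η → ids R ρ′ η′ η →
          τ ⊢ app ⟦ M ⟧ᵀ (ρ , η) ≈ app ⟦ N ⟧ᵀ (ρ , η) →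
          τ ⊢ app ⟦ M′ ⟧ᵀ (ρ′ , η′) ≈ app ⟦ N′ ⟧ᵀ (ρ′ , η′)
        transfer η′ η t eq = Dom.≈-trans τ (⟦⟧-≈ m ρ′ ρ η′ η s t)
          (Dom.≈-trans τ eq (Dom.≈-sym τ (⟦⟧-≈ n ρ′ ρ η′ η s t)))

    ∧ˢ-cong : ∀ {φ′ ψ′ φ ψ} → SpecEq R φ′ φ → SpecEq R ψ′ ψ → SpecEq R (φ′ ∧ˢ ψ′) (φ ∧ˢ ψ)
    ∧ˢ-cong e f = spec-eq
      (λ w′ w m (x , y) → sat⇒ e w′ w m x , sat⇒ f w′ w m y)
      (λ w′ w m (x , y) → sat⇐ e w′ w m x , sat⇐ f w′ w m y)

    ∨ˢ-cong : ∀ {φ′ ψ′ φ ψ} → SpecEq R φ′ φ → SpecEq R ψ′ ψ → SpecEq R (φ′ ∨ˢ ψ′) (φ ∨ˢ ψ)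
    ∨ˢ-cong e f = spec-eq
      (λ w′ w m → ⊎-map (sat⇒ e w′ w m) (sat⇒ f w′ w m))
      (λ w′ w m → ⊎-map (sat⇐ e w′ w m) (sat⇐ f w′ w m))

    ⊃-cong : ∀ {φ′ ψ′ φ ψ} → SpecEq R φ′ φ → SpecEq R ψ′ ψ → SpecEq R (φ′ ⊃ ψ′) (φ ⊃ ψ)
    ⊃-cong e f = spec-eq
      (λ { (ρ′ , η₀′ , η₁′ , r′) (ρ , η₀ , η₁ , r) (s , t₀ , t₁ , r≅) imp u x →
           let m = s , t₀ , t₁ , ℛₘ.∙-congʳ {u} r≅ in sat⇒ f _ _ m (imp u (sat⇐ e _ _ m x)) })
      (λ { (ρ′ , η₀′ , η₁′ , r′) (ρ , η₀ , η₁ , r) (s , t₀ , t₁ , r≅) imp u x →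
           let m = s , t₀ , t₁ , ℛₘ.∙-congʳ {u} r≅ in sat⇐ f _ _ m (imp u (sat⇒ e _ _ m x)) })

    ∀ˣ-cong : ∀ {φ′ φ} → SpecEq (R ↑ˣ) φ′ φ → SpecEq R (∀ˣ τ φ′) (∀ˣ τ φ)
    ∀ˣ-cong {τ = τ} e = spec-eq
      (λ { _ _ (s , t₀ , t₁ , r≅) all m n →
           sat⇒ e _ _ (s , (Dom.≈-refl τ , t₀) , (Dom.≈-refl τ , t₁) , r≅) (all m n) })
      (λ { _ _ (s , t₀ , t₁ , r≅) all m n →
           sat⇐ e _ _ (s , (Dom.≈-refl τ , t₀) , (Dom.≈-refl τ , t₁) , r≅) (all m n) })

    ∃ˣ-cong : ∀ {φ′ φ} → SpecEq (R ↑ˣ) φ′ φ → SpecEq R (∃ˣ τ φ′) (∃ˣ τ φ)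
    ∃ˣ-cong {τ = τ} e = spec-eq
      (λ { _ _ (s , t₀ , t₁ , r≅) (m , n , x) → m , n ,
           sat⇒ e _ _ (s , (Dom.≈-refl τ , t₀) , (Dom.≈-refl τ , t₁) , r≅) x })
      (λ { _ _ (s , t₀ , t₁ , r≅) (m , n , x) → m , n ,
           sat⇐ e _ _ (s , (Dom.≈-refl τ , t₀) , (Dom.≈-refl τ , t₁) , r≅) x })

    ∀ⁱ-cong : ∀ {φ′ φ} → SpecEq (R ↑ⁱ) φ′ φ → SpecEq R (∀ⁱ φ′) (∀ⁱ φ)
    ∀ⁱ-cong e = spec-eq
      (λ { _ _ (s , t₀ , t₁ , r≅) all v → sat⇒ e _ _ ((refl , s) , t₀ , t₁ , r≅) (all v) })
      (λ { _ _ (s , t₀ , t₁ , r≅) all v → sat⇐ e _ _ ((refl , s) , t₀ , t₁ , r≅) (all v) })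

    ∃ⁱ-cong : ∀ {φ′ φ} → SpecEq (R ↑ⁱ) φ′ φ → SpecEq R (∃ⁱ φ′) (∃ⁱ φ)
    ∃ⁱ-cong e = spec-eq
      (λ { _ _ (s , t₀ , t₁ , r≅) (v , x) → v , sat⇒ e _ _ ((refl , s) , t₀ , t₁ , r≅) x })
      (λ { _ _ (s , t₀ , t₁ , r≅) (v , x) → v , sat⇐ e _ _ ((refl , s) , t₀ , t₁ , r≅) x })

  renˢ-eq : (f : Ren Δ Γ Δ′ Γ′) (φ : Spec Δ Γ) → SpecEq (renRel f) (renˢ f φ) φ
  renˢ-eq f (⟪ P ⟫ M ⟪ Q ⟫) =
    ⟪⟫-cong (renᴬ-eq (onStack f) P) (renᵀ-eq f M) (renᴬ-eq (onStack f) Q)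
  renˢ-eq f (φ ⊗ P)  = ⊗-cong (renˢ-eq f φ) (renᴬ-eq (onStack f) P)
  renˢ-eq f (E ≐ᴱ F) = ≐ᴱ-cong (renᴱ-eq (onStack f) E) (renᴱ-eq (onStack f) F)
  renˢ-eq f (M ≐ᵀ N) = ≐ᵀ-cong (renᵀ-eq f M) (renᵀ-eq f N)
  renˢ-eq f (φ ∧ˢ ψ) = ∧ˢ-cong (renˢ-eq f φ) (renˢ-eq f ψ)
  renˢ-eq f (φ ∨ˢ ψ) = ∨ˢ-cong (renˢ-eq f φ) (renˢ-eq f ψ)
  renˢ-eq f (φ ⊃ ψ)  = ⊃-cong (renˢ-eq f φ) (renˢ-eq f ψ)
  renˢ-eq f (∀ˣ τ φ) = ∀ˣ-cong (SpecEq-narrow (renRel-↑ˣ f) (renˢ-eq (liftˣ f) φ))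
  renˢ-eq f (∃ˣ τ φ) = ∃ˣ-cong (SpecEq-narrow (renRel-↑ˣ f) (renˢ-eq (liftˣ f) φ))
  renˢ-eq f (∀ⁱ φ)   = ∀ⁱ-cong (SpecEq-narrow (renRel-↑ⁱ f) (renˢ-eq (liftⁱ f) φ))
  renˢ-eq f (∃ⁱ φ)   = ∃ⁱ-cong (SpecEq-narrow (renRel-↑ⁱ f) (renˢ-eq (liftⁱ f) φ))

  subˢ-eq : (s : Sub Δ Γ Δ′ Γ′) (φ : Spec Δ Γ) → SpecEq (subRel s) (subˢ s φ) φ
  subˢ-eq s (⟪ P ⟫ M ⟪ Q ⟫) =
    ⟪⟫-cong (subᴬ-eq (forStack s) P) (subᵀ-eq s M) (subᴬ-eq (forStack s) Q)
  subˢ-eq s (φ ⊗ P)  = ⊗-cong (subˢ-eq s φ) (subᴬ-eq (forStack s) P)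
  subˢ-eq s (E ≐ᴱ F) = ≐ᴱ-cong (subᴱ-eq (forStack s) E) (subᴱ-eq (forStack s) F)
  subˢ-eq s (M ≐ᵀ N) = ≐ᵀ-cong (subᵀ-eq s M) (subᵀ-eq s N)
  subˢ-eq s (φ ∧ˢ ψ) = ∧ˢ-cong (subˢ-eq s φ) (subˢ-eq s ψ)
  subˢ-eq s (φ ∨ˢ ψ) = ∨ˢ-cong (subˢ-eq s φ) (subˢ-eq s ψ)
  subˢ-eq s (φ ⊃ ψ)  = ⊃-cong (subˢ-eq s φ) (subˢ-eq s ψ)
  subˢ-eq s (∀ˣ τ φ) = ∀ˣ-cong (SpecEq-narrow (subRel-↑ˣ s) (subˢ-eq (liftSubˣ s) φ))
  subˢ-eq s (∃ˣ τ φ) = ∃ˣ-cong (SpecEq-narrow (subRel-↑ˣ s) (subˢ-eq (liftSubˣ s) φ))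
  subˢ-eq s (∀ⁱ φ)   = ∀ⁱ-cong (SpecEq-narrow (subRel-↑ⁱ s) (subˢ-eq (liftSubⁱ s) φ))
  subˢ-eq s (∃ⁱ φ)   = ∃ⁱ-cong (SpecEq-narrow (subRel-↑ⁱ s) (subˢ-eq (liftSubⁱ s) φ))

  ≈Rel-↑ⁱ : ∀ Δ Γ → ≈Rel Δ Γ ↑ⁱ ⊆ᴱ ≈Rel (suc Δ) Γ
  ≈Rel-↑ⁱ Δ Γ = (λ { (_ ∷ _) (_ ∷ _) (refl , refl) → refl }) and λ { (_ ∷ _) _ _ t → t }

  ≈Rel-↑ˣ : ∀ Δ Γ → (≈Rel Δ Γ ↑ˣ) ⊆ᴱ ≈Rel Δ (τ ∷ Γ)
  ≈Rel-↑ˣ Δ Γ = (λ _ _ s → s) and λ _ _ _ t → t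

  -- The syntax stays the same here, while the environments vary up to `≈` and the world up to `≅`.
  -- This gives both `⊨-resp` and the substitution rule for equal terms.
  ≈ˢ-eq : (φ : Spec Δ Γ) → SpecEq (≈Rel Δ Γ) φ φ
  ≈ˢ-eq (⟪ P ⟫ M ⟪ Q ⟫) = ⟪⟫-cong (≡-stackᴬ-eq P) (≈ᵀ-eq M) (≡-stackᴬ-eq Q)
  ≈ˢ-eq (φ ⊗ P)  = ⊗-cong (≈ˢ-eq φ) (≡-stackᴬ-eq P)
  ≈ˢ-eq (E ≐ᴱ F) = ≐ᴱ-cong (≡-stackᴱ-eq E) (≡-stackᴱ-eq F)
  ≈ˢ-eq (M ≐ᵀ N) = ≐ᵀ-cong (≈ᵀ-eq M) (≈ᵀ-eq N)
  ≈ˢ-eq (φ ∧ˢ ψ) = ∧ˢ-cong (≈ˢ-eq φ) (≈ˢ-eq ψ)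
  ≈ˢ-eq (φ ∨ˢ ψ) = ∨ˢ-cong (≈ˢ-eq φ) (≈ˢ-eq ψ)
  ≈ˢ-eq (φ ⊃ ψ)  = ⊃-cong (≈ˢ-eq φ) (≈ˢ-eq ψ)
  ≈ˢ-eq (∀ˣ τ φ) = ∀ˣ-cong (SpecEq-narrow (≈Rel-↑ˣ _ _) (≈ˢ-eq φ))
  ≈ˢ-eq (∃ˣ τ φ) = ∃ˣ-cong (SpecEq-narrow (≈Rel-↑ˣ _ _) (≈ˢ-eq φ))
  ≈ˢ-eq (∀ⁱ φ)   = ∀ⁱ-cong (SpecEq-narrow (≈Rel-↑ⁱ _ _) (≈ˢ-eq φ))
  ≈ˢ-eq (∃ⁱ φ)   = ∃ⁱ-cong (SpecEq-narrow (≈Rel-↑ⁱ _ _) (≈ˢ-eq φ))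

  ⊨-resp : ∀ (φ : Spec Δ Γ) {ρ η₀ η₁ r s} → r ≅ s →
    ⟨ ρ , η₀ , η₁ , r ⟩⊨ φ → ⟨ ρ , η₀ , η₁ , s ⟩⊨ φ
  ⊨-resp {Γ = Γ} φ {ρ} {η₀} {η₁} {r} {s} r≅s =
    sat⇒ (≈ˢ-eq φ) (ρ , η₀ , η₁ , r) (ρ , η₀ , η₁ , s)
      (refl , FMCpo.≈-refl ⟦ Γ ⟧ᶜ , FMCpo.≈-refl ⟦ Γ ⟧ᶜ , r≅s)

  ⊨-extend : ∀ (φ : Spec Δ Γ) {ρ η₀ η₁ r} s →
    ⟨ ρ , η₀ , η₁ , r ⟩⊨ φ → ⟨ ρ , η₀ , η₁ , r ⋆ s ⟩⊨ φ
  ⊨-extend (⟪ P ⟫ M ⟪ Q ⟫) {ρ} {η₀} {η₁} {r} s quad =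
    Quadruple-resp {c₀ = c₀} {c₀} {c₁} {c₁}
      (proj₂ (⋆-assoc (eqᴬ P ρ) r s)) (proj₁ (⋆-assoc (eqᴬ Q ρ) r s)) (λ _ → refl) (λ _ → refl)
      (Quadruple-frame {eqᴬ P ρ ⋆ r} {eqᴬ Q ρ ⋆ r} {c₀} {c₁} quad s)
    where
    c₀ = app ⟦ M ⟧ᵀ (ρ , η₀)
    c₁ = app ⟦ M ⟧ᵀ (ρ , η₁)
  -- The invariant is adjoined to the already extended world, so it has to be exchanged with `s`.
  ⊨-extend (φ ⊗ P) {ρ} {r = r} s x = ⊨-resp φ (xy∙z≈xz∙y r (eqᴬ P ρ) s) (⊨-extend φ s x)
  ⊨-extend (E ≐ᴱ F) s (lift eq)     = lift eq
  ⊨-extend (M ≐ᵀ N) s (lift eqs)    = lift eqs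
  ⊨-extend (φ ∧ˢ ψ) s (x , y)       = ⊨-extend φ s x , ⊨-extend ψ s y
  ⊨-extend (φ ∨ˢ ψ) s (inj₁ x)      = inj₁ (⊨-extend φ s x)
  ⊨-extend (φ ∨ˢ ψ) s (inj₂ y)      = inj₂ (⊨-extend ψ s y)
  ⊨-extend (φ ⊃ ψ) {r = r} s imp t x =
    ⊨-resp ψ (ℛₘ.sym (⋆-assoc r s t)) (imp (s ⋆ t) (⊨-resp φ (⋆-assoc r s t) x))
  ⊨-extend (∀ˣ τ φ) s all m n       = ⊨-extend φ s (all m n)
  ⊨-extend (∃ˣ τ φ) s (m , n , x)   = m , n , ⊨-extend φ s x
  ⊨-extend (∀ⁱ φ) s all v           = ⊨-extend φ s (all v)
  ⊨-extend (∃ⁱ φ) s (v , x)         = v , ⊨-extend φ s x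

  -- Triples

  ⟶eqG-antitone : ∀ {q q′ k₀ k₁} w → q ⊆ q′ → k₀ [ q′ ⋆ w ⟶eqG] k₁ → k₀ [ q ⋆ w ⟶eqG] k₁
  ⟶eqG-antitone w q⊆q′ k h₀ h₁ x = k h₀ h₁ (include (⋆-mono q⊆q′ (⊆-refl {w})) h₀ h₁ x)

  -- A triple with the frame w fixed: w absorbs both the invariant of the world and the
  -- relation quantified in Quadruple.
  record Valid (w : ℛ) (ρ : Stack Δ) (η₀ η₁ : Env Γ) (P : Assn Δ) (M : Term Δ Γ com) (Q : Assn Δ) :
    Set where
    constructor valid
    field
      holds : ∀ h₀ h₁ k₀ k₁ → rel (eqᴬ P ρ ⋆ w) h₀ h₁ → k₀ [ eqᴬ Q ρ ⋆ w ⟶eqG] k₁ →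
              eqG (run M ρ η₀ h₀ k₀) (run M ρ η₁ h₁ k₁)

  open Valid

  ⊨⇒Valid : ∀ ρ (η₀ η₁ : Env Γ) r P (M : Term Δ Γ com) Q →
    ⟨ ρ , η₀ , η₁ , r ⟩⊨ ⟪ P ⟫ M ⟪ Q ⟫ → ∀ t → Valid (r ⋆ t) ρ η₀ η₁ P M Q
  ⊨⇒Valid ρ η₀ η₁ r P M Q quad t = valid λ h₀ h₁ k₀ k₁ x k →
    quad t h₀ h₁ k₀ k₁ (include (proj₂ (⋆-assoc (eqᴬ P ρ) r t)) h₀ h₁ x)
      λ h₀ h₁ y → k h₀ h₁ (include (proj₁ (⋆-assoc (eqᴬ Q ρ) r t)) h₀ h₁ y)

  Valid⇒⊨ : ∀ ρ (η₀ η₁ : Env Γ) r P (M : Term Δ Γ com) Q →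
    (∀ t → Valid (r ⋆ t) ρ η₀ η₁ P M Q) → ⟨ ρ , η₀ , η₁ , r ⟩⊨ ⟪ P ⟫ M ⟪ Q ⟫
  Valid⇒⊨ ρ η₀ η₁ r P M Q v t h₀ h₁ k₀ k₁ x k =
    holds (v t) h₀ h₁ k₀ k₁ (include (proj₁ (⋆-assoc (eqᴬ P ρ) r t)) h₀ h₁ x)
      λ h₀ h₁ y → k h₀ h₁ (include (proj₂ (⋆-assoc (eqᴬ Q ρ) r t)) h₀ h₁ y)

  module _ (w : ℛ) (ρ : Stack Δ) (η₀ η₁ : Env Γ) where

    -- The two footprints are equal heaps, so one witness `v` instantiates the hypothesis for both
    -- runs.
    exists-valid : ∀ {P Q} {M : Term Δ Γ com} → (∀ v → Valid w (v ∷ ρ) η₀ η₁ P (renᵀ wkⁱ M) Q) →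
      Valid w ρ η₀ η₁ (∃ᴬ P) M (∃ᴬ Q)
    exists-valid {P} {Q} {M} all = valid
      λ h₀ h₁ k₀ k₁ (n₀ , m₀ , n₁ , m₁ , s₀ , s₁ , (n≈ , v , p) , x) k →
        subst₂ eqG (wkⁱ-eq M v ρ η₀ (h₀ , k₀)) (wkⁱ-eq M v ρ η₁ (h₁ , k₁))
          (holds (all v) h₀ h₁ k₀ k₁ (n₀ , m₀ , n₁ , m₁ , s₀ , s₁ , (n≈ , p) , x)
            (⟶eqG-antitone {eqᴬ Q (v ∷ ρ)} {eqᴬ (∃ᴬ Q) ρ} {k₀} {k₁} w
              (inclusion λ _ _ (e , q) → e , v , q) k))

    -- `∨ᴬ` is the De Morgan encoding, so excluded middle decides which disjunct holds. It suffices
    -- to inspect `n₀`, since `n₁` equals it.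
    disjunction-valid : ∀ {P P′ Q Q′} {M : Term Δ Γ com} →
      Valid w ρ η₀ η₁ P M Q → Valid w ρ η₀ η₁ P′ M Q′ →
      Valid w ρ η₀ η₁ (P ∨ᴬ P′) M (Q ∨ᴬ Q′)
    disjunction-valid {P} {P′} {Q} {Q′} {M} t t′ = valid go
      where
      go : ∀ h₀ h₁ k₀ k₁ → rel (eqᴬ (P ∨ᴬ P′) ρ ⋆ w) h₀ h₁ →
        k₀ [ eqᴬ (Q ∨ᴬ Q′) ρ ⋆ w ⟶eqG] k₁ → eqG (run M ρ η₀ h₀ k₀) (run M ρ η₁ h₁ k₁)
      go h₀ h₁ k₀ k₁ (n₀ , m₀ , n₁ , m₁ , s₀ , s₁ , (n≈ , p∨p′) , x) k
        with em {⟦ P ⟧ᴬ ρ n₀} | em {⟦ P′ ⟧ᴬ ρ n₀}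
      ... | yes p | _      = holds t h₀ h₁ k₀ k₁ (n₀ , m₀ , n₁ , m₁ , s₀ , s₁ , (n≈ , p) , x)
        (⟶eqG-antitone {k₀ = k₀} {k₁} w
          (eqᴬ-mono Q (Q ∨ᴬ Q′) ρ λ _ q (¬q , _) → ¬q q) k)
      ... | no _  | yes p′ = holds t′ h₀ h₁ k₀ k₁ (n₀ , m₀ , n₁ , m₁ , s₀ , s₁ , (n≈ , p′) , x)
        (⟶eqG-antitone {k₀ = k₀} {k₁} w
          (eqᴬ-mono Q′ (Q ∨ᴬ Q′) ρ λ _ q′ (_ , ¬q′) → ¬q′ q′) k)
      ... | no ¬p | no ¬p′ = ⊥-elim (p∨p′ (¬p , ¬p′))

    -- The test depends only on `ρ`, which both runs share, so they take the same branch.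
    conditional-valid : ∀ {P E F Q} {M N : Term Δ Γ com} → Valid w ρ η₀ η₁ (P ∧ᴬ E ≐ᴬ F) M Q →
      Valid w ρ η₀ η₁ (P ∧ᴬ E ≢ᴬ F) N Q → Valid w ρ η₀ η₁ P (if E ≐ F then M else N) Q
    conditional-valid {P} {E} {F} {Q} {M} {N} m n = valid
      λ h₀ h₁ k₀ k₁ x k → subst₂ eqG
        (sym (if-eq ρ η₀ h₀ k₀ E F M N)) (sym (if-eq ρ η₁ h₁ k₁ E F M N))
        (branch h₀ h₁ k₀ k₁ x k (⟦ E ⟧ᴱ ρ ≟ᵛ ⟦ F ⟧ᴱ ρ))
      where
      branch : ∀ h₀ h₁ k₀ k₁ → rel (eqᴬ P ρ ⋆ w) h₀ h₁ → k₀ [ eqᴬ Q ρ ⋆ w ⟶eqG] k₁ →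
        (d : Dec (⟦ E ⟧ᴱ ρ ≡ ⟦ F ⟧ᴱ ρ)) →
        eqG (if does d then run M ρ η₀ h₀ k₀ else run N ρ η₀ h₀ k₀)
            (if does d then run M ρ η₁ h₁ k₁ else run N ρ η₁ h₁ k₁)
      branch h₀ h₁ k₀ k₁ (n₀ , m₀ , n₁ , m₁ , s₀ , s₁ , (n≈ , p) , x) k (yes e) =
        holds m h₀ h₁ k₀ k₁ (n₀ , m₀ , n₁ , m₁ , s₀ , s₁ , (n≈ , p , e) , x) k
      branch h₀ h₁ k₀ k₁ (n₀ , m₀ , n₁ , m₁ , s₀ , s₁ , (n≈ , p) , x) k (no ¬e) =
        holds n h₀ h₁ k₀ k₁ (n₀ , m₀ , n₁ , m₁ , s₀ , s₁ , (n≈ , p , ¬e) , x) k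

    sequence-valid : ∀ {P P₀ Q} {M N : Term Δ Γ com} →
      Valid w ρ η₀ η₁ P M P₀ → Valid w ρ η₀ η₁ P₀ N Q →
      Valid w ρ η₀ η₁ P (M ⨾ N) Q
    sequence-valid {P} {P₀} {Q} {M} {N} m n = valid go
      where
      go : ∀ h₀ h₁ k₀ k₁ → rel (eqᴬ P ρ ⋆ w) h₀ h₁ → k₀ [ eqᴬ Q ρ ⋆ w ⟶eqG] k₁ →
        eqG (run (M ⨾ N) ρ η₀ h₀ k₀) (run (M ⨾ N) ρ η₁ h₁ k₁)
      go h₀ h₁ k₀ k₁ x k =
        subst₂ eqG (sym (seqCont-eq M N ρ η₀ h₀ k₀)) (sym (seqCont-eq M N ρ η₁ h₁ k₁))
          (holds m h₀ h₁
            (app (seqCont N) ((ρ , η₀) , h₀ , k₀)) (app (seqCont N) ((ρ , η₁) , h₁ , k₁))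
            -- What `M` requires of its continuations is validity of `N` in the same frame `w`.
            x λ h₀′ h₁′ y → holds n h₀′ h₁′ k₀ k₁ y k)

    allocate-valid : ∀ {P Q} {M : Term (suc Δ) Γ com} →
      (∀ v → Valid w (v ∷ ρ) η₀ η₁ (wkᴬ P ✶ svar zero ↦ zeroᴱ , zeroᴱ) M (wkᴬ Q)) →
      Valid w ρ η₀ η₁ P (let-new M) Q
    allocate-valid {P} {Q} {M} all = valid go
      where
      X = State (Ctxᴰ Δ Γ)
      go : ∀ h₀ h₁ k₀ k₁ → rel (eqᴬ P ρ ⋆ w) h₀ h₁ → k₀ [ eqᴬ Q ρ ⋆ w ⟶eqG] k₁ →
        eqG (run (let-new M) ρ η₀ h₀ k₀) (run (let-new M) ρ η₁ h₁ k₁)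
      go h₀ h₁ k₀ k₁ (n₀ , m₀ , n₁ , m₁ , s₀ , s₁ , (n≈ , p) , x) k =
        subst₂ eqG
          (sym (let-new-eq ρ η₀ h₀ k₀ M (FMCpo.supp-supports X x₀) l∉L₀))
          (sym (let-new-eq ρ η₁ h₁ k₁ M (FMCpo.supp-supports X x₁) l∉L₁))
          (holds (all (loc l)) (h₀ ∪ c) (h₁ ∪ c) k₀ k₁
            ( n₀ ∪ c , m₀ , n₁ ∪ c , m₁ , proj₁ e₀ , proj₁ e₁
            , ( (λ l′ → cong (_<∣> cells c l′) (n≈ l′))
              , n₀ , c , proj₂ e₀ , Equivalence.from (wkᴬ-⇔ P (loc l) ρ n₀) p
              , l , refl , λ _ → refl)
            , x)
            (⟶eqG-antitone {k₀ = k₀} {k₁} w (proj₁ (eqᴬ-wk Q (loc l) ρ)) k))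
        where
        x₀ : ∣ X ∣
        x₀ = (ρ , η₀) , h₀ , k₀
        x₁ : ∣ X ∣
        x₁ = (ρ , η₁) , h₁ , k₁
        L₀ = FMCpo.supp X x₀
        L₁ = FMCpo.supp X x₁
        D₀ = proj₁ (finite h₀)
        D₁ = proj₁ (finite h₁)
        -- One location must serve both runs, because the extended footprints have to stay equal.
        -- Avoiding the supports lets `let-new-eq` use it; avoiding the domains makes the new cell
        -- disjoint from both heaps.
        L  = (L₀ ++ L₁) ++ (D₀ ++ D₁)
        l  = fresh L
        c  = [ l ↦ newCell ]
        l∉L₀ : l ∉ L₀
        l∉L₀ = fresh-∉ L ∘ ∈-++⁺ˡ ∘ ∈-++⁺ˡ
        l∉L₁ : l ∉ L₁
        l∉L₁ = fresh-∉ L ∘ ∈-++⁺ˡ ∘ ∈-++⁺ʳ L₀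
        e₀ = •-extend h₀ n₀ m₀ l newCell s₀
          (proj₂ (finite h₀) (fresh-∉ L ∘ ∈-++⁺ʳ (L₀ ++ L₁) ∘ ∈-++⁺ˡ))
        e₁ = •-extend h₁ n₁ m₁ l newCell s₁
          (proj₂ (finite h₁) (fresh-∉ L ∘ ∈-++⁺ʳ (L₀ ++ L₁) ∘ ∈-++⁺ʳ D₀))

    read-run : ∀ E f (M : Term (suc Δ) Γ com) η h k {l c} → ⟦ E ⟧ᴱ ρ ≡ loc l → cells h l ≡ just c →
      run (let-read E f M) ρ η h k ≡ run M (component f c ∷ ρ) η h k
    read-run E f M η h k {l} E≡l h≡c = trans (let-read-eq ρ η h k E f M)
      (cong (maybe′ (λ c → run M (component f c ∷ ρ) η h k) err)
        (trans (cong (cellAt h) E≡l) h≡c))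

    free-run : ∀ E η h k {l c} → ⟦ E ⟧ᴱ ρ ≡ loc l → cells h l ≡ just c →
      run (free {Γ = Γ} E) ρ η h k ≡ fun k (update l nothing h)
    free-run E η h k {l} {c} E≡l h≡c = trans (free-eq {Γ = Γ} ρ η h k E)
      (trans (cong (λ v → maybe′ (λ _ → fun k (updateAt v nothing h)) err (cellAt h v)) E≡l)
        (cong (maybe′ (λ _ → fun k (update l nothing h)) err) h≡c))

    assign-run : ∀ E f F η h k {l c} → ⟦ E ⟧ᴱ ρ ≡ loc l → cells h l ≡ just c →
      run (assign {Γ = Γ} E f F) ρ η h k ≡ fun k (update l (just (setComponent f (⟦ F ⟧ᴱ ρ) c)) h)
    assign-run E f F η h k {l} {c} E≡l h≡c = trans (assign-eq {Γ = Γ} ρ η h k E f F)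
      (trans (cong (λ v → maybe′ (λ c → fun k (updateAt v (just (setComponent f (⟦ F ⟧ᴱ ρ) c)) h))
                                 err (cellAt h v)) E≡l)
        (cong (maybe′ (λ c → fun k (update l (just (setComponent f (⟦ F ⟧ᴱ ρ) c)) h)) err) h≡c))

    read-valid : ∀ {P E E₁ Q} {M : Term (suc Δ) Γ com} →
      (∀ v → Valid w (v ∷ ρ) η₀ η₁ (P ✶ wkᴱ E ↦ svar zero , E₁) M (wkᴬ Q)) →
      Valid w ρ η₀ η₁ (∃ᴬ (P ✶ wkᴱ E ↦ svar zero , E₁)) (let-read E 0F M) Q
    read-valid {P} {E} {E₁} {Q} {M} all = valid go
      where
      go : ∀ h₀ h₁ k₀ k₁ → rel (eqᴬ (∃ᴬ (P ✶ wkᴱ E ↦ svar zero , E₁)) ρ ⋆ w) h₀ h₁ →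
        k₀ [ eqᴬ Q ρ ⋆ w ⟶eqG] k₁ →
        eqG (run (let-read E 0F M) ρ η₀ h₀ k₀) (run (let-read E 0F M) ρ η₁ h₁ k₁)
      go h₀ h₁ k₀ k₁
        (n₀ , m₀ , n₁ , m₁ , s₀ , s₁ , (n≈ , v , a , b , n₀≐ , p , l , wkE≡l , b≈) , x) k =
        subst₂ eqG
          (sym (read-run E 0F M η₀ h₀ k₀ E≡l (•-cells h₀ n₀ m₀ s₀ n₀≡c)))
          (sym (read-run E 0F M η₁ h₁ k₁ E≡l (•-cells h₁ n₁ m₁ s₁ (trans (sym (n≈ l)) n₀≡c))))
          -- Component 0 of the cell is the witness `v` itself, so both bodies run on the stack
          -- `v ∷ ρ`.
          (holds (all v) h₀ h₁ k₀ k₁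
            (n₀ , m₀ , n₁ , m₁ , s₀ , s₁ , (n≈ , a , b , n₀≐ , p , l , wkE≡l , b≈) , x)
            (⟶eqG-antitone {k₀ = k₀} {k₁} w (proj₁ (eqᴬ-wk Q v ρ)) k))
        where
        c : Cell
        c = v , ⟦ E₁ ⟧ᴱ (v ∷ ρ)
        E≡l : ⟦ E ⟧ᴱ ρ ≡ loc l
        E≡l = trans (sym (wkᴱ-eq E v ρ)) wkE≡l
        n₀≡c : cells n₀ l ≡ just c
        n₀≡c = •-cells n₀ b a (•-comm n₀ a b n₀≐) (trans (b≈ l) (cells-update l (just c) []ʰ))

    dispose-valid : ∀ {E} → Valid w ρ η₀ η₁ (E ↦–) (free {Γ = Γ} E) emp
    dispose-valid {E} = valid go
      where
      go : ∀ h₀ h₁ k₀ k₁ → rel (eqᴬ (E ↦–) ρ ⋆ w) h₀ h₁ → k₀ [ eqᴬ emp ρ ⋆ w ⟶eqG] k₁ →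
        eqG (run (free {Γ = Γ} E) ρ η₀ h₀ k₀) (run (free {Γ = Γ} E) ρ η₁ h₁ k₁)
      go h₀ h₁ k₀ k₁ (n₀ , m₀ , n₁ , m₁ , s₀ , s₁ , (n≈ , v , u , l , wkE≡l , n₀≈) , x) k =
        subst₂ eqG
          (sym (free-run E η₀ h₀ k₀ E≡l (•-cells h₀ n₀ m₀ s₀ n₀≡c)))
          (sym (free-run E η₁ h₁ k₁ E≡l (•-cells h₁ n₁ m₁ s₁ (trans (sym (n≈ l)) n₀≡c))))
          (k (update l nothing h₀) (update l nothing h₁)
            -- The remaining footprint is written as an update to match `•-update`; it is empty only
            -- up to `≈ʰ`.
            ( update l nothing []ʰ , m₀ , update l nothing []ʰ , m₁
            , •-update h₀ n₀ m₀ l (v , u) nothing s₀ n₀≈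
            , •-update h₁ n₁ m₁ l (v , u) nothing s₁ (λ l′ → trans (sym (n≈ l′)) (n₀≈ l′))
            , ((λ _ → refl) , update-nothing-[] l) , x))
        where
        E≡l : ⟦ E ⟧ᴱ ρ ≡ loc l
        E≡l = trans (sym (trans (wkᴱ-eq (wkᴱ E) u (v ∷ ρ)) (wkᴱ-eq E v ρ))) wkE≡l
        n₀≡c : cells n₀ l ≡ just (v , u)
        n₀≡c = trans (n₀≈ l) (cells-update l (just (v , u)) []ʰ)

    write-valid : ∀ {E E₁ F} → Valid w ρ η₀ η₁ (E ↦–, E₁) (assign {Γ = Γ} E 0F F) (E ↦ F , E₁)
    write-valid {E} {E₁} {F} = valid go
      where
      go : ∀ h₀ h₁ k₀ k₁ → rel (eqᴬ (E ↦–, E₁) ρ ⋆ w) h₀ h₁ →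
        k₀ [ eqᴬ (E ↦ F , E₁) ρ ⋆ w ⟶eqG] k₁ →
        eqG (run (assign {Γ = Γ} E 0F F) ρ η₀ h₀ k₀) (run (assign {Γ = Γ} E 0F F) ρ η₁ h₁ k₁)
      go h₀ h₁ k₀ k₁ (n₀ , m₀ , n₁ , m₁ , s₀ , s₁ , (n≈ , v , l , wkE≡l , n₀≈) , x) k =
        subst₂ eqG
          (sym (assign-run E 0F F η₀ h₀ k₀ E≡l (•-cells h₀ n₀ m₀ s₀ n₀≡c)))
          (sym (assign-run E 0F F η₁ h₁ k₁ E≡l (•-cells h₁ n₁ m₁ s₁ (trans (sym (n≈ l)) n₀≡c))))
          (k (update l (just d) h₀) (update l (just d) h₁)
            ( [ l ↦ d ] , m₀ , [ l ↦ d ] , m₁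
            , •-update h₀ n₀ m₀ l c (just d) s₀ n₀≈
            , •-update h₁ n₁ m₁ l c (just d) s₁ (λ l′ → trans (sym (n≈ l′)) (n₀≈ l′))
            , ((λ _ → refl) , l , E≡l ,
                λ l′ → cong (λ u → cells [ l ↦ ⟦ F ⟧ᴱ ρ , u ] l′) (wkᴱ-eq E₁ v ρ))
            , x))
        where
        c d : Cell
        c = v , ⟦ wkᴱ E₁ ⟧ᴱ (v ∷ ρ)
        -- The second component is the one already stored in `c`, hence still in weakened form;
        -- `wkᴱ-eq` removes the weakening in the postcondition.
        d = ⟦ F ⟧ᴱ ρ , ⟦ wkᴱ E₁ ⟧ᴱ (v ∷ ρ)
        E≡l : ⟦ E ⟧ᴱ ρ ≡ loc l
        E≡l = trans (sym (wkᴱ-eq E v ρ)) wkE≡l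
        n₀≡c : cells n₀ l ≡ just c
        n₀≡c = trans (n₀≈ l) (cells-update l (just c) []ʰ)

  -- Fixed-point induction

  -- Built from the combinators of `⟦_⟧ᵀ`, so continuity in the hole value is automatic. That value
  -- passes unchanged under binders, just as `plug` weakens the inserted term.
  ⟦_⟧ᴴ : Hole σ Δ Γ τ → Hom (Ctxᴰ Δ Γ ×ᴰ ⟦ σ ⟧) ⟦ τ ⟧
  ⟦ ∙ ⟧ᴴ      = π₂
  ⟦ lamᵥ C ⟧ᴴ = curry (⟦ C ⟧ᴴ ∘ᴴ ⟨ push π₂ (π₁ ∘ᴴ π₁) , π₂ ∘ᴴ π₁ ⟩)
  ⟦ C ·ᵥ E ⟧ᴴ = eval ∘ᴴ ⟨ ⟦ C ⟧ᴴ , expᴴ E ∘ᴴ π₁ ∘ᴴ π₁ ⟩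
  ⟦ lam C ⟧ᴴ  =
    curry (⟦ C ⟧ᴴ ∘ᴴ ⟨ ⟨ π₁ ∘ᴴ π₁ ∘ᴴ π₁ , ⟨ π₂ , π₂ ∘ᴴ π₁ ∘ᴴ π₁ ⟩ ⟩ , π₂ ∘ᴴ π₁ ⟩)
  ⟦ C · M ⟧ᴴ  = eval ∘ᴴ ⟨ ⟦ C ⟧ᴴ , ⟦ M ⟧ᵀ ∘ᴴ π₁ ⟩
  ⟦ fix {τ = τ} C ⟧ᴴ = fixᴴ ⟦ τ ⟧ (pointed τ) ∘ᴴ ⟦ C ⟧ᴴ
  ⟦ C ⨾ M ⟧ᴴ  = curry
    (eval ∘ᴴ ⟨ ⟦ C ⟧ᴴ ∘ᴴ ctx , ⟨ heap , seqCont M ∘ᴴ ⟨ π₁ ∘ᴴ π₁ , π₂ ⟩ ⟩ ⟩)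

  fill : Hole σ Δ Γ τ → Stack Δ → Env Γ → ∣ ⟦ σ ⟧ ∣ → ∣ ⟦ τ ⟧ ∣
  fill C ρ η d = app ⟦ C ⟧ᴴ ((ρ , η) , d)

  fill-⨾ : ∀ (C : Hole σ Δ Γ com) M ρ η d h k {k′ : ∣ Contᴰ ∣} →
    (∀ h′ → fun k′ h′ ≡ run M ρ η h′ k) →
    fun (fill (C ⨾ M) ρ η d) (h , k) ≡ fun (fill C ρ η d) (h , k′)
  fill-⨾ C M ρ η d h k eq = Fun.cong-fun (fill C ρ η d) ((λ _ → refl) , λ h′ → sym (eq h′))

  -- The value `d` is given only up to `≈`, so that under a binder the weakening equation for `N`
  -- can be absorbed into the hypothesis.
  plug-eq : ∀ (C : Hole σ Δ Γ τ) N ρ η {d} → σ ⊢ app ⟦ N ⟧ᵀ (ρ , η) ≈ d →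
    τ ⊢ app ⟦ plug C N ⟧ᵀ (ρ , η) ≈ fill C ρ η d
  plug-eq ∙ N ρ η e = e
  plug-eq {σ} (lamᵥ C) N ρ η e v =
    plug-eq C (renᵀ wkⁱ N) (v ∷ ρ) η (Dom.≈-trans σ (wkⁱ-eq N v ρ η) e)
  plug-eq (C ·ᵥ E) N ρ η e = plug-eq C N ρ η e (⟦ E ⟧ᴱ ρ)
  plug-eq {σ} (lam C) N ρ η e m =
    plug-eq C (renᵀ wkˣ N) ρ (m , η) (Dom.≈-trans σ (wkˣ-eq N ρ m η) e)
  plug-eq (C · M) N ρ η e = plug-eq C N ρ η e (app ⟦ M ⟧ᵀ (ρ , η))
  plug-eq {τ = τ} (fix C) N ρ η {d} e =
    Hom.cong-app (fixᴴ ⟦ τ ⟧ (pointed τ)) {app ⟦ plug C N ⟧ᵀ (ρ , η)} {fill C ρ η d}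
      (plug-eq C N ρ η e)
  plug-eq (C ⨾ M) N ρ η {d} e (h , k) =
    trans (seqCont-eq (plug C N) M ρ η h k)
      (trans (plug-eq C N ρ η e (h , k′)) (sym (fill-⨾ C M ρ η d h k λ _ → refl)))
    where k′ = app (seqCont M) ((ρ , η) , h , k)

  renᶜ-eq : ∀ (f : Ren Δ Γ Δ′ Γ′) (C : Hole σ Δ Γ τ) ρ′ ρ η′ η →
    stacks (renRel f) ρ′ ρ → ids (renRel f) ρ′ η′ η → ∀ d →
    τ ⊢ fill (renᶜ f C) ρ′ η′ d ≈ fill C ρ η d
  renᶜ-eq {σ = σ} f ∙ ρ′ ρ η′ η s t d = Dom.≈-refl σ
  renᶜ-eq f (lamᵥ C) ρ′ ρ η′ η s t d v =
    renᶜ-eq (liftⁱ f) C (v ∷ ρ′) (v ∷ ρ) η′ η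
      (stacks⊆ (renRel-↑ⁱ f) (v ∷ ρ′) (v ∷ ρ) (refl , s))
      (λ {τ} → ids⊆ (renRel-↑ⁱ f) (v ∷ ρ′) η′ η t {τ}) d
  renᶜ-eq {τ = τ} f (C ·ᵥ E) ρ′ ρ η′ η s t d =
    Dom.≈-trans τ (renᶜ-eq f C ρ′ ρ η′ η s t d (⟦ renᴱ (onStack f) E ⟧ᴱ ρ′))
      (Fun.cong-fun (fill C ρ η d) (⟦⟧-eq (renᴱ-eq (onStack f) E) ρ′ ρ s))
  renᶜ-eq f (lam {τ′ = υ} C) ρ′ ρ η′ η s t d m =
    renᶜ-eq (liftˣ f) C ρ′ ρ (m , η′) (m , η) s
      (λ {τ} → ids⊆ (renRel-↑ˣ f) ρ′ (m , η′) (m , η) (Dom.≈-refl υ , t) {τ}) d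
  renᶜ-eq {τ = τ} f (C · M) ρ′ ρ η′ η s t d =
    Dom.≈-trans τ (renᶜ-eq f C ρ′ ρ η′ η s t d (app ⟦ renᵀ f M ⟧ᵀ (ρ′ , η′)))
      (Fun.cong-fun (fill C ρ η d) (⟦⟧-≈ (renᵀ-eq f M) ρ′ ρ η′ η s t))
  renᶜ-eq {τ = τ} f (fix C) ρ′ ρ η′ η s t d =
    Hom.cong-app (fixᴴ ⟦ τ ⟧ (pointed τ)) {fill (renᶜ f C) ρ′ η′ d} {fill C ρ η d}
      (renᶜ-eq f C ρ′ ρ η′ η s t d)
  renᶜ-eq f (C ⨾ M) ρ′ ρ η′ η s t d (h , k) =
    trans (fill-⨾ (renᶜ f C) (renᵀ f M) ρ′ η′ d h k {k′} λ _ → refl)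
      (trans (renᶜ-eq f C ρ′ ρ η′ η s t d (h , k′))
        (sym (fill-⨾ C M ρ η d h k λ h′ → TermEq-run (renᵀ-eq f M) ρ′ ρ η′ η s t h′ k)))
    where k′ = app (seqCont (renᵀ f M)) ((ρ′ , η′) , h , k)

  bot : ∀ τ → ∣ ⟦ τ ⟧ ∣
  bot τ = Pointed.bot (pointed τ)

  -- The grammar places holes only under abstractions, in function position, under `fix` and to the
  -- left of `⨾`, never in an argument; each of these positions preserves ⊥.
  fill-strict : ∀ (C : Hole σ Δ Γ τ) ρ η → τ ⊢ fill C ρ η (bot σ) ≈ bot τ
  fill-strict {σ} ∙ ρ η       = Dom.≈-refl σ
  fill-strict (lamᵥ C) ρ η v  = fill-strict C (v ∷ ρ) η
  fill-strict (C ·ᵥ E) ρ η    = fill-strict C ρ η (⟦ E ⟧ᴱ ρ)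
  fill-strict (lam C) ρ η m   = fill-strict C ρ (m , η)
  fill-strict (C · M) ρ η     = fill-strict C ρ η (app ⟦ M ⟧ᵀ (ρ , η))
  fill-strict {σ} {τ = τ} (fix C) ρ η = Dom.⊑-antisym τ
    (LeastFixedPoint.lfp-least ⟦ τ ⟧ (pointed τ) (fill C ρ η (bot σ)) (bot τ)
      -- The functional itself is ⊥, so ⊥ is a prefixed point and hence above the least fixed point.
      (Dom.⊑-reflexive τ (fill-strict C ρ η (bot τ))))
    (Pointed.least (pointed τ) _)
  fill-strict {σ} (C ⨾ M) ρ η (h , k) =
    trans (fill-⨾ C M ρ η (bot σ) h k {k′} λ _ → refl) (fill-strict C ρ η (h , k′))
    where k′ = app (seqCont M) ((ρ , η) , h , k)

  -- With heap and continuation fixed, the observable result becomes a continuous function of the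
  -- hole value alone, so that lubs can be compared in `Oᴰ`.
  outcome : Hole σ Δ Γ com → Stack Δ → Env Γ → Heap → ∣ Contᴰ ∣ → Fun ⟦ σ ⟧ Oᴰ
  outcome {Δ = Δ} {Γ} C ρ η h k = app (curry {State (Ctxᴰ Δ Γ)}
    (eval ∘ᴴ ⟨ ⟦ C ⟧ᴴ ∘ᴴ ⟨ π₁ ∘ᴴ π₁ , π₂ ⟩ , π₂ ∘ᴴ π₁ ⟩)) ((ρ , η) , h , k)

  -- The lub stays in G because normal is an upper bound of G.
  eqG-lub : ∀ {a b x y} → FMPoset.IsLub Oᴾ a x → FMPoset.IsLub Oᴾ b y →
    (∀ n → eqG (a n) (b n)) → eqG x y
  eqG-lub {a} la lb e = FMPoset.isLub-unique Oᴾ (λ n → proj₁ (e n)) la lb ,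
    ⊑normal⇒G (proj₂ la normal λ n → G⇒⊑normal (proj₂ (e n)))
    where
    G⇒⊑normal : ∀ {o} → G o → o ⊑ᴼ normal
    G⇒⊑normal (inj₁ refl) = refl
    G⇒⊑normal (inj₂ refl) = bot⊑
    ⊑normal⇒G : ∀ {o} → o ⊑ᴼ normal → G o
    ⊑normal⇒G bot⊑ = inj₂ refl
    ⊑normal⇒G refl = inj₁ refl

  infix 4 ⟨_,_,_,_¦_,_⟩⊨_

  -- Satisfaction of γ with the values d₀ and d₁ in its hole on the two sides.
  ⟨_,_,_,_¦_,_⟩⊨_ : Stack Δ → Env Γ → Env Γ → ℛ → ∣ ⟦ σ ⟧ ∣ → ∣ ⟦ σ ⟧ ∣ → HoleSpec σ Δ Γ → Set₁
  ⟨ ρ , η₀ , η₁ , r ¦ d₀ , d₁ ⟩⊨ ⟪ P ⟫ C ⟪ Q ⟫ =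
    Quadruple (eqᴬ P ρ ⋆ r) (fill C ρ η₀ d₀) (fill C ρ η₁ d₁) (eqᴬ Q ρ ⋆ r)
  ⟨ ρ , η₀ , η₁ , r ¦ d₀ , d₁ ⟩⊨ (γ ∧ˢ δ) =
    ⟨ ρ , η₀ , η₁ , r ¦ d₀ , d₁ ⟩⊨ γ × ⟨ ρ , η₀ , η₁ , r ¦ d₀ , d₁ ⟩⊨ δ
  ⟨ ρ , η₀ , η₁ , r ¦ d₀ , d₁ ⟩⊨ (∀ˣ τ γ) = ∀ m n → ⟨ ρ , (m , η₀) , (n , η₁) , r ¦ d₀ , d₁ ⟩⊨ γ
  ⟨ ρ , η₀ , η₁ , r ¦ d₀ , d₁ ⟩⊨ (∀ⁱ γ)   = ∀ v → ⟨ v ∷ ρ , η₀ , η₁ , r ¦ d₀ , d₁ ⟩⊨ γ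

  plug-⇔ : ∀ (γ : HoleSpec σ Δ Γ) N ρ η₀ η₁ r {d₀ d₁} →
    σ ⊢ app ⟦ N ⟧ᵀ (ρ , η₀) ≈ d₀ → σ ⊢ app ⟦ N ⟧ᵀ (ρ , η₁) ≈ d₁ →
    ⟨ ρ , η₀ , η₁ , r ⟩⊨ γ ⦅ N ⦆ ⇔ ⟨ ρ , η₀ , η₁ , r ¦ d₀ , d₁ ⟩⊨ γ
  plug-⇔ (⟪ P ⟫ C ⟪ Q ⟫) N ρ η₀ η₁ r {d₀} {d₁} e₀ e₁ = mk⇔
    (Quadruple-resp {c₀ = fill C ρ η₀ d₀} {app ⟦ plug C N ⟧ᵀ (ρ , η₀)}
      {fill C ρ η₁ d₁} {app ⟦ plug C N ⟧ᵀ (ρ , η₁)}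
      (⊆-refl {eqᴬ P ρ ⋆ r}) (⊆-refl {eqᴬ Q ρ ⋆ r})
      (plug-eq C N ρ η₀ e₀) (plug-eq C N ρ η₁ e₁))
    (Quadruple-resp {c₀ = app ⟦ plug C N ⟧ᵀ (ρ , η₀)} {fill C ρ η₀ d₀}
      {app ⟦ plug C N ⟧ᵀ (ρ , η₁)} {fill C ρ η₁ d₁}
      (⊆-refl {eqᴬ P ρ ⋆ r}) (⊆-refl {eqᴬ Q ρ ⋆ r})
      (λ a → sym (plug-eq C N ρ η₀ e₀ a)) (λ a → sym (plug-eq C N ρ η₁ e₁ a)))
  plug-⇔ (γ ∧ˢ δ) N ρ η₀ η₁ r e₀ e₁ = mk⇔
    (λ (x , y) → Equivalence.to g x , Equivalence.to d y)
    (λ (x , y) → Equivalence.from g x , Equivalence.from d y)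
    where
    g = plug-⇔ γ N ρ η₀ η₁ r e₀ e₁
    d = plug-⇔ δ N ρ η₀ η₁ r e₀ e₁
  plug-⇔ {σ} (∀ˣ τ γ) N ρ η₀ η₁ r {d₀} {d₁} e₀ e₁ =
    mk⇔ (λ x m n → Equivalence.to (g m n) (x m n)) (λ x m n → Equivalence.from (g m n) (x m n))
    where
    g : ∀ m n → ⟨ ρ , (m , η₀) , (n , η₁) , r ⟩⊨ γ ⦅ renᵀ wkˣ N ⦆ ⇔
                ⟨ ρ , (m , η₀) , (n , η₁) , r ¦ d₀ , d₁ ⟩⊨ γ
    g m n = plug-⇔ γ (renᵀ wkˣ N) ρ (m , η₀) (n , η₁) r
      (Dom.≈-trans σ (wkˣ-eq N ρ m η₀) e₀) (Dom.≈-trans σ (wkˣ-eq N ρ n η₁) e₁)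
  plug-⇔ {σ} (∀ⁱ γ) N ρ η₀ η₁ r {d₀} {d₁} e₀ e₁ =
    mk⇔ (λ x v → Equivalence.to (g v) (x v)) (λ x v → Equivalence.from (g v) (x v))
    where
    g : ∀ v → ⟨ v ∷ ρ , η₀ , η₁ , r ⟩⊨ γ ⦅ renᵀ wkⁱ N ⦆ ⇔ ⟨ v ∷ ρ , η₀ , η₁ , r ¦ d₀ , d₁ ⟩⊨ γ
    g v = plug-⇔ γ (renᵀ wkⁱ N) (v ∷ ρ) η₀ η₁ r
      (Dom.≈-trans σ (wkⁱ-eq N v ρ η₀) e₀) (Dom.≈-trans σ (wkⁱ-eq N v ρ η₁) e₁)

  -- The induction premise states `γ` under one more identifier; this moves it into and out of that
  -- context with the hole values fixed.
  renᵞ-⇔ : ∀ (f : Ren Δ Γ Δ′ Γ′) (γ : HoleSpec σ Δ Γ) ρ′ ρ η₀′ η₀ η₁′ η₁ r {d₀ d₁} →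
    stacks (renRel f) ρ′ ρ → ids (renRel f) ρ′ η₀′ η₀ → ids (renRel f) ρ′ η₁′ η₁ →
    ⟨ ρ′ , η₀′ , η₁′ , r ¦ d₀ , d₁ ⟩⊨ renᵞ f γ ⇔ ⟨ ρ , η₀ , η₁ , r ¦ d₀ , d₁ ⟩⊨ γ
  renᵞ-⇔ f (⟪ P ⟫ C ⟪ Q ⟫) ρ′ ρ η₀′ η₀ η₁′ η₁ r {d₀} {d₁} s t₀ t₁ = mk⇔
    (Quadruple-resp {c₀ = fill C ρ η₀ d₀} {fill (renᶜ f C) ρ′ η₀′ d₀}
      {fill C ρ η₁ d₁} {fill (renᶜ f C) ρ′ η₁′ d₁}
      (⋆-mono (proj₂ p) (⊆-refl {r})) (⋆-mono (proj₁ q) (⊆-refl {r}))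
      (renᶜ-eq f C ρ′ ρ η₀′ η₀ s t₀ d₀) (renᶜ-eq f C ρ′ ρ η₁′ η₁ s t₁ d₁))
    (Quadruple-resp {c₀ = fill (renᶜ f C) ρ′ η₀′ d₀} {fill C ρ η₀ d₀}
      {fill (renᶜ f C) ρ′ η₁′ d₁} {fill C ρ η₁ d₁}
      (⋆-mono (proj₁ p) (⊆-refl {r})) (⋆-mono (proj₂ q) (⊆-refl {r}))
      (λ a → sym (renᶜ-eq f C ρ′ ρ η₀′ η₀ s t₀ d₀ a))
      (λ a → sym (renᶜ-eq f C ρ′ ρ η₁′ η₁ s t₁ d₁ a)))
    where
    p = eqᴬ-cong (renᴬ-eq (onStack f) P) ρ′ ρ s
    q = eqᴬ-cong (renᴬ-eq (onStack f) Q) ρ′ ρ s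
  renᵞ-⇔ f (γ ∧ˢ δ) ρ′ ρ η₀′ η₀ η₁′ η₁ r s t₀ t₁ = mk⇔
    (λ (x , y) → Equivalence.to g x , Equivalence.to d y)
    (λ (x , y) → Equivalence.from g x , Equivalence.from d y)
    where
    g = renᵞ-⇔ f γ ρ′ ρ η₀′ η₀ η₁′ η₁ r s t₀ t₁
    d = renᵞ-⇔ f δ ρ′ ρ η₀′ η₀ η₁′ η₁ r s t₀ t₁
  renᵞ-⇔ f (∀ˣ τ γ) ρ′ ρ η₀′ η₀ η₁′ η₁ r {d₀} {d₁} s t₀ t₁ =
    mk⇔ (λ x m n → Equivalence.to (g m n) (x m n)) (λ x m n → Equivalence.from (g m n) (x m n))
    where
    g : ∀ m n → ⟨ ρ′ , (m , η₀′) , (n , η₁′) , r ¦ d₀ , d₁ ⟩⊨ renᵞ (liftˣ f) γ ⇔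
                ⟨ ρ , (m , η₀) , (n , η₁) , r ¦ d₀ , d₁ ⟩⊨ γ
    g m n = renᵞ-⇔ (liftˣ f) γ ρ′ ρ (m , η₀′) (m , η₀) (n , η₁′) (n , η₁) r s
      (λ {υ} → ids⊆ (renRel-↑ˣ f) ρ′ (m , η₀′) (m , η₀) (Dom.≈-refl τ , t₀) {υ})
      (λ {υ} → ids⊆ (renRel-↑ˣ f) ρ′ (n , η₁′) (n , η₁) (Dom.≈-refl τ , t₁) {υ})
  renᵞ-⇔ f (∀ⁱ γ) ρ′ ρ η₀′ η₀ η₁′ η₁ r {d₀} {d₁} s t₀ t₁ =
    mk⇔ (λ x v → Equivalence.to (g v) (x v)) (λ x v → Equivalence.from (g v) (x v))
    where
    g : ∀ v → ⟨ v ∷ ρ′ , η₀′ , η₁′ , r ¦ d₀ , d₁ ⟩⊨ renᵞ (liftⁱ f) γ ⇔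
              ⟨ v ∷ ρ , η₀ , η₁ , r ¦ d₀ , d₁ ⟩⊨ γ
    g v = renᵞ-⇔ (liftⁱ f) γ (v ∷ ρ′) (v ∷ ρ) η₀′ η₀ η₁′ η₁ r
      (stacks⊆ (renRel-↑ⁱ f) (v ∷ ρ′) (v ∷ ρ) (refl , s))
      (λ {υ} → ids⊆ (renRel-↑ⁱ f) (v ∷ ρ′) η₀′ η₀ t₀ {υ})
      (λ {υ} → ids⊆ (renRel-↑ⁱ f) (v ∷ ρ′) η₁′ η₁ t₁ {υ})

  -- By strictness both runs yield `⊥ᴼ`, which belongs to `G`; neither the precondition nor the
  -- continuations are consulted.
  ⊨-bot : ∀ (γ : HoleSpec σ Δ Γ) ρ η₀ η₁ r → ⟨ ρ , η₀ , η₁ , r ¦ bot σ , bot σ ⟩⊨ γ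
  ⊨-bot (⟪ P ⟫ C ⟪ Q ⟫) ρ η₀ η₁ r t h₀ h₁ k₀ k₁ x k =
    subst₂ eqG (sym (fill-strict C ρ η₀ (h₀ , k₀))) (sym (fill-strict C ρ η₁ (h₁ , k₁)))
      (refl , inj₂ refl)
  ⊨-bot (γ ∧ˢ δ) ρ η₀ η₁ r     = ⊨-bot γ ρ η₀ η₁ r , ⊨-bot δ ρ η₀ η₁ r
  ⊨-bot (∀ˣ τ γ) ρ η₀ η₁ r m n = ⊨-bot γ ρ (m , η₀) (n , η₁) r
  ⊨-bot (∀ⁱ γ) ρ η₀ η₁ r v     = ⊨-bot γ (v ∷ ρ) η₀ η₁ r

  -- Frame, heaps and continuations do not depend on the chain index, so a triple reduces to closure
  -- of `eqG` under lubs. The only connectives in `γ` are conjunction and universal quantification,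
  -- which preserve closure pointwise.
  ⊨-lub : ∀ (γ : HoleSpec σ Δ Γ) ρ η₀ η₁ r (c₀ c₁ : Chain (Dom.fmposet σ)) {d₀ d₁} →
    Dom.IsLub σ (at c₀) d₀ → Dom.IsLub σ (at c₁) d₁ →
    (∀ n → ⟨ ρ , η₀ , η₁ , r ¦ at c₀ n , at c₁ n ⟩⊨ γ) → ⟨ ρ , η₀ , η₁ , r ¦ d₀ , d₁ ⟩⊨ γ
  ⊨-lub (⟪ P ⟫ C ⟪ Q ⟫) ρ η₀ η₁ r c₀ c₁ l₀ l₁ all t h₀ h₁ k₀ k₁ x k =
    eqG-lub (Fun.cont (outcome C ρ η₀ h₀ k₀) c₀ l₀) (Fun.cont (outcome C ρ η₁ h₁ k₁) c₁ l₁)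
      λ n → all n t h₀ h₁ k₀ k₁ x k
  ⊨-lub (γ ∧ˢ δ) ρ η₀ η₁ r c₀ c₁ l₀ l₁ all =
    ⊨-lub γ ρ η₀ η₁ r c₀ c₁ l₀ l₁ (λ n → proj₁ (all n)) ,
    ⊨-lub δ ρ η₀ η₁ r c₀ c₁ l₀ l₁ (λ n → proj₂ (all n))
  ⊨-lub (∀ˣ τ γ) ρ η₀ η₁ r c₀ c₁ l₀ l₁ all m n =
    ⊨-lub γ ρ (m , η₀) (n , η₁) r c₀ c₁ l₀ l₁ λ i → all i m n
  ⊨-lub (∀ⁱ γ) ρ η₀ η₁ r c₀ c₁ l₀ l₁ all v =
    ⊨-lub γ (v ∷ ρ) η₀ η₁ r c₀ c₁ l₀ l₁ λ i → all i v

  fix-induction-valid : ∀ (γ : HoleSpec σ Δ Γ) (M : Term Δ Γ (σ ⇒ σ)) ρ η₀ η₁ r →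
    ⟨ ρ , η₀ , η₁ , r ⟩⊨ ∀ˣ σ (renᵞ wkˣ γ ⦅ var (here refl) ⦆ ⊃
                               renᵞ wkˣ γ ⦅ renᵀ wkˣ M · var (here refl) ⦆) →
    ⟨ ρ , η₀ , η₁ , r ⟩⊨ γ ⦅ fix M ⦆
  fix-induction-valid {σ} γ M ρ η₀ η₁ r prem =
    Equivalence.from (plug-⇔ γ (fix M) ρ η₀ η₁ r (Dom.≈-refl σ) (Dom.≈-refl σ))
      (⊨-lub γ ρ η₀ η₁ r (iterateChain F₀) (iterateChain F₁)
        (Dom.⨆-lub σ (iterateChain F₀)) (Dom.⨆-lub σ (iterateChain F₁)) approx)
    where
    open LeastFixedPoint ⟦ σ ⟧ (pointed σ) using (iterate; iterateChain)
    F₀ F₁ : Fun ⟦ σ ⟧ ⟦ σ ⟧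
    F₀ = app ⟦ M ⟧ᵀ (ρ , η₀)
    F₁ = app ⟦ M ⟧ᵀ (ρ , η₁)
    wk : ∀ m n {d₀ d₁} →
      ⟨ ρ , (m , η₀) , (n , η₁) , r ¦ d₀ , d₁ ⟩⊨ renᵞ wkˣ γ ⇔ ⟨ ρ , η₀ , η₁ , r ¦ d₀ , d₁ ⟩⊨ γ
    wk m n = renᵞ-⇔ wkˣ γ ρ ρ (m , η₀) η₀ (n , η₁) η₁ r (λ _ → refl)
      (λ {τ} _ → Dom.≈-refl τ) (λ {τ} _ → Dom.≈-refl τ)
    -- `∀ˣ` ranges over independent pairs of values, so the premise may be applied to approximants
    -- of two different functionals. Freshness of the bound identifier makes `γ` insensitive to `m`
    -- and `n` outside the hole.
    step : ∀ m n → ⟨ ρ , η₀ , η₁ , r ¦ m , n ⟩⊨ γ → ⟨ ρ , η₀ , η₁ , r ¦ fun F₀ m , fun F₁ n ⟩⊨ γ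
    step m n x = Equivalence.to (wk m n)
      (Equivalence.to
        (plug-⇔ (renᵞ wkˣ γ) (renᵀ wkˣ M · var (here refl)) ρ (m , η₀) (n , η₁) r
          (wkˣ-eq M ρ m η₀ m) (wkˣ-eq M ρ n η₁ n))
        (⊨-resp (renᵞ wkˣ γ ⦅ renᵀ wkˣ M · var (here refl) ⦆) (ℛₘ.identityʳ r)
          (prem m n ε (⊨-extend (renᵞ wkˣ γ ⦅ var (here refl) ⦆) ε
            (Equivalence.from
              (plug-⇔ (renᵞ wkˣ γ) (var (here refl)) ρ (m , η₀) (n , η₁) r
                (Dom.≈-refl σ) (Dom.≈-refl σ))
              (Equivalence.from (wk m n) x))))))
    approx : ∀ n → ⟨ ρ , η₀ , η₁ , r ¦ iterate F₀ n , iterate F₁ n ⟩⊨ γ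
    approx zero    = ⊨-bot γ ρ η₀ η₁ r
    approx (suc n) = step (iterate F₀ n) (iterate F₁ n) (approx n)

  -- Soundness of the deduction rules

  wkˣ-⇔ : ∀ (φ : Spec Δ Γ) ρ (m n : ∣ ⟦ σ ⟧ ∣) η₀ η₁ r →
    ⟨ ρ , (m , η₀) , (n , η₁) , r ⟩⊨ renˢ (wkˣ {σ = σ}) φ ⇔ ⟨ ρ , η₀ , η₁ , r ⟩⊨ φ
  wkˣ-⇔ φ ρ m n η₀ η₁ r = SpecEq-⇔ (renˢ-eq wkˣ φ) _ _
    ((λ _ → refl) , (λ {τ} _ → Dom.≈-refl τ) , (λ {τ} _ → Dom.≈-refl τ) , ℛₘ.refl {r})

  wkⁱ-⇔ : ∀ (φ : Spec Δ Γ) v ρ η₀ η₁ r →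
    ⟨ v ∷ ρ , η₀ , η₁ , r ⟩⊨ renˢ wkⁱ φ ⇔ ⟨ ρ , η₀ , η₁ , r ⟩⊨ φ
  wkⁱ-⇔ φ v ρ η₀ η₁ r = SpecEq-⇔ (renˢ-eq wkⁱ φ) _ _
    ((λ _ → refl) , (λ {τ} _ → Dom.≈-refl τ) , (λ {τ} _ → Dom.≈-refl τ) , ℛₘ.refl {r})

  []ˣ-⇔ : ∀ (φ : Spec Δ (σ ∷ Γ)) M ρ η₀ η₁ r → ⟨ ρ , η₀ , η₁ , r ⟩⊨ φ [ M ]ˣ ⇔
    ⟨ ρ , (app ⟦ M ⟧ᵀ (ρ , η₀) , η₀) , (app ⟦ M ⟧ᵀ (ρ , η₁) , η₁) , r ⟩⊨ φ
  []ˣ-⇔ {σ = σ} {Γ} φ M ρ η₀ η₁ r = SpecEq-⇔ (subˢ-eq (singleˣ M) φ) _ _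
    ((λ _ → refl) , same η₀ , same η₁ , ℛₘ.refl {r})
    where
    same : ∀ η {τ} (x : τ ∈ σ ∷ Γ) →
      τ ⊢ app ⟦ forId (singleˣ M) x ⟧ᵀ (ρ , η) ≈ app (varᴴ x) (app ⟦ M ⟧ᵀ (ρ , η) , η)
    same η (here refl)   = Dom.≈-refl σ
    same η {τ} (there x) = Dom.≈-refl τ

  []ⁱ-⇔ : ∀ (φ : Spec (suc Δ) Γ) E ρ η₀ η₁ r →
    ⟨ ρ , η₀ , η₁ , r ⟩⊨ φ [ E ]ⁱ ⇔ ⟨ ⟦ E ⟧ᴱ ρ ∷ ρ , η₀ , η₁ , r ⟩⊨ φ
  []ⁱ-⇔ {Γ = Γ} φ E ρ η₀ η₁ r = SpecEq-⇔ (subˢ-eq (singleⁱ {Γ = Γ} E) φ) _ _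
    ( (λ { zero → refl ; (suc i) → refl })
    , (λ {τ} _ → Dom.≈-refl τ) , (λ {τ} _ → Dom.≈-refl τ) , ℛₘ.refl {r})

  infix 4 ⟨_,_,_,_⟩⊨*_

  ⟨_,_,_,_⟩⊨*_ : Stack Δ → Env Γ → Env Γ → ℛ → List (Spec Δ Γ) → Set₁
  ⟨ ρ , η₀ , η₁ , r ⟩⊨* Ψ = ∀ {φ} → φ ∈ Ψ → ⟨ ρ , η₀ , η₁ , r ⟩⊨ φ

  ⊨*-∷ : ∀ {ρ : Stack Δ} {η₀ η₁ : Env Γ} {r φ} {Ψ : List (Spec Δ Γ)} →
    ⟨ ρ , η₀ , η₁ , r ⟩⊨ φ → ⟨ ρ , η₀ , η₁ , r ⟩⊨* Ψ → ⟨ ρ , η₀ , η₁ , r ⟩⊨* (φ ∷ Ψ)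
  ⊨*-∷ x xs (here refl) = x
  ⊨*-∷ x xs (there i)   = xs i

  ⊨*-extend : ∀ {ρ : Stack Δ} {η₀ η₁ : Env Γ} {r} {Ψ : List (Spec Δ Γ)} s →
    ⟨ ρ , η₀ , η₁ , r ⟩⊨* Ψ → ⟨ ρ , η₀ , η₁ , r ⋆ s ⟩⊨* Ψ
  ⊨*-extend s xs {φ} i = ⊨-extend φ s (xs i)

  ⊨*-wkˣ : ∀ {Ψ : List (Spec Δ Γ)} ρ (m n : ∣ ⟦ σ ⟧ ∣) η₀ η₁ r →
    ⟨ ρ , η₀ , η₁ , r ⟩⊨* Ψ → ⟨ ρ , (m , η₀) , (n , η₁) , r ⟩⊨* map (renˢ (wkˣ {σ = σ})) Ψ
  ⊨*-wkˣ ρ m n η₀ η₁ r xs i with ∈-map⁻ (renˢ wkˣ) i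
  ... | φ , φ∈Ψ , refl = Equivalence.from (wkˣ-⇔ φ ρ m n η₀ η₁ r) (xs φ∈Ψ)

  ⊨*-wkⁱ : ∀ {Ψ : List (Spec Δ Γ)} v ρ η₀ η₁ r →
    ⟨ ρ , η₀ , η₁ , r ⟩⊨* Ψ → ⟨ v ∷ ρ , η₀ , η₁ , r ⟩⊨* map (renˢ wkⁱ) Ψ
  ⊨*-wkⁱ v ρ η₀ η₁ r xs i with ∈-map⁻ (renˢ wkⁱ) i
  ... | φ , φ∈Ψ , refl = Equivalence.from (wkⁱ-⇔ φ v ρ η₀ η₁ r) (xs φ∈Ψ)

  -- An implication at `r` speaks only of worlds `r ⋆ s`; the current world is recovered at `s = ε`
  -- through `r ⋆ ε ≅ r`.
  ⊨-⊃-elim : ∀ {ρ : Stack Δ} {η₀ η₁ : Env Γ} {r} (φ ψ : Spec Δ Γ) →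
    ⟨ ρ , η₀ , η₁ , r ⟩⊨ (φ ⊃ ψ) → ⟨ ρ , η₀ , η₁ , r ⟩⊨ φ → ⟨ ρ , η₀ , η₁ , r ⟩⊨ ψ
  ⊨-⊃-elim {r = r} φ ψ f x = ⊨-resp ψ (ℛₘ.identityʳ r) (f ε (⊨-extend φ ε x))

  -- Both sides are the same quadruple up to regrouping: `⊗` stores `Q` in the world, `✶` stores it
  -- next to the pre- and postcondition.
  ⊗-triple-⇔ : ∀ (P : Assn Δ) (M : Term Δ Γ com) P′ Q ρ η₀ η₁ r →
    ⟨ ρ , η₀ , η₁ , r ⟩⊨ (⟪ P ⟫ M ⟪ P′ ⟫ ⊗ Q) ⇔ ⟨ ρ , η₀ , η₁ , r ⟩⊨ ⟪ P ✶ Q ⟫ M ⟪ P′ ✶ Q ⟫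
  ⊗-triple-⇔ P M P′ Q ρ η₀ η₁ r = mk⇔
    (Quadruple-resp {c₀ = c₀} {c₀} {c₁} {c₁} (proj₁ (regroup P)) (proj₂ (regroup P′))
      (λ _ → refl) (λ _ → refl))
    (Quadruple-resp {c₀ = c₀} {c₀} {c₁} {c₁} (proj₂ (regroup P)) (proj₁ (regroup P′))
      (λ _ → refl) (λ _ → refl))
    where
    c₀ = app ⟦ M ⟧ᵀ (ρ , η₀)
    c₁ = app ⟦ M ⟧ᵀ (ρ , η₁)
    regroup : ∀ P → (eqᴬ (P ✶ Q) ρ ⋆ r) ≅ (eqᴬ P ρ ⋆ (r ⋆ eqᴬ Q ρ))
    regroup P = ℛₘ.trans (ℛₘ.∙-congʳ {r} (eqᴬ-✶ P Q ρ)) (xy∙z≈x∙zy (eqᴬ P ρ) (eqᴬ Q ρ) r)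

  sound : ∀ {Ψ : List (Spec Δ Γ)} {φ} → Ψ ⊢ φ → ∀ ρ η₀ η₁ r →
    ⟨ ρ , η₀ , η₁ , r ⟩⊨* Ψ → ⟨ ρ , η₀ , η₁ , r ⟩⊨ φ
  sound (assume i) ρ η₀ η₁ r Ψ = Ψ i
  sound (∧-intro d e) ρ η₀ η₁ r Ψ = sound d ρ η₀ η₁ r Ψ , sound e ρ η₀ η₁ r Ψ
  sound (∧-elimˡ d) ρ η₀ η₁ r Ψ = proj₁ (sound d ρ η₀ η₁ r Ψ)
  sound (∧-elimʳ d) ρ η₀ η₁ r Ψ = proj₂ (sound d ρ η₀ η₁ r Ψ)
  sound (∨-introˡ d) ρ η₀ η₁ r Ψ = inj₁ (sound d ρ η₀ η₁ r Ψ)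
  sound (∨-introʳ d) ρ η₀ η₁ r Ψ = inj₂ (sound d ρ η₀ η₁ r Ψ)
  sound (∨-elim d e f) ρ η₀ η₁ r Ψ with sound d ρ η₀ η₁ r Ψ
  ... | inj₁ x = sound e ρ η₀ η₁ r (⊨*-∷ x Ψ)
  ... | inj₂ y = sound f ρ η₀ η₁ r (⊨*-∷ y Ψ)
  sound (⊃-intro d) ρ η₀ η₁ r Ψ s x = sound d ρ η₀ η₁ (r ⋆ s) (⊨*-∷ x (⊨*-extend s Ψ))
  sound (⊃-elim {φ = φ} {ψ} d e) ρ η₀ η₁ r Ψ =
    ⊨-⊃-elim φ ψ (sound d ρ η₀ η₁ r Ψ) (sound e ρ η₀ η₁ r Ψ)
  sound (∀ˣ-intro d) ρ η₀ η₁ r Ψ m n =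
    sound d ρ (m , η₀) (n , η₁) r (⊨*-wkˣ ρ m n η₀ η₁ r Ψ)
  sound (∀ˣ-elim {φ = φ} d M) ρ η₀ η₁ r Ψ = Equivalence.from ([]ˣ-⇔ φ M ρ η₀ η₁ r)
    (sound d ρ η₀ η₁ r Ψ (app ⟦ M ⟧ᵀ (ρ , η₀)) (app ⟦ M ⟧ᵀ (ρ , η₁)))
  sound (∃ˣ-intro {φ = φ} M d) ρ η₀ η₁ r Ψ =
    app ⟦ M ⟧ᵀ (ρ , η₀) , app ⟦ M ⟧ᵀ (ρ , η₁) ,
    Equivalence.to ([]ˣ-⇔ φ M ρ η₀ η₁ r) (sound d ρ η₀ η₁ r Ψ)
  sound (∃ˣ-elim {χ = χ} d e) ρ η₀ η₁ r Ψ with sound d ρ η₀ η₁ r Ψ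
  ... | m , n , x = Equivalence.to (wkˣ-⇔ χ ρ m n η₀ η₁ r)
    (sound e ρ (m , η₀) (n , η₁) r (⊨*-∷ x (⊨*-wkˣ ρ m n η₀ η₁ r Ψ)))
  sound (∀ⁱ-intro d) ρ η₀ η₁ r Ψ v = sound d (v ∷ ρ) η₀ η₁ r (⊨*-wkⁱ v ρ η₀ η₁ r Ψ)
  sound (∀ⁱ-elim {φ = φ} d E) ρ η₀ η₁ r Ψ =
    Equivalence.from ([]ⁱ-⇔ φ E ρ η₀ η₁ r) (sound d ρ η₀ η₁ r Ψ (⟦ E ⟧ᴱ ρ))
  sound (∃ⁱ-intro {φ = φ} E d) ρ η₀ η₁ r Ψ =
    ⟦ E ⟧ᴱ ρ , Equivalence.to ([]ⁱ-⇔ φ E ρ η₀ η₁ r) (sound d ρ η₀ η₁ r Ψ)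
  sound (∃ⁱ-elim {χ = χ} d e) ρ η₀ η₁ r Ψ with sound d ρ η₀ η₁ r Ψ
  ... | v , x = Equivalence.to (wkⁱ-⇔ χ v ρ η₀ η₁ r)
    (sound e (v ∷ ρ) η₀ η₁ r (⊨*-∷ x (⊨*-wkⁱ v ρ η₀ η₁ r Ψ)))
  sound (≐ᴱ-refl E) ρ η₀ η₁ r Ψ = lift refl
  sound (≐ᴱ-subst {E = E} {F} φ d e) ρ η₀ η₁ r Ψ with sound d ρ η₀ η₁ r Ψ
  ... | lift E≡F = Equivalence.from ([]ⁱ-⇔ φ F ρ η₀ η₁ r)
    (subst (λ v → ⟨ v ∷ ρ , η₀ , η₁ , r ⟩⊨ φ) E≡F
      (Equivalence.to ([]ⁱ-⇔ φ E ρ η₀ η₁ r) (sound e ρ η₀ η₁ r Ψ)))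
  sound (≐ᵀ-refl {σ = σ} M) ρ η₀ η₁ r Ψ = lift (Dom.≈-refl σ , Dom.≈-refl σ)
  sound {Γ = Γ} (≐ᵀ-subst {M = M} {N} φ d e) ρ η₀ η₁ r Ψ with sound d ρ η₀ η₁ r Ψ
  ... | lift (M≈N₀ , M≈N₁) = Equivalence.from ([]ˣ-⇔ φ N ρ η₀ η₁ r)
    -- The two denotations are equal only in the setoid sense, so invariance of satisfaction
    -- replaces rewriting.
    (sat⇒ (≈ˢ-eq φ) _ _
      (refl , (M≈N₀ , FMCpo.≈-refl ⟦ Γ ⟧ᶜ) , (M≈N₁ , FMCpo.≈-refl ⟦ Γ ⟧ᶜ) , ℛₘ.refl {r})
      (Equivalence.to ([]ˣ-⇔ φ M ρ η₀ η₁ r) (sound e ρ η₀ η₁ r Ψ)))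
  sound (exists {P = P} {M} {Q}) ρ η₀ η₁ r Ψ s all = Valid⇒⊨ ρ η₀ η₁ (r ⋆ s) (∃ᴬ P) M (∃ᴬ Q) λ t →
    exists-valid (r ⋆ s ⋆ t) ρ η₀ η₁ λ v → ⊨⇒Valid (v ∷ ρ) η₀ η₁ (r ⋆ s) P (renᵀ wkⁱ M) Q (all v) t
  sound (disjunction {P = P} {P′} {M} {Q} {Q′}) ρ η₀ η₁ r Ψ s (x , y) =
    Valid⇒⊨ ρ η₀ η₁ (r ⋆ s) (P ∨ᴬ P′) M (Q ∨ᴬ Q′) λ t →
      disjunction-valid (r ⋆ s ⋆ t) ρ η₀ η₁
        (⊨⇒Valid ρ η₀ η₁ (r ⋆ s) P M Q x t) (⊨⇒Valid ρ η₀ η₁ (r ⋆ s) P′ M Q′ y t)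
  sound (conditional {P = P} {E} {F} {M} {N} {Q}) ρ η₀ η₁ r Ψ s (x , y) =
    Valid⇒⊨ ρ η₀ η₁ (r ⋆ s) P (if E ≐ F then M else N) Q λ t → conditional-valid (r ⋆ s ⋆ t) ρ η₀ η₁
      (⊨⇒Valid ρ η₀ η₁ (r ⋆ s) (P ∧ᴬ E ≐ᴬ F) M Q x t)
      (⊨⇒Valid ρ η₀ η₁ (r ⋆ s) (P ∧ᴬ E ≢ᴬ F) N Q y t)
  sound (sequence {P = P} {P₀} {Q} {M} {N}) ρ η₀ η₁ r Ψ s (x , y) =
    Valid⇒⊨ ρ η₀ η₁ (r ⋆ s) P (M ⨾ N) Q λ t →
      sequence-valid (r ⋆ s ⋆ t) ρ η₀ η₁
        (⊨⇒Valid ρ η₀ η₁ (r ⋆ s) P M P₀ x t) (⊨⇒Valid ρ η₀ η₁ (r ⋆ s) P₀ N Q y t)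
  sound (allocate {P = P} {M} {Q}) ρ η₀ η₁ r Ψ s all = Valid⇒⊨ ρ η₀ η₁ (r ⋆ s) P (let-new M) Q λ t →
    allocate-valid (r ⋆ s ⋆ t) ρ η₀ η₁ λ v →
      ⊨⇒Valid (v ∷ ρ) η₀ η₁ (r ⋆ s) (wkᴬ P ✶ svar zero ↦ zeroᴱ , zeroᴱ) M (wkᴬ Q) (all v) t
  sound (read {P = P} {E} {E₁} {M} {Q}) ρ η₀ η₁ r Ψ s all =
    Valid⇒⊨ ρ η₀ η₁ (r ⋆ s) (∃ᴬ (P ✶ wkᴱ E ↦ svar zero , E₁)) (let-read E 0F M) Q λ t →
      read-valid (r ⋆ s ⋆ t) ρ η₀ η₁ λ v →
        ⊨⇒Valid (v ∷ ρ) η₀ η₁ (r ⋆ s) (P ✶ wkᴱ E ↦ svar zero , E₁) M (wkᴬ Q) (all v) t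
  sound {Γ = Γ} (dispose {E = E}) ρ η₀ η₁ r Ψ =
    Valid⇒⊨ ρ η₀ η₁ r (E ↦–) (free {Γ = Γ} E) emp λ t → dispose-valid (r ⋆ t) ρ η₀ η₁
  sound {Γ = Γ} (write {E = E} {E₁} {F}) ρ η₀ η₁ r Ψ =
    Valid⇒⊨ ρ η₀ η₁ r (E ↦–, E₁) (assign {Γ = Γ} E 0F F) (E ↦ F , E₁) λ t →
      write-valid (r ⋆ t) ρ η₀ η₁
  sound (consequence {P = P} {P′} {Q} {Q′} {M} P⊆P′ Q′⊆Q) ρ η₀ η₁ r Ψ s =
    Quadruple-resp {c₀ = c₀} {c₀} {c₁} {c₁}
      (⋆-mono (eqᴬ-mono P P′ ρ (P⊆P′ ρ)) (⊆-refl {r ⋆ s}))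
      (⋆-mono (eqᴬ-mono Q′ Q ρ (Q′⊆Q ρ)) (⊆-refl {r ⋆ s})) (λ _ → refl) (λ _ → refl)
    where
    c₀ = app ⟦ M ⟧ᵀ (ρ , η₀)
    c₁ = app ⟦ M ⟧ᵀ (ρ , η₁)
  sound (⊗-extend {φ = φ} {P}) ρ η₀ η₁ r Ψ s = ⊨-extend φ (eqᴬ P ρ)
  sound (⊗-triple {P = P} {M} {P′} {Q}) ρ η₀ η₁ r Ψ =
    (λ s → Equivalence.to (⊗-triple-⇔ P M P′ Q ρ η₀ η₁ (r ⋆ s))) ,
    (λ s → Equivalence.from (⊗-triple-⇔ P M P′ Q ρ η₀ η₁ (r ⋆ s)))
  sound ⊗-≐ᴱ ρ η₀ η₁ r Ψ = (λ _ x → x) , λ _ x → x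
  sound ⊗-≐ᵀ ρ η₀ η₁ r Ψ = (λ _ x → x) , λ _ x → x
  sound (⊗-⊗ {φ = φ} {P} {Q}) ρ η₀ η₁ r Ψ =
    (λ s → ⊨-resp φ (ℛₘ.sym (regroup (r ⋆ s)))) , λ s → ⊨-resp φ (regroup (r ⋆ s))
    where
    -- The outer invariant enters the world first, hence `Q` before `P` on the right.
    regroup : ∀ r → (r ⋆ eqᴬ (P ✶ Q) ρ) ≅ (r ⋆ eqᴬ Q ρ ⋆ eqᴬ P ρ)
    regroup r = ℛₘ.trans (ℛₘ.∙-congˡ {r} (eqᴬ-✶ P Q ρ)) (x∙yz≈xz∙y r (eqᴬ P ρ) (eqᴬ Q ρ))
  sound (⊗-⊃ {φ = φ} {ψ} {P}) ρ η₀ η₁ r Ψ =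
    -- On the left the invariant is adjoined before the extension `t`, on the right after it, so
    -- each passage exchanges the two.
    (λ s f t x → ⊨-resp ψ (xy∙z≈xz∙y (r ⋆ s) p t) (f t (⊨-resp φ (xy∙z≈xz∙y (r ⋆ s) t p) x))) ,
    (λ s f t x → ⊨-resp ψ (xy∙z≈xz∙y (r ⋆ s) t p) (f t (⊨-resp φ (xy∙z≈xz∙y (r ⋆ s) p t) x)))
    where p = eqᴬ P ρ
  sound ⊗-∧ ρ η₀ η₁ r Ψ = (λ _ x → x) , λ _ x → x
  sound ⊗-∨ ρ η₀ η₁ r Ψ = (λ _ x → x) , λ _ x → x
  sound ⊗-∀ˣ ρ η₀ η₁ r Ψ = (λ _ x → x) , λ _ x → x
  sound ⊗-∃ˣ ρ η₀ η₁ r Ψ = (λ _ x → x) , λ _ x → x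
  sound (⊗-∀ⁱ {φ = φ} {P}) ρ η₀ η₁ r Ψ =
    (λ s x v → ⊨-resp φ (ℛₘ.∙-congˡ {r ⋆ s} (ℛₘ.sym (eqᴬ-wk P v ρ))) (x v)) ,
    (λ s x v → ⊨-resp φ (ℛₘ.∙-congˡ {r ⋆ s} (eqᴬ-wk P v ρ)) (x v))
  sound (⊗-∃ⁱ {φ = φ} {P}) ρ η₀ η₁ r Ψ =
    (λ s (v , x) → v , ⊨-resp φ (ℛₘ.∙-congˡ {r ⋆ s} (ℛₘ.sym (eqᴬ-wk P v ρ))) x) ,
    (λ s (v , x) → v , ⊨-resp φ (ℛₘ.∙-congˡ {r ⋆ s} (eqᴬ-wk P v ρ)) x)
  sound (fix-induction γ M) ρ η₀ η₁ r Ψ s = fix-induction-valid γ M ρ η₀ η₁ (r ⋆ s)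

theorem8p1 : (em : ExcludedMiddle 0ℓ) → let open Semantics em in
    (Δ : ℕ) (Γ : Ctx) (φ : Spec Δ Γ) → [] ⊢ φ →
    (ρ : Stack Δ) (η₀ η₁ : ∣ ⟦ Γ ⟧ᶜ ∣) (r : ℛ) → ⟨ ρ , η₀ , η₁ , r ⟩⊨ φ
theorem8p1 em Δ Γ φ ⊢φ ρ η₀ η₁ r = Soundness.sound em ⊢φ ρ η₀ η₁ r λ ()
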